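{- Let $B$ be a finite connected left regular band and $\Bbbk$ a commutative ring with unit. Then the augmented simplicial chain complex $C_\bullet(\Delta(B);\Bbbk)\xrightarrow{\varepsilon}\Bbbk$ of the order complex of $B$ (with $B$ acting by left multiplication) is a projective resolution of the trivial $\Bbbk B$-module. More precisely, fixing $e_X$ with $Be_X=X$ for each $X\in\Lambda(B)$, $$C_q(\Delta(B);\Bbbk)\cong\bigoplus_{X\in\Lambda(B)} n_X\cdot\Bbbk L_X,$$ where $n_X$ is the number of $q$-simplices of $\Delta(e_XB)$ having $e_X$ as a vertex.
   Context: A left regular band is a finite semigroup $B$ with $x^2=x$, $xyx=xy$, partially ordered by $a\le b$ iff $ba=a$; left multiplication is order preserving, so $B$ acts on its order complex $\Delta(B)$ (simplices = nonempty chains) by simplicial maps, making the chain complex a complex of $\Bbbk B$-modules. $\Lambda(B)=\{Bb\}$ ordered by inclusion; $B_{\ge X}=\{b\mid Bb\supseteq X\}$; $B$ is connected if every $\Delta(B_{\ge X})$ is connected. The trivial module $\Bbbk$ has all $b$ acting as $1$. $L_X=\{b\mid Bb=X\}$ and $\Bbbk L_X$ is the free $\Bbbk$-module on $L_X$ with $a\cdot b=ab$ if $Ba\supseteq X$, $0$ otherwise. -}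

module Defs where

open import Level using (Level; _⊔_; Setω) renaming (suc to lsuc)
open import Data.Nat as ℕ using (ℕ; zero; suc)
open import Data.Fin using (Fin; zero; suc)
open import Data.Fin.Properties using (any?; all?) renaming (_≟_ to _≟F_)
open import Data.Vec using (Vec; []; _∷_; map; removeAt)
open import Data.Vec.Properties using (≡-dec)
open import Data.Vec.Relation.Unary.All using (All) renaming (all? to allV?)
open import Data.Vec.Relation.Unary.Any using (Any) renaming (any? to anyV?)
open import Data.Product using (Σ; Σ-syntax; ∃; ∃-syntax; _×_; _,_)
open import Data.Sum using (_⊎_)
open import Data.Unit using (⊤)
open import Data.Empty using (⊥)
open import Function using (flip)
open import Relation.Nullary using (¬_; Dec; yes; no)
open import Relation.Nullary.Decidable using (_×-dec_; _→-dec_; ¬?; _⊎-dec_)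
open import Relation.Binary.PropositionalEquality using (_≡_; _≢_)
open import Relation.Binary.Construct.Closure.ReflexiveTransitive using (Star)
open import Algebra.Bundles using (CommutativeRing)
open import Algebra.Module.Structures using (IsModule)

record LRB (n : ℕ) : Set where
  infixl 7 _·_
  field
    _·_     : Fin n → Fin n → Fin n
    assoc   : ∀ x y z → (x · y) · z ≡ x · (y · z)
    idem    : ∀ x → x · x ≡ x
    leftReg : ∀ x y → x · y · x ≡ x · y

module LRBTheory {n : ℕ} (B : LRB n) where
  open LRB B public

  _≤_ : Fin n → Fin n → Set
  a ≤ b = b · a ≡ a

  _<_ : Fin n → Fin n → Set
  a < b = (a ≤ b) × (a ≢ b)

  _<?_ : ∀ a b → Dec (a < b)
  a <? b = ((b · a) ≟F a) ×-dec ¬? (a ≟F b)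

  _∈B·_ : Fin n → Fin n → Set
  x ∈B· b = ∃[ y ] (y · b ≡ x)

  _∈B·?_ : ∀ x b → Dec (x ∈B· b)
  x ∈B·? b = any? (λ y → (y · b) ≟F x)

  _∈·B_ : Fin n → Fin n → Set
  x ∈·B b = ∃[ z ] (b · z ≡ x)

  _∈·B?_ : ∀ x b → Dec (x ∈·B b)
  x ∈·B? b = any? (λ z → (b · z) ≟F x)

  _⊆Λ_ : Fin n → Fin n → Set
  a ⊆Λ b = ∀ x → x ∈B· a → x ∈B· b

  _⊆Λ?_ : ∀ a b → Dec (a ⊆Λ b)
  a ⊆Λ? b = all? (λ x → (x ∈B·? a) →-dec (x ∈B·? b))

  _≡Λ_ : Fin n → Fin n → Set
  a ≡Λ b = (a ⊆Λ b) × (b ⊆Λ a)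

  _≡Λ?_ : ∀ a b → Dec (a ≡Λ b)
  a ≡Λ? b = (a ⊆Λ? b) ×-dec (b ⊆Λ? a)

  -- B_{≥ X} for X = B x :  b ∈ B_{≥X}  iff  B b ⊇ X
  InB≥ : Fin n → Fin n → Set
  InB≥ x b = x ⊆Λ b

  -- comparability graph (1-skeleton of the order complex) restricted to B_{≥X}
  Adj≥ : Fin n → Fin n → Fin n → Set
  Adj≥ x u v = InB≥ x u × InB≥ x v × (u ≤ v ⊎ v ≤ u)

  -- B connected: Δ(B_{≥X}) connected for every X ∈ Λ(B) (X = B x)
  Connected : Set
  Connected = ∀ x u v → InB≥ x u → InB≥ x v → Star (Adj≥ x) u v

  -- Simplices of Δ(B): nonempty chains, written increasingly x₀ < x₁ < … < x_q
  IsChain : ∀ {m} → Vec (Fin n) m → Set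
  IsChain []           = ⊤
  IsChain (x ∷ [])     = ⊤
  IsChain (x ∷ y ∷ xs) = (x < y) × IsChain (y ∷ xs)

  isChain? : ∀ {m} (v : Vec (Fin n) m) → Dec (IsChain v)
  isChain? []           = yes _
  isChain? (x ∷ [])     = yes _
  isChain? (x ∷ y ∷ xs) = (x <? y) ×-dec isChain? (y ∷ xs)

  _≟V_ : ∀ {m} (u v : Vec (Fin n) m) → Dec (u ≡ v)
  _≟V_ = ≡-dec _≟F_

  fsum : ∀ {a} {A : Set a} → (A → A → A) → A → (k : ℕ) → (Fin k → A) → A
  fsum _+_ z zero    f = z
  fsum _+_ z (suc k) f = f zero + fsum _+_ z k (λ i → f (suc i))

  vsum : ∀ {a} {A : Set a} → (A → A → A) → A → (m : ℕ) → (Vec (Fin n) m → A) → A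
  vsum _+_ z zero    f = f []
  vsum _+_ z (suc m) f = fsum _+_ z n (λ i → vsum _+_ z m (λ v → f (i ∷ v)))

  count : (m : ℕ) (P : Vec (Fin n) m → Set) → (∀ v → Dec (P v)) → ℕ
  count m P P? = vsum ℕ._+_ 0 m (λ v → ind (P? v))
    where
      ind : ∀ {p} {Q : Set p} → Dec Q → ℕ
      ind (yes _) = 1
      ind (no _)  = 0

  nSimp : ℕ → Fin n → ℕ
  nSimp q e = count (suc q) (λ σ → IsChain σ × All (_∈·B e) σ × Any (e ≡_) σ)
                     (λ σ → isChain? σ ×-dec allV? (_∈·B? e) σ ×-dec anyV? (e ≟F_) σ)

  -- a choice of e_X with B e_X = X for every X ∈ Λ(B), given as a function
  -- e : B → B constant on each L_X with B (e b) = B b.  Then Λ(B) ↔ {b | e b ≡ b}.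
  IsRepChoice : (Fin n → Fin n) → Set
  IsRepChoice e = (∀ b → e b ≡Λ b) × (∀ a b → a ≡Λ b → e a ≡ e b)

module KB {c ℓ : Level} (R : CommutativeRing c ℓ) {n : ℕ} (B : LRB n) where
  open LRBTheory B
  open CommutativeRing R renaming (Carrier to K; _≈_ to _≈K_; _+_ to _+K_; _*_ to _*K_; -_ to -K_)

  record RawKBMod (m ℓm : Level) : Set (lsuc (m ⊔ ℓm) ⊔ c) where
    infixr 7 _*ₗ_ _▷_
    infixl 6 _+ᴹ_
    infix 4 _≈ᴹ_
    field
      M     : Set m
      _≈ᴹ_  : M → M → Set ℓm
      _+ᴹ_  : M → M → M
      0ᴹ    : M
      -ᴹ_   : M → M
      _*ₗ_  : K → M → M
      _▷_   : Fin n → M → M     -- action of b ∈ B (extended linearly to kB)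

  record IsKBModule {m ℓm} (A : RawKBMod m ℓm) : Set (m ⊔ ℓm ⊔ c ⊔ ℓ) where
    open RawKBMod A
    field
      isModule : IsModule R _≈ᴹ_ _+ᴹ_ 0ᴹ -ᴹ_ _*ₗ_ (flip _*ₗ_)
      ▷-cong   : ∀ b {x y} → x ≈ᴹ y → b ▷ x ≈ᴹ b ▷ y
      ▷-+      : ∀ b x y → b ▷ (x +ᴹ y) ≈ᴹ b ▷ x +ᴹ b ▷ y
      ▷-*ₗ     : ∀ b r x → b ▷ (r *ₗ x) ≈ᴹ r *ₗ (b ▷ x)
      ▷-assoc  : ∀ a b x → (a · b) ▷ x ≈ᴹ a ▷ (b ▷ x)

  record KBModule (m ℓm : Level) : Set (lsuc (m ⊔ ℓm) ⊔ c ⊔ ℓ) where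
    field
      raw        : RawKBMod m ℓm
      isKBModule : IsKBModule raw
    open RawKBMod raw public

  record IsHom {m ℓm m' ℓm'} (A : RawKBMod m ℓm) (A' : RawKBMod m' ℓm')
               (f : RawKBMod.M A → RawKBMod.M A') : Set (m ⊔ ℓm ⊔ ℓm' ⊔ c) where
    private
      module A  = RawKBMod A
      module A' = RawKBMod A'
    field
      cong : ∀ {x y} → x A.≈ᴹ y → f x A'.≈ᴹ f y
      +-hom : ∀ x y → f (x A.+ᴹ y) A'.≈ᴹ f x A'.+ᴹ f y
      *ₗ-hom : ∀ r x → f (r A.*ₗ x) A'.≈ᴹ r A'.*ₗ f x
      ▷-hom : ∀ b x → f (b A.▷ x) A'.≈ᴹ b A'.▷ f x

  record Hom {m ℓm m' ℓm'} (A : RawKBMod m ℓm) (A' : RawKBMod m' ℓm')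
             : Set (m ⊔ ℓm ⊔ m' ⊔ ℓm' ⊔ c) where
    field
      fun   : RawKBMod.M A → RawKBMod.M A'
      isHom : IsHom A A' fun

  Iso : ∀ {m ℓm m' ℓm'} → RawKBMod m ℓm → RawKBMod m' ℓm' → Set (m ⊔ ℓm ⊔ m' ⊔ ℓm' ⊔ c)
  Iso A A' = Σ[ φ ∈ Hom A A' ] Σ[ ψ ∈ Hom A' A ]
               ((∀ x → RawKBMod._≈ᴹ_ A (Hom.fun ψ (Hom.fun φ x)) x) ×
                (∀ y → RawKBMod._≈ᴹ_ A' (Hom.fun φ (Hom.fun ψ y)) y))

  Projective : ∀ {p ℓp} (m ℓm m' ℓm' : Level) → RawKBMod p ℓp → Set _
  Projective m ℓm m' ℓm' P =
    (Mo : KBModule m ℓm) (No : KBModule m' ℓm') (g : Hom (KBModule.raw Mo) (KBModule.raw No)) →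
    (∀ y → ∃[ x ] (KBModule._≈ᴹ_ No (Hom.fun g x) y)) →
    (h : Hom P (KBModule.raw No)) →
    Σ[ l ∈ Hom P (KBModule.raw Mo) ] (∀ x → KBModule._≈ᴹ_ No (Hom.fun g (Hom.fun l x)) (Hom.fun h x))

  Σv : (m : ℕ) → (Vec (Fin n) m → K) → K
  Σv = vsum _+K_ 0#

  Σf : (k : ℕ) → (Fin k → K) → K
  Σf = fsum _+K_ 0#

  when : ∀ {p} {P : Set p} → Dec P → K → K
  when (yes _) x = x
  when (no _)  x = 0#

  sign : ∀ {k} → Fin k → K
  sign zero    = 1#
  sign (suc i) = -K sign i

  -- C_q(Δ(B);k): free k-module on the q-simplices.  An element is a function on
  -- vectors of length q+1; only its values on chains (the q-simplices) matter.
  C : ℕ → RawKBMod c ℓ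
  C q = record
    { M    = Vec (Fin n) (suc q) → K
    ; _≈ᴹ_ = λ f g → ∀ σ → IsChain σ → f σ ≈K g σ
    ; _+ᴹ_ = λ f g σ → f σ +K g σ
    ; 0ᴹ   = λ _ → 0#
    ; -ᴹ_  = λ f σ → -K f σ
    ; _*ₗ_ = λ r f σ → r *K f σ
      -- b·σ = (bx₀,…,bx_q); if degenerate it is not a chain, i.e. it is 0
    ; _▷_  = λ b f τ → Σv (suc q) (λ σ → when (isChain? σ) (when (map (b ·_) σ ≟V τ) (f σ)))
    }

  ∂ : (q : ℕ) → RawKBMod.M (C (suc q)) → RawKBMod.M (C q)
  ∂ q f τ = Σv (suc (suc q)) (λ σ → when (isChain? σ)
              (Σf (suc (suc q)) (λ i → when (removeAt σ i ≟V τ) (sign i *K f σ))))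

  ε : RawKBMod.M (C 0) → K
  ε f = Σf n (λ v → f (v ∷ []))

  triv : RawKBMod c ℓ
  triv = record
    { M = K ; _≈ᴹ_ = _≈K_ ; _+ᴹ_ = _+K_ ; 0ᴹ = 0# ; -ᴹ_ = -K_ ; _*ₗ_ = _*K_ ; _▷_ = λ _ r → r }

  -- ⊕_{X ∈ Λ(B)} n_X · kL_X, with X ↔ its chosen representative b = e_X (e b ≡ b),
  -- n_X = nSimp q b copies, and kL_X free on L_X = {a | B a = B b}.
  -- Action on kL_X: c·a = c a if B c ⊇ X, 0 otherwise.
  D : (Fin n → Fin n) → ℕ → RawKBMod c ℓ
  D e q = record
    { M    = (b : Fin n) → Fin (nSimp q b) → Fin n → K
    ; _≈ᴹ_ = λ f g → ∀ b → e b ≡ b → ∀ j a → a ≡Λ b → f b j a ≈K g b j a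
    ; _+ᴹ_ = λ f g b j a → f b j a +K g b j a
    ; 0ᴹ   = λ _ _ _ → 0#
    ; -ᴹ_  = λ f b j a → -K f b j a
    ; _*ₗ_ = λ r f b j a → r *K f b j a
    ; _▷_  = λ c' f b j a' → Σf n (λ a → when (a ≡Λ? b) (when (b ⊆Λ? c')
                                   (when ((c' · a) ≟F a') (f b j a))))
    }

  record IsProjectiveResolution : Setω where
    field
      C-isKBModule    : ∀ q → IsKBModule (C q)
      triv-isKBModule : IsKBModule triv
      ∂-hom           : ∀ q → IsHom (C (suc q)) (C q) (∂ q)
      ε-hom           : IsHom (C 0) triv ε
      ε∘∂≈0           : ∀ f → ε (∂ 0 f) ≈K 0#
      ∂∘∂≈0           : ∀ q f → RawKBMod._≈ᴹ_ (C q) (∂ q (∂ (suc q) f)) (RawKBMod.0ᴹ (C q))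
      ε-surjective    : ∀ r → ∃[ f ] (ε f ≈K r)
      exact-C₀        : ∀ f → ε f ≈K 0# → ∃[ g ] (RawKBMod._≈ᴹ_ (C 0) (∂ 0 g) f)
      exact-C         : ∀ q f → RawKBMod._≈ᴹ_ (C q) (∂ q f) (RawKBMod.0ᴹ (C q)) →
                          ∃[ g ] (RawKBMod._≈ᴹ_ (C (suc q)) (∂ (suc q) g) f)
      C-projective    : ∀ q (m ℓm m' ℓm' : Level) → Projective m ℓm m' ℓm' (C q)

record _×ω_ (A : Setω) {b : Level} (B : Set b) : Setω where
  constructor _,ω_
  field
    fstω : A
    sndω : B

{-# OPTIONS --safe #-}
module Submission where

-- Order the representatives e_X linearly by a refinement of inclusion of the X and put
-- f_X = e_X (1 - e_Y) ⋯ (1 - e_Z), the product running over all earlier representatives, the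
-- earliest one last. Then x Σ f_X = x for all x ∈ B by telescoping, and c f_X = 0 if B c ⊊ X,
-- because c w e_Y = c w whenever B c ⊆ Y. Hence a ↦ a f_X m is a homomorphism from kL_X to any
-- module, for any m in it, which gives both the projectivity of kL_X and the inverse of the
-- homomorphism C_q → ⊕ n_X kL_X sending a simplex σ = (x_0 < … < x_q) to the sum over the X ⊆ B x_q
-- of x_q e_X in the copy of kL_X belonging to e_X σ (or 0, if e_X σ is degenerate).
--
-- Connectedness makes Σ f_X a left identity as well. Suppose that the coefficients of (1 - Σ f_Y) b
-- on L_Y vanish for all Y ⊋ X. Right multiplication by z ∈ L_X then does not change those on L_X, so
-- they agree for b and b z, hence for comparable b and b′ in B_{≥X}, hence for b and e_X; but
-- (1 - Σ f_Y) e_X vanishes on L_X.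
--
-- Finally b maps Δ(B) into the cone under b, so it maps cycles to boundaries, and a cycle is
-- Σ f_X applied to itself.

open import Defs
open import Algebra.Bundles using (AbelianGroup; CommutativeRing)
open import Algebra.Module.Structures using (IsModule)
open import Algebra.Module.Structures.Biased using (IsModuleFromLeft)
import Algebra.Properties.AbelianGroup as AbelianGroupProperties
import Algebra.Properties.Ring as RingProperties
open import Algebra.Structures using (IsMonoid)
open import Data.Empty using (⊥-elim)
open import Data.Fin using (Fin; zero; suc; toℕ; splitAt; _↑ˡ_; _↑ʳ_)
open import Data.Fin.Induction using (spo-noetherian)
open import Data.Fin.Properties using (toℕ<n; toℕ-injective; splitAt-↑ˡ; splitAt-↑ʳ; splitAt⁻¹-↑ˡ; splitAt⁻¹-↑ʳ)
  renaming (_≟_ to _≟F_)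
open import Data.Nat as ℕ using (ℕ; zero; suc)
import Data.Nat.Properties as ℕₚ
open import Data.Product using (Σ; ∃; ∃-syntax; _×_; _,_; proj₁; proj₂)
open import Data.Sum using (inj₁; inj₂)
open import Data.Vec using (Vec; []; _∷_; _∷ʳ_; map; removeAt)
open import Data.Vec.Relation.Unary.All as All using (All; []; _∷_) renaming (all? to allV?)
open import Data.Vec.Relation.Unary.AllPairs using (AllPairs; []; _∷_)
open import Data.Vec.Relation.Unary.Any using (Any; here; there) renaming (any? to anyV?)
open import Function using (_∘_; flip)
open import Induction.WellFounded using (Acc; acc)
open import Level using (Level; Setω; _⊔_)
open import Relation.Binary.Construct.Closure.ReflexiveTransitive using (Star; _◅_) renaming (ε to ⟨⟩)
open import Relation.Binary.Definitions using (DecidableEquality; tri<; tri≈; tri>)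
open import Relation.Binary.PropositionalEquality as ≡ using (_≡_; _≢_; refl)
import Relation.Binary.Reasoning.Setoid as SetoidReasoning
open import Relation.Nullary using (¬_; Dec; yes; no)
open import Relation.Nullary.Decidable using (_×-dec_)

-- A product of factors 1 - e_Y is therefore not an element of kB but an operator `T k`, defined
-- alike on every module and commuting with all homomorphisms; over all representatives it becomes
-- `T keyBound`, which is 1 - Σ f_X. Left multiplication by any c kills it at once, but exactness
-- needs it to vanish by itself: cones only fill cycles of the form b times a cycle, so every cycle
-- has to be a sum of such. This is proved on C_0, which is kB as a left module and where the
-- coefficients of (1 - Σ f_X) b are visible. Right multiplication by elements of L_X relates it to
-- kL_X, and the decomposition of C_q into copies of kL_X takes it to all degrees. The decomposition
-- is invertible by triangularity: passing through C_q from a copy of kL_X to a copy of kL_Y is 0 or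
-- a ↦ a f_X e_Y, nonzero only for Y ⊆ X, and for Y strictly inside X the factor 1 - e_Y of f_X
-- kills e_Y in kL_Y.

module Order {n : ℕ} (B : LRB n) where
  open LRBTheory B
  open ≡ using (cong; cong₂; subst; sym; trans)
  open ≡.≡-Reasoning

  -- Since b is a right identity of B b, the inclusion B a ⊆ B b is the equation a b = a.
  infix 4 _⊑_ _⊏_
  _⊑_ : Fin n → Fin n → Set
  a ⊑ b = a · b ≡ a

  _⊏_ : Fin n → Fin n → Set
  a ⊏ b = a ⊑ b × ¬ (b ⊑ a)

  ⊆Λ⇒⊑ : ∀ {a b} → a ⊆Λ b → a ⊑ b
  ⊆Λ⇒⊑ {a} {b} p with y , eq ← p a (a , idem a) = begin
    a · b        ≡⟨ cong (_· b) eq ⟨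
    y · b · b    ≡⟨ assoc y b b ⟩
    y · (b · b)  ≡⟨ cong (y ·_) (idem b) ⟩
    y · b        ≡⟨ eq ⟩
    a            ∎

  ⊑⇒⊆Λ : ∀ {a b} → a ⊑ b → a ⊆Λ b
  ⊑⇒⊆Λ {a} {b} p x (y , refl) = x , (begin
    y · a · b    ≡⟨ assoc y a b ⟩
    y · (a · b)  ≡⟨ cong (y ·_) p ⟩
    y · a        ∎)

  ⊑-refl : ∀ a → a ⊑ a
  ⊑-refl = idem

  ⊑-trans : ∀ {a b c} → a ⊑ b → b ⊑ c → a ⊑ c
  ⊑-trans {a} {b} {c} p q = begin
    a · c        ≡⟨ cong (_· c) p ⟨
    a · b · c    ≡⟨ assoc a b c ⟩
    a · (b · c)  ≡⟨ cong (a ·_) q ⟩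
    a · b        ≡⟨ p ⟩
    a            ∎

  ·-⊑ˡ : ∀ a b → a · b ⊑ a
  ·-⊑ˡ = leftReg

  ·-⊑ʳ : ∀ a b → a · b ⊑ b
  ·-⊑ʳ a b = trans (assoc a b b) (cong (a ·_) (idem b))

  ⊑-· : ∀ {a b c} → a ⊑ b → a ⊑ c → a ⊑ b · c
  ⊑-· {a} {b} {c} p q = begin
    a · (b · c)  ≡⟨ assoc a b c ⟨
    a · b · c    ≡⟨ cong (_· c) p ⟩
    a · c        ≡⟨ q ⟩
    a            ∎

  ≡Λ⇒⊑ : ∀ {a b} → a ≡Λ b → a ⊑ b
  ≡Λ⇒⊑ p = ⊆Λ⇒⊑ (proj₁ p)

  ≡Λ⇒⊒ : ∀ {a b} → a ≡Λ b → b ⊑ a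
  ≡Λ⇒⊒ p = ⊆Λ⇒⊑ (proj₂ p)

  ⊑-antisym : ∀ {a b} → a ⊑ b → b ⊑ a → a ≡Λ b
  ⊑-antisym p q = ⊑⇒⊆Λ p , ⊑⇒⊆Λ q

  ≡Λ-refl : ∀ a → a ≡Λ a
  ≡Λ-refl a = ⊑-antisym (⊑-refl a) (⊑-refl a)

  ≡Λ-sym : ∀ {a b} → a ≡Λ b → b ≡Λ a
  ≡Λ-sym (p , q) = q , p

  ≡Λ-trans : ∀ {a b c} → a ≡Λ b → b ≡Λ c → a ≡Λ c
  ≡Λ-trans (p , q) (p′ , q′) = (λ x → p′ x ∘ p x) , (λ x → q x ∘ q′ x)

  ≤-refl : ∀ a → a ≤ a
  ≤-refl = idem

  ≤-trans : ∀ {a b c} → a ≤ b → b ≤ c → a ≤ c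
  ≤-trans {a} {b} {c} p q = begin
    c · a        ≡⟨ cong (c ·_) p ⟨
    c · (b · a)  ≡⟨ assoc c b a ⟨
    c · b · a    ≡⟨ cong (_· a) q ⟩
    b · a        ≡⟨ p ⟩
    a            ∎

  ≤-⊒⇒≡ : ∀ {a b} → a ≤ b → b ⊑ a → a ≡ b
  ≤-⊒⇒≡ p q = trans (sym p) q

  ≤⇒⊑ : ∀ {a b} → a ≤ b → a ⊑ b
  ≤⇒⊑ {a} {b} p = begin
    a · b        ≡⟨ cong (_· b) p ⟨
    b · a · b    ≡⟨ leftReg b a ⟩
    b · a        ≡⟨ p ⟩
    a            ∎

  ≤-antisym : ∀ {a b} → a ≤ b → b ≤ a → a ≡ b
  ≤-antisym p q = ≤-⊒⇒≡ p (≤⇒⊑ q)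

  ·-mono-≤ : ∀ c {a b} → a ≤ b → (c · a) ≤ (c · b)
  ·-mono-≤ c {a} {b} p = begin
    c · b · (c · a)    ≡⟨ assoc (c · b) c a ⟨
    c · b · c · a      ≡⟨ cong (_· a) (leftReg c b) ⟩
    c · b · a          ≡⟨ assoc c b a ⟩
    c · (b · a)        ≡⟨ cong (c ·_) p ⟩
    c · a              ∎

  ·-≤ : ∀ a b → (a · b) ≤ a
  ·-≤ a b = trans (sym (assoc a a b)) (cong (_· b) (idem a))

  <-trans : ∀ {a b c} → a < b → b < c → a < c
  <-trans (p , p′) (q , q′) =
    ≤-trans p q , λ { refl → p′ (≤-antisym p q) }

  -- Simplices

  -- Left multiplication may merge vertices, so weak chains rather than chains are closed under it.
  -- Comparing all pairs, not only neighbours, makes the passage to a face immediate.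
  Weak : ∀ {m} → Vec (Fin n) m → Set
  Weak = AllPairs _≤_

  chain⇒pairs : ∀ {m} (w : Vec (Fin n) m) → IsChain w → AllPairs _<_ w
  chain⇒pairs [] _ = []
  chain⇒pairs (x ∷ []) _ = [] ∷ []
  chain⇒pairs (x ∷ y ∷ w) (p , c) with chain⇒pairs (y ∷ w) c
  ... | q ∷ qs = (p ∷ All.map (<-trans p) q) ∷ q ∷ qs

  chain⇒weak : ∀ {m} (w : Vec (Fin n) m) → IsChain w → Weak w
  chain⇒weak w c = go (chain⇒pairs w c)
    where
    go : ∀ {m} {w : Vec (Fin n) m} → AllPairs _<_ w → Weak w
    go [] = []
    go (p ∷ ps) = All.map proj₁ p ∷ go ps

  All-map : ∀ {P Q : Fin n → Set} {f : Fin n → Fin n} → (∀ {x} → P x → Q (f x)) →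
            ∀ {m} {w : Vec (Fin n) m} → All P w → All Q (map f w)
  All-map h [] = []
  All-map h (p ∷ ps) = h p ∷ All-map h ps

  weak-map : ∀ b {m} {w : Vec (Fin n) m} → Weak w → Weak (map (b ·_) w)
  weak-map b [] = []
  weak-map b (p ∷ ps) = All-map (·-mono-≤ b) p ∷ weak-map b ps

  All-snoc : ∀ {P : Fin n → Set} {x m} {w : Vec (Fin n) m} → All P w → P x → All P (w ∷ʳ x)
  All-snoc [] p = p ∷ []
  All-snoc (q ∷ qs) p = q ∷ All-snoc qs p

  weak-snoc : ∀ {x m} {w : Vec (Fin n) m} → Weak w → All (_≤ x) w → Weak (w ∷ʳ x)
  weak-snoc [] [] = [] ∷ []
  weak-snoc (p ∷ ps) (q ∷ qs) = All-snoc p q ∷ weak-snoc ps qs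

  All-map-≤ : ∀ b {m} (w : Vec (Fin n) m) → All (_≤ b) (map (b ·_) w)
  All-map-≤ b [] = []
  All-map-≤ b (x ∷ w) = ·-≤ b x ∷ All-map-≤ b w

  -- Entries with distinct images are distinct, and their order is already given. Contrapositively,
  -- a degenerate simplex stays degenerate under `b`.
  chain-map⁻ : ∀ b {m} {w : Vec (Fin n) m} → Weak w → IsChain (map (b ·_) w) → IsChain w
  chain-map⁻ b [] _ = _
  chain-map⁻ b (p ∷ []) _ = _
  chain-map⁻ b ((p ∷ _) ∷ ps@(_ ∷ _)) ((_ , q) , c) =
    (p , λ eq → q (cong (b ·_) eq)) , chain-map⁻ b ps c

  chain-init : ∀ {x m} (w : Vec (Fin n) m) → IsChain (w ∷ʳ x) → IsChain w
  chain-init [] _ = _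
  chain-init (y ∷ []) _ = _
  chain-init (y ∷ z ∷ w) (p , c) = p , chain-init (z ∷ w) c

  top : ∀ {m} → Vec (Fin n) (suc m) → Fin n
  top (x ∷ []) = x
  top (x ∷ y ∷ w) = top (y ∷ w)

  top-map : ∀ b {m} (w : Vec (Fin n) (suc m)) → top (map (b ·_) w) ≡ b · top w
  top-map b (x ∷ []) = refl
  top-map b (x ∷ y ∷ w) = top-map b (y ∷ w)

  Any-top : ∀ {m} (w : Vec (Fin n) (suc m)) → Any (top w ≡_) w
  Any-top (x ∷ []) = here refl
  Any-top (x ∷ y ∷ w) = there (Any-top (y ∷ w))

  weak⇒≤top : ∀ {m} {w : Vec (Fin n) (suc m)} → Weak w → All (_≤ top w) w
  weak⇒≤top {w = x ∷ []} _ = ≤-refl x ∷ []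
  weak⇒≤top {w = x ∷ y ∷ w} ((p ∷ _) ∷ ps) with weak⇒≤top ps
  ... | q ∷ qs = ≤-trans p q ∷ q ∷ qs

  All-top : ∀ {P : Fin n → Set} {m} {w : Vec (Fin n) (suc m)} → All P w → P (top w)
  All-top {w = x ∷ []} (p ∷ _) = p
  All-top {w = x ∷ y ∷ w} (p ∷ ps) = All-top ps

  ≤⇒map-fixed : ∀ {b m} {w : Vec (Fin n) m} → All (_≤ b) w → map (b ·_) w ≡ w
  ≤⇒map-fixed [] = refl
  ≤⇒map-fixed (p ∷ ps) = cong₂ _∷_ p (≤⇒map-fixed ps)

  ∈·B⇒≤ : ∀ {b x} → x ∈·B b → x ≤ b
  ∈·B⇒≤ {b} (z , refl) = ·-≤ b z

  IsFace : Fin n → ∀ {m} → Vec (Fin n) m → Set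
  IsFace e σ = IsChain σ × All (_∈·B e) σ × Any (e ≡_) σ

  face-fixed : ∀ {e m} {σ : Vec (Fin n) m} → IsFace e σ → map (e ·_) σ ≡ σ
  face-fixed (_ , p , _) = ≤⇒map-fixed (All.map ∈·B⇒≤ p)

  All-Any : ∀ {P : Fin n → Set} {e m} {w : Vec (Fin n) m} → All P w → Any (e ≡_) w → P e
  All-Any (p ∷ _) (here refl) = p
  All-Any (_ ∷ ps) (there q) = All-Any ps q

  -- `e` is the largest element of `e` B and occurs in `σ`.
  face-top : ∀ {e m} {σ : Vec (Fin n) (suc m)} → IsFace e σ → top σ ≡ e
  face-top {σ = σ} (c , p , q) =
    ≤-antisym (∈·B⇒≤ (All-top p)) (All-Any (weak⇒≤top (chain⇒weak σ c)) q)

  -- The image lies in `e` B in any case; it has `e` as a vertex because `e · top σ ≡ e`. This is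
  -- how the simplices counted by n_X arise from those of Δ(B).
  map-face : ∀ e {m} (σ : Vec (Fin n) (suc m)) → IsChain (map (e ·_) σ) → e ⊑ top σ →
             IsFace e (map (e ·_) σ)
  map-face e σ c p = c , inB σ , subst (λ x → Any (x ≡_) (map (e ·_) σ)) (trans (top-map e σ) p) (Any-top _)
    where
    inB : ∀ {m} (w : Vec (Fin n) m) → All (_∈·B e) (map (e ·_) w)
    inB [] = []
    inB (x ∷ w) = (x , refl) ∷ inB w

  map-· : ∀ a b {m} (w : Vec (Fin n) m) → map (a ·_) (map (b ·_) w) ≡ map (a · b ·_) w
  map-· a b [] = refl
  map-· a b (x ∷ w) = cong₂ _∷_ (sym (assoc a b x)) (map-· a b w)

  -- A linear extension of Λ(B)

  private
    Σℕ : ∀ k → (Fin k → ℕ) → ℕ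
    Σℕ = fsum ℕ._+_ 0

    Σℕ-mono : ∀ k {f g : Fin k → ℕ} → (∀ i → f i ℕ.≤ g i) → Σℕ k f ℕ.≤ Σℕ k g
    Σℕ-mono zero h = ℕ.z≤n
    Σℕ-mono (suc k) h = ℕₚ.+-mono-≤ (h zero) (Σℕ-mono k (h ∘ suc))

    Σℕ-mono-< : ∀ k {f g : Fin k → ℕ} → (∀ i → f i ℕ.≤ g i) → ∀ j → f j ℕ.< g j →
                Σℕ k f ℕ.< Σℕ k g
    Σℕ-mono-< (suc k) h zero p = ℕₚ.+-mono-<-≤ p (Σℕ-mono k (h ∘ suc))
    Σℕ-mono-< (suc k) h (suc j) p = ℕₚ.+-mono-≤-< (h zero) (Σℕ-mono-< k (h ∘ suc) j p)

    term≤Σℕ : ∀ k (f : Fin k → ℕ) i → f i ℕ.≤ Σℕ k f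
    term≤Σℕ (suc k) f zero = ℕₚ.m≤m+n _ _
    term≤Σℕ (suc k) f (suc i) = ℕₚ.≤-trans (term≤Σℕ k (f ∘ suc) i) (ℕₚ.m≤n+m _ _)

    indicator : ∀ {p} {P : Set p} → Dec P → ℕ
    indicator (yes _) = 1
    indicator (no _) = 0

    indicator-mono : ∀ {p q} {P : Set p} {Q : Set q} (d : Dec P) (d′ : Dec Q) → (P → Q) →
                     indicator d ℕ.≤ indicator d′
    indicator-mono (yes p) (yes _) h = ℕₚ.≤-refl
    indicator-mono (yes p) (no ¬q) h = ⊥-elim (¬q (h p))
    indicator-mono (no _) _ h = ℕ.z≤n

    indicator-mono-< : ∀ {p q} {P : Set p} {Q : Set q} (d : Dec P) (d′ : Dec Q) → ¬ P → Q →
                       indicator d ℕ.< indicator d′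
    indicator-mono-< (yes p) _ ¬p q = ⊥-elim (¬p p)
    indicator-mono-< (no _) (yes _) ¬p q = ℕₚ.≤-refl
    indicator-mono-< (no _) (no ¬q) ¬p q = ⊥-elim (¬q q)

  rank : Fin n → ℕ
  rank b = Σℕ n (λ x → indicator (x · b ≟F x))

  -- Whatever is counted for `a` is counted for `b` by transitivity, and `b` itself is counted for
  -- `b` alone.
  rank-mono-< : ∀ {a b} → a ⊏ b → rank a ℕ.< rank b
  rank-mono-< {a} {b} (p , ¬q) =
    Σℕ-mono-< n (λ x → indicator-mono (x · a ≟F x) (x · b ≟F x) (λ r → ⊑-trans r p)) b
      (indicator-mono-< (b · a ≟F b) (b · b ≟F b) ¬q (idem b))

  -- Rank first, ties broken by the number of `b`: since `toℕ b` is below n, the sum encodes the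
  -- lexicographic order of the pair and is injective.
  key : Fin n → ℕ
  key b = rank b ℕ.* n ℕ.+ toℕ b

  private
    rank<⇒key< : ∀ {a b} → rank a ℕ.< rank b → key a ℕ.< key b
    rank<⇒key< {a} {b} p = ℕₚ.<-≤-trans
      (ℕₚ.+-monoʳ-< (rank a ℕ.* n) (toℕ<n a))
      (ℕₚ.≤-trans (ℕₚ.≤-reflexive (ℕₚ.+-comm (rank a ℕ.* n) n))
        (ℕₚ.≤-trans (ℕₚ.*-monoˡ-≤ n p) (ℕₚ.m≤m+n _ _)))

  key-mono-< : ∀ {a b} → a ⊏ b → key a ℕ.< key b
  key-mono-< = rank<⇒key< ∘ rank-mono-<

  key-injective : ∀ {a b} → key a ≡ key b → a ≡ b
  key-injective {a} {b} eq with ℕₚ.<-cmp (rank a) (rank b)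
  ... | tri< p _ _ = ⊥-elim (ℕₚ.<⇒≢ (rank<⇒key< {a} {b} p) eq)
  ... | tri> _ _ p = ⊥-elim (ℕₚ.<⇒≢ (rank<⇒key< {b} {a} p) (sym eq))
  ... | tri≈ _ p _ = toℕ-injective (ℕₚ.+-cancelˡ-≡ (rank b ℕ.* n) _ _
                       (trans (cong (λ r → r ℕ.* n ℕ.+ toℕ a) (sym p)) eq))

  -- A crude bound exceeding every key, so that `T keyBound` runs through all representatives.
  keyBound : ℕ
  keyBound = suc (Σℕ n key)

  key<keyBound : ∀ b → key b ℕ.< keyBound
  key<keyBound b = ℕ.s≤s (term≤Σℕ n key b)

  private
    first : ∀ {k} {P : Fin k → Set} → (∀ i → Dec (P i)) → ∃ P → ∃ P
    first {suc k} P? (i , p) with P? zero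
    ... | yes q = zero , q
    first {suc k} P? (zero , p) | no ¬q = ⊥-elim (¬q p)
    first {suc k} P? (suc i , p) | no ¬q with first (P? ∘ suc) (i , p)
    ... | j , q = suc j , q

    first-cong : ∀ {k} {P Q : Fin k → Set} (P? : ∀ i → Dec (P i)) (Q? : ∀ i → Dec (Q i)) →
                 (∀ i → P i → Q i) → (∀ i → Q i → P i) → ∀ p q →
                 proj₁ (first P? p) ≡ proj₁ (first Q? q)
    first-cong {suc k} P? Q? f g (i , p) (j , q) with P? zero | Q? zero
    ... | yes _ | yes _ = refl
    ... | yes p₀ | no ¬q₀ = ⊥-elim (¬q₀ (f zero p₀))
    ... | no ¬p₀ | yes q₀ = ⊥-elim (¬p₀ (g zero q₀))
    first-cong {suc k} P? Q? f g (zero , p) (j , q) | no ¬p₀ | no _ = ⊥-elim (¬p₀ p)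
    first-cong {suc k} P? Q? f g (suc i , p) (zero , q) | no _ | no ¬q₀ = ⊥-elim (¬q₀ q)
    first-cong {suc k} P? Q? f g (suc i , p) (suc j , q) | no _ | no _ =
      cong suc (first-cong (P? ∘ suc) (Q? ∘ suc) (f ∘ suc) (g ∘ suc) (i , p) (j , q))

  -- The least element of L_X in the numbering of `Fin n`, hence determined by the class of `b`
  -- alone. The resolution is stated without a choice of representatives, so its proof has to make
  -- one.
  rep : Fin n → Fin n
  rep b = proj₁ (first (_≡Λ? b) (b , ≡Λ-refl b))

  rep-isRepChoice : IsRepChoice rep
  rep-isRepChoice =
    (λ b → proj₂ (first (_≡Λ? b) (b , ≡Λ-refl b))) ,
    (λ a b p → first-cong (_≡Λ? a) (_≡Λ? b) (λ x q → ≡Λ-trans q p)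
                 (λ x q → ≡Λ-trans q (≡Λ-sym p)) _ _)

-- Enumeration of the simplices counted by n_X

module Enumeration {n : ℕ} (B : LRB n) where
  open LRBTheory B
  open ≡ using (cong; sym; trans)

  -- The summands of `D` are indexed by a bare number; these data tie each index to the simplex it
  -- stands for.
  record Listing {m} (P : Vec (Fin n) m → Set) (k : ℕ) : Set where
    field
      elem : Fin k → Vec (Fin n) m
      elem-sound : ∀ j → P (elem j)
      elem-injective : ∀ {i j} → elem i ≡ elem j → i ≡ j
      index : ∀ v → P v → Fin k
      elem-index : ∀ v p → elem (index v p) ≡ v

  private
    Σℕ : ∀ k → (Fin k → ℕ) → ℕ
    Σℕ = fsum ℕ._+_ 0

    -- A sum of numbers indexes the disjoint union of its summands. As `count` is an iterated sum of
    -- zeros and ones, decoding an index entry by entry yields a vector.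
    split : ∀ k (f : Fin k → ℕ) → Fin (Σℕ k f) → Σ (Fin k) (Fin ∘ f)
    split (suc k) f j with splitAt (f zero) j
    ... | inj₁ j₀ = zero , j₀
    ... | inj₂ j₁ with i , j₂ ← split k (f ∘ suc) j₁ = suc i , j₂

    join : ∀ k (f : Fin k → ℕ) → Σ (Fin k) (Fin ∘ f) → Fin (Σℕ k f)
    join (suc k) f (zero , j) = j ↑ˡ _
    join (suc k) f (suc i , j) = f zero ↑ʳ join k (f ∘ suc) (i , j)

    split-join : ∀ k f p → split k f (join k f p) ≡ p
    split-join (suc k) f (zero , j) rewrite splitAt-↑ˡ (f zero) j (Σℕ k (f ∘ suc)) = refl
    split-join (suc k) f (suc i , j)
      rewrite splitAt-↑ʳ (f zero) (Σℕ k (f ∘ suc)) (join k (f ∘ suc) (i , j))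
            | split-join k (f ∘ suc) (i , j) = refl

    join-split : ∀ k f j → join k f (split k f j) ≡ j
    join-split (suc k) f j with splitAt (f zero) j in eq
    ... | inj₁ j₀ = splitAt⁻¹-↑ˡ eq
    ... | inj₂ j₁ = trans (cong (f zero ↑ʳ_) (join-split k (f ∘ suc) j₁)) (splitAt⁻¹-↑ʳ eq)

    Σℕᵛ : ∀ m → (Vec (Fin n) m → ℕ) → ℕ
    Σℕᵛ = vsum ℕ._+_ 0

    splitᵛ : ∀ m f → Fin (Σℕᵛ m f) → Σ (Vec (Fin n) m) (Fin ∘ f)
    splitᵛ zero f j = [] , j
    splitᵛ (suc m) f j with i , j₁ ← split n _ j with v , j₂ ← splitᵛ m (f ∘ (i ∷_)) j₁ = i ∷ v , j₂

    joinᵛ : ∀ m f → Σ (Vec (Fin n) m) (Fin ∘ f) → Fin (Σℕᵛ m f)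
    joinᵛ zero f ([] , j) = j
    joinᵛ (suc m) f (i ∷ v , j) = join n _ (i , joinᵛ m (f ∘ (i ∷_)) (v , j))

    splitᵛ-joinᵛ : ∀ m f p → splitᵛ m f (joinᵛ m f p) ≡ p
    splitᵛ-joinᵛ zero f ([] , j) = refl
    splitᵛ-joinᵛ (suc m) f (i ∷ v , j)
      rewrite split-join n (λ i → Σℕᵛ m (f ∘ (i ∷_))) (i , joinᵛ m (f ∘ (i ∷_)) (v , j))
            | splitᵛ-joinᵛ m (f ∘ (i ∷_)) (v , j) = refl

    joinᵛ-splitᵛ : ∀ m f j → joinᵛ m f (splitᵛ m f j) ≡ j
    joinᵛ-splitᵛ zero f j = refl
    joinᵛ-splitᵛ (suc m) f j =
      trans (cong (λ j₁ → join n _ (proj₁ (split n _ j) , j₁)) (joinᵛ-splitᵛ m _ _)) (join-split n _ j)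

    module _ {m} {P : Vec (Fin n) m → Set} {f : Vec (Fin n) m → ℕ}
             (sound : ∀ v → Fin (f v) → P v) (complete : ∀ v → P v → Fin (f v))
             (unique : ∀ v (i j : Fin (f v)) → i ≡ j) where

      listing : Listing P (Σℕᵛ m f)
      listing = record
        { elem = proj₁ ∘ splitᵛ m f
        ; elem-sound = λ j → sound _ (proj₂ (splitᵛ m f j))
        ; elem-injective = λ {i} {j} eq →
            trans (sym (joinᵛ-splitᵛ m f i)) (trans (cong (joinᵛ m f) (pair eq)) (joinᵛ-splitᵛ m f j))
        ; index = λ v p → joinᵛ m f (v , complete v p)
        ; elem-index = λ v p → cong proj₁ (splitᵛ-joinᵛ m f (v , complete v p))
        }
        where
        pair : ∀ {p q : Σ _ (Fin ∘ f)} → proj₁ p ≡ proj₁ q → p ≡ q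
        pair {v , i} {.v , j} refl = cong (v ,_) (unique v i j)

  private
    -- The placeholder captures the local indicator function of count, which has no name outside Defs.
    summand : ∀ m (P : Vec (Fin n) m → Set) (P? : ∀ v → Dec (P v)) →
              Σ (Vec (Fin n) m → ℕ) (λ f → Σℕᵛ m f ≡ count m P P?)
    summand m P P? = _ , refl

    sound : ∀ {m} (P : Vec (Fin n) m → Set) (P? : ∀ v → Dec (P v)) v →
            Fin (proj₁ (summand m P P?) v) → P v
    sound P P? v j with yes p ← P? v = p

    complete : ∀ {m} (P : Vec (Fin n) m → Set) (P? : ∀ v → Dec (P v)) v →
               P v → Fin (proj₁ (summand m P P?) v)
    complete P P? v p with P? v
    ... | yes _ = zero
    ... | no ¬p = ⊥-elim (¬p p)

    unique : ∀ {m} (P : Vec (Fin n) m → Set) (P? : ∀ v → Dec (P v)) v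
             (i j : Fin (proj₁ (summand m P P?) v)) → i ≡ j
    unique P P? v i j with P? v
    unique P P? v zero zero | yes _ = refl

  countListing : ∀ m (P : Vec (Fin n) m → Set) (P? : ∀ v → Dec (P v)) → Listing P (count m P P?)
  countListing m P P? = listing (sound P P?) (complete P P?) (unique P P?)

-- Finite sums over `Fin k` and over vectors

record Summation (S : Set) : Setω where
  field
    sum : ∀ {a} {A : Set a} → (A → A → A) → A → (S → A) → A
    -- With a relation of three arguments, this one induction principle yields congruence,
    -- additivity, homogeneity and compatibility with linear maps.
    sum-rel : ∀ {a b c r} {A : Set a} {B : Set b} {C : Set c} (R : A → B → C → Set r)
              {_+₁_ : A → A → A} {_+₂_ : B → B → B} {_+₃_ : C → C → C} {z₁ z₂ z₃} →
              R z₁ z₂ z₃ →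
              (∀ {x y u v s t} → R x u s → R y v t → R (x +₁ y) (u +₂ v) (s +₃ t)) →
              ∀ {f g h} → (∀ s → R (f s) (g s) (h s)) →
              R (sum _+₁_ z₁ f) (sum _+₂_ z₂ g) (sum _+₃_ z₃ h)
    sum-single : ∀ {a r} {A : Set a} {_≈_ : A → A → Set r} {_+_ z} → IsMonoid _≈_ _+_ z →
                 ∀ t {f} → (∀ s → s ≢ t → f s ≈ z) → sum _+_ z f ≈ f t

  module _ {a r} {A : Set a} {_≈_ : A → A → Set r} {_+_ z} (m : IsMonoid _≈_ _+_ z) where
    open IsMonoid m using (∙-cong; trans; identityˡ; identityʳ)

    sum-zero : ∀ {f} → (∀ s → f s ≈ z) → sum _+_ z f ≈ z
    sum-zero {f} = sum-rel (λ x _ _ → x ≈ z) {_+₂_ = _+_} {_+₃_ = _+_} {z₂ = z} {z₃ = z} (IsMonoid.refl m)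
      (λ p q → trans (∙-cong p q) (identityˡ z)) {g = f} {h = f}

module Summations {n : ℕ} (B : LRB n) where
  open LRBTheory B

  finSummation : ∀ k → Summation (Fin k)
  finSummation k = record
    { sum = λ _+_ z → fsum _+_ z k
    ; sum-rel = λ R r₀ r₊ → rel R r₀ r₊ k
    ; sum-single = single
    }
    where
    rel : ∀ {a b c r} {A : Set a} {B : Set b} {C : Set c} (R : A → B → C → Set r)
          {_+₁_ : A → A → A} {_+₂_ : B → B → B} {_+₃_ : C → C → C} {z₁ z₂ z₃} →
          R z₁ z₂ z₃ →
          (∀ {x y u v s t} → R x u s → R y v t → R (x +₁ y) (u +₂ v) (s +₃ t)) →
          ∀ k {f g h} → (∀ s → R (f s) (g s) (h s)) →
          R (fsum _+₁_ z₁ k f) (fsum _+₂_ z₂ k g) (fsum _+₃_ z₃ k h)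
    rel R r₀ r₊ zero p = r₀
    rel R r₀ r₊ (suc k) p = r₊ (p zero) (rel R r₀ r₊ k (p ∘ suc))

    single : ∀ {k a r} {A : Set a} {_≈_ : A → A → Set r} {_+_ z} → IsMonoid _≈_ _+_ z →
             ∀ t {f} → (∀ s → s ≢ t → f s ≈ z) → fsum _+_ z k f ≈ f t
    single {suc k} {_≈_ = _≈_} {_+_} {z} m zero {f} p = trans (∙-cong (IsMonoid.refl m) rest) (identityʳ _)
      where
      open IsMonoid m using (∙-cong; trans; identityˡ; identityʳ)
      rest : fsum _+_ z k (f ∘ suc) ≈ z
      rest = rel (λ x _ _ → x ≈ z) {_+₂_ = _+_} {_+₃_ = _+_} {z₂ = z} {z₃ = z} (IsMonoid.refl m)
        (λ p q → trans (∙-cong p q) (identityˡ z)) k {g = f ∘ suc} {h = f ∘ suc} (λ s → p (suc s) λ ())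
    single {suc k} m (suc t) p =
      trans (∙-cong (p zero λ ()) (single m t (λ s s≢t → p (suc s) λ { refl → s≢t refl }))) (identityˡ _)
      where open IsMonoid m using (∙-cong; trans; identityˡ; identityʳ)

  vecSummation : ∀ m → Summation (Vec (Fin n) m)
  vecSummation m = record
    { sum = λ _+_ z → vsum _+_ z m
    ; sum-rel = λ R r₀ r₊ → rel R r₀ r₊ m
    ; sum-single = single
    }
    where
    module F = Summation (finSummation n)

    rel : ∀ {a b c r} {A : Set a} {B : Set b} {C : Set c} (R : A → B → C → Set r)
          {_+₁_ : A → A → A} {_+₂_ : B → B → B} {_+₃_ : C → C → C} {z₁ z₂ z₃} →
          R z₁ z₂ z₃ →
          (∀ {x y u v s t} → R x u s → R y v t → R (x +₁ y) (u +₂ v) (s +₃ t)) →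
          ∀ m {f g h} → (∀ s → R (f s) (g s) (h s)) →
          R (vsum _+₁_ z₁ m f) (vsum _+₂_ z₂ m g) (vsum _+₃_ z₃ m h)
    rel R r₀ r₊ zero p = p []
    rel R r₀ r₊ (suc m) p = F.sum-rel R r₀ r₊ (λ i → rel R r₀ r₊ m (p ∘ (i ∷_)))

    single : ∀ {m a r} {A : Set a} {_≈_ : A → A → Set r} {_+_ z} → IsMonoid _≈_ _+_ z →
             ∀ t {f} → (∀ s → s ≢ t → f s ≈ z) → vsum _+_ z m f ≈ f t
    single m [] p = IsMonoid.refl m
    single {suc k} {_≈_ = _≈_} {_+_} {z} m (i ∷ t) {f} p = trans
      (F.sum-single m i (λ j j≢i → rest j (λ v → p (j ∷ v) (λ { refl → j≢i refl }))))
      (single m t (λ v v≢t → p (i ∷ v) (λ { refl → v≢t refl })))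
      where
      open IsMonoid m using (∙-cong; trans; identityˡ; identityʳ)
      rest : ∀ j → (∀ v → f (j ∷ v) ≈ z) → vsum _+_ z k (f ∘ (j ∷_)) ≈ z
      rest j = rel (λ x _ _ → x ≈ z) {_+₂_ = _+_} {_+₃_ = _+_} {z₂ = z} {z₃ = z} (IsMonoid.refl m)
        (λ p q → trans (∙-cong p q) (identityˡ z)) k {g = f ∘ (j ∷_)} {h = f ∘ (j ∷_)}

-- Modules, linear maps and free modules

module Resolution {c ℓ : Level} (R : CommutativeRing c ℓ) {n : ℕ} (B : LRB n) where
  open LRBTheory B
  open Order B
  open Enumeration B
  open Summations B
  open KB R B
  open CommutativeRing R using (0#; 1#; ring)
    renaming (Carrier to K; _≈_ to _≈K_; _+_ to _+K_; _*_ to _*K_; -_ to -K_)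
  module 𝕂 = CommutativeRing R
  module 𝕂ₚ = RingProperties ring

  -- A record rather than a synonym, so that A can be inferred from a proof of IsMod A although
  -- the action does not occur in the module axioms.
  record IsMod {m ℓm} (A : RawKBMod m ℓm) : Set (m ⊔ ℓm ⊔ c ⊔ ℓ) where
    constructor mod
    open RawKBMod A
    field
      isModule : IsModule R _≈ᴹ_ _+ᴹ_ 0ᴹ -ᴹ_ _*ₗ_ (flip _*ₗ_)

  record IsLinear {m ℓm m′ ℓm′} (A : RawKBMod m ℓm) (A′ : RawKBMod m′ ℓm′)
                  (φ : RawKBMod.M A → RawKBMod.M A′) : Set (m ⊔ ℓm ⊔ ℓm′ ⊔ c) where
    private
      module A  = RawKBMod A
      module A′ = RawKBMod A′
    field
      cong : ∀ {x y} → x A.≈ᴹ y → φ x A′.≈ᴹ φ y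
      +-hom : ∀ x y → φ (x A.+ᴹ y) A′.≈ᴹ φ x A′.+ᴹ φ y
      *ₗ-hom : ∀ r x → φ (r A.*ₗ x) A′.≈ᴹ r A′.*ₗ φ x

  hom⇒linear : ∀ {m ℓm m′ ℓm′} {A : RawKBMod m ℓm} {A′ : RawKBMod m′ ℓm′} {φ} →
               IsHom A A′ φ → IsLinear A A′ φ
  hom⇒linear h = record { IsHom h }

  module Mod {m ℓm} (A : RawKBMod m ℓm) (isMod : IsMod A) where
    open RawKBMod A public
    open IsModule (IsMod.isModule isMod) public
      using (*ₗ-cong; *ₗ-zeroˡ; *ₗ-zeroʳ; *ₗ-distribˡ; *ₗ-distribʳ; *ₗ-identityˡ; *ₗ-assoc;
             +ᴹ-cong; +ᴹ-assoc; +ᴹ-comm; +ᴹ-identityˡ; +ᴹ-identityʳ; -ᴹ‿cong; -ᴹ‿inverseˡ; -ᴹ‿inverseʳ;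
             ≈ᴹ-refl; ≈ᴹ-sym; ≈ᴹ-trans; ≈ᴹ-setoid; +ᴹ-isAbelianGroup; +ᴹ-isMonoid)

    abelianGroup : AbelianGroup m ℓm
    abelianGroup = record { isAbelianGroup = +ᴹ-isAbelianGroup }

    open AbelianGroupProperties abelianGroup public
      using (⁻¹-involutive; ε⁻¹≈ε; ⁻¹-∙-comm; xyx⁻¹≈y)

    +ᴹ-congˡ : ∀ {x y z} → y ≈ᴹ z → x +ᴹ y ≈ᴹ x +ᴹ z
    +ᴹ-congˡ = +ᴹ-cong ≈ᴹ-refl

    +ᴹ-congʳ : ∀ {x y z} → y ≈ᴹ z → y +ᴹ x ≈ᴹ z +ᴹ x
    +ᴹ-congʳ p = +ᴹ-cong p ≈ᴹ-refl

    interchange : ∀ w x y z → (w +ᴹ x) +ᴹ (y +ᴹ z) ≈ᴹ (w +ᴹ y) +ᴹ (x +ᴹ z)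
    interchange w x y z = begin
      (w +ᴹ x) +ᴹ (y +ᴹ z)  ≈⟨ +ᴹ-assoc w x _ ⟩
      w +ᴹ (x +ᴹ (y +ᴹ z))  ≈⟨ +ᴹ-congˡ (+ᴹ-assoc x y z) ⟨
      w +ᴹ ((x +ᴹ y) +ᴹ z)  ≈⟨ +ᴹ-congˡ (+ᴹ-congʳ (+ᴹ-comm x y)) ⟩
      w +ᴹ ((y +ᴹ x) +ᴹ z)  ≈⟨ +ᴹ-congˡ (+ᴹ-assoc y x z) ⟩
      w +ᴹ (y +ᴹ (x +ᴹ z))  ≈⟨ +ᴹ-assoc w y _ ⟨
      (w +ᴹ y) +ᴹ (x +ᴹ z)  ∎
      where open SetoidReasoning ≈ᴹ-setoid

    x+[y-x] : ∀ x y → x +ᴹ (y +ᴹ -ᴹ x) ≈ᴹ y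
    x+[y-x] x y = ≈ᴹ-trans (≈ᴹ-sym (+ᴹ-assoc x y _)) (xyx⁻¹≈y x y)

    whenᴹ : ∀ {p} {P : Set p} → Dec P → M → M
    whenᴹ (yes _) x = x
    whenᴹ (no _)  x = 0ᴹ

    whenᴹ-cong : ∀ {p} {P : Set p} (d : Dec P) {x y} → (P → x ≈ᴹ y) → whenᴹ d x ≈ᴹ whenᴹ d y
    whenᴹ-cong (yes p) h = h p
    whenᴹ-cong (no _) h = ≈ᴹ-refl

    whenᴹ-yes : ∀ {p} {P : Set p} (d : Dec P) {x} → P → whenᴹ d x ≈ᴹ x
    whenᴹ-yes (yes _) p = ≈ᴹ-refl
    whenᴹ-yes (no ¬p) p = ⊥-elim (¬p p)

    whenᴹ-no : ∀ {p} {P : Set p} (d : Dec P) {x} → ¬ P → whenᴹ d x ≈ᴹ 0ᴹ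
    whenᴹ-no (yes p) ¬p = ⊥-elim (¬p p)
    whenᴹ-no (no _) ¬p = ≈ᴹ-refl

    -ᴹ-*ₗ : ∀ r x → (-K r) *ₗ x ≈ᴹ -ᴹ (r *ₗ x)
    -ᴹ-*ₗ r x = begin
      (-K r) *ₗ x                                     ≈⟨ +ᴹ-identityʳ _ ⟨
      (-K r) *ₗ x +ᴹ 0ᴹ                               ≈⟨ +ᴹ-congˡ (-ᴹ‿inverseʳ (r *ₗ x)) ⟨
      (-K r) *ₗ x +ᴹ (r *ₗ x +ᴹ -ᴹ (r *ₗ x))          ≈⟨ +ᴹ-assoc _ _ _ ⟨
      (-K r) *ₗ x +ᴹ r *ₗ x +ᴹ -ᴹ (r *ₗ x)            ≈⟨ +ᴹ-congʳ (*ₗ-distribʳ x _ _) ⟨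
      ((-K r) +K r) *ₗ x +ᴹ -ᴹ (r *ₗ x)               ≈⟨ +ᴹ-congʳ (*ₗ-cong (𝕂.-‿inverseˡ r) ≈ᴹ-refl) ⟩
      0# *ₗ x +ᴹ -ᴹ (r *ₗ x)                          ≈⟨ +ᴹ-congʳ (*ₗ-zeroˡ x) ⟩
      0ᴹ +ᴹ -ᴹ (r *ₗ x)                               ≈⟨ +ᴹ-identityˡ _ ⟩
      -ᴹ (r *ₗ x)                                     ∎
      where open SetoidReasoning ≈ᴹ-setoid

    module _ {S : Set} (Σˢ : Summation S) where
      open Summation Σˢ

      ⅀ : (S → M) → M
      ⅀ = sum _+ᴹ_ 0ᴹ

      ⅀-cong : ∀ {f g} → (∀ s → f s ≈ᴹ g s) → ⅀ f ≈ᴹ ⅀ g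
      ⅀-cong {f} = sum-rel (λ x y _ → x ≈ᴹ y) {_+₃_ = _+ᴹ_} {z₃ = 0ᴹ} ≈ᴹ-refl +ᴹ-cong {h = f}

      ⅀-zero : ∀ {f} → (∀ s → f s ≈ᴹ 0ᴹ) → ⅀ f ≈ᴹ 0ᴹ
      ⅀-zero = sum-zero +ᴹ-isMonoid

      ⅀-+ : ∀ f g → ⅀ (λ s → f s +ᴹ g s) ≈ᴹ ⅀ f +ᴹ ⅀ g
      ⅀-+ f g = sum-rel (λ x y z → x ≈ᴹ y +ᴹ z) (≈ᴹ-sym (+ᴹ-identityˡ _))
        (λ p q → ≈ᴹ-trans (+ᴹ-cong p q) (interchange _ _ _ _)) (λ s → ≈ᴹ-refl)

      ⅀-*ₗ : ∀ r f → ⅀ (λ s → r *ₗ f s) ≈ᴹ r *ₗ ⅀ f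
      ⅀-*ₗ r f = sum-rel (λ x y _ → x ≈ᴹ r *ₗ y) {_+₃_ = _+ᴹ_} {z₃ = 0ᴹ} (≈ᴹ-sym (*ₗ-zeroʳ r))
        (λ p q → ≈ᴹ-trans (+ᴹ-cong p q) (≈ᴹ-sym (*ₗ-distribˡ r _ _))) {h = f} (λ s → ≈ᴹ-refl)

      ⅀-single : ∀ t {f} → (∀ s → s ≢ t → f s ≈ᴹ 0ᴹ) → ⅀ f ≈ᴹ f t
      ⅀-single = sum-single +ᴹ-isMonoid

  module _ {m ℓm m′ ℓm′} {A : RawKBMod m ℓm} {A′ : RawKBMod m′ ℓm′} (mA : IsMod A) (mA′ : IsMod A′)
           {φ : RawKBMod.M A → RawKBMod.M A′} (φ-linear : IsLinear A A′ φ) where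
    private
      module A = Mod A mA
      module A′ = Mod A′ mA′
    open IsLinear φ-linear

    linear-0 : φ A.0ᴹ A′.≈ᴹ A′.0ᴹ
    linear-0 = begin
      φ A.0ᴹ             ≈⟨ cong (A.*ₗ-zeroˡ _) ⟨
      φ (0# A.*ₗ A.0ᴹ)   ≈⟨ *ₗ-hom _ _ ⟩
      0# A′.*ₗ φ A.0ᴹ    ≈⟨ A′.*ₗ-zeroˡ _ ⟩
      A′.0ᴹ              ∎
      where open SetoidReasoning A′.≈ᴹ-setoid

    linear-neg : ∀ x → φ (A.-ᴹ x) A′.≈ᴹ A′.-ᴹ φ x
    linear-neg x = begin
      φ (A.-ᴹ x)                                      ≈⟨ A′.+ᴹ-identityˡ _ ⟨
      A′.0ᴹ A′.+ᴹ φ (A.-ᴹ x)                          ≈⟨ A′.+ᴹ-congʳ (A′.-ᴹ‿inverseˡ (φ x)) ⟨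
      A′.-ᴹ φ x A′.+ᴹ φ x A′.+ᴹ φ (A.-ᴹ x)            ≈⟨ A′.+ᴹ-assoc _ _ _ ⟩
      A′.-ᴹ φ x A′.+ᴹ (φ x A′.+ᴹ φ (A.-ᴹ x))          ≈⟨ A′.+ᴹ-congˡ (+-hom _ _) ⟨
      A′.-ᴹ φ x A′.+ᴹ φ (x A.+ᴹ A.-ᴹ x)               ≈⟨ A′.+ᴹ-congˡ (cong (A.-ᴹ‿inverseʳ x)) ⟩
      A′.-ᴹ φ x A′.+ᴹ φ A.0ᴹ                          ≈⟨ A′.+ᴹ-congˡ linear-0 ⟩
      A′.-ᴹ φ x A′.+ᴹ A′.0ᴹ                           ≈⟨ A′.+ᴹ-identityʳ _ ⟩
      A′.-ᴹ φ x                                       ∎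
      where open SetoidReasoning A′.≈ᴹ-setoid

    linear-when : ∀ {p} {P : Set p} (d : Dec P) x → φ (A.whenᴹ d x) A′.≈ᴹ A′.whenᴹ d (φ x)
    linear-when (yes _) x = A′.≈ᴹ-refl
    linear-when (no _) x = linear-0

    linear-⅀ : ∀ {S} (Σˢ : Summation S) f → φ (A.⅀ Σˢ f) A′.≈ᴹ A′.⅀ Σˢ (φ ∘ f)
    linear-⅀ Σˢ f = Summation.sum-rel Σˢ (λ x y _ → φ x A′.≈ᴹ y) {_+₃_ = A._+ᴹ_} {z₃ = A.0ᴹ} linear-0
      (λ p q → A′.≈ᴹ-trans (+-hom _ _) (A′.+ᴹ-cong p q)) {h = f} (λ s → A′.≈ᴹ-refl)

  module Linear {m ℓm m′ ℓm′} {A : RawKBMod m ℓm} {A′ : RawKBMod m′ ℓm′} (mA : IsMod A) (mA′ : IsMod A′)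
                {φ : RawKBMod.M A → RawKBMod.M A′} (φ-linear : IsLinear A A′ φ) where
    open IsLinear φ-linear public

    0-hom : RawKBMod._≈ᴹ_ A′ (φ (RawKBMod.0ᴹ A)) (RawKBMod.0ᴹ A′)
    0-hom = linear-0 mA mA′ φ-linear

    -‿hom : ∀ x → RawKBMod._≈ᴹ_ A′ (φ (RawKBMod.-ᴹ_ A x)) (RawKBMod.-ᴹ_ A′ (φ x))
    -‿hom = linear-neg mA mA′ φ-linear

    when-hom : ∀ {p} {P : Set p} (d : Dec P) x → RawKBMod._≈ᴹ_ A′ (φ (Mod.whenᴹ A mA d x)) (Mod.whenᴹ A′ mA′ d (φ x))
    when-hom = linear-when mA mA′ φ-linear

    ⅀-hom : ∀ {S} (Σˢ : Summation S) f → RawKBMod._≈ᴹ_ A′ (φ (Mod.⅀ A mA Σˢ f)) (Mod.⅀ A′ mA′ Σˢ (φ ∘ f))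
    ⅀-hom = linear-⅀ mA mA′ φ-linear

  id-linear : ∀ {m ℓm} {A : RawKBMod m ℓm} → IsMod A → IsLinear A A (λ x → x)
  id-linear {A = A} mA = record { cong = λ p → p ; +-hom = λ _ _ → A.≈ᴹ-refl ; *ₗ-hom = λ _ _ → A.≈ᴹ-refl }
    where module A = Mod A mA

  ∘-linear : ∀ {m₁ ℓ₁ m₂ ℓ₂ m₃ ℓ₃} {A₁ : RawKBMod m₁ ℓ₁} {A₂ : RawKBMod m₂ ℓ₂} {A₃ : RawKBMod m₃ ℓ₃} {φ ψ} →
             IsMod A₃ → IsLinear A₂ A₃ ψ → IsLinear A₁ A₂ φ → IsLinear A₁ A₃ (ψ ∘ φ)
  ∘-linear {A₃ = A₃} mA₃ lψ lφ = record
    { cong = ψ.cong ∘ φ.cong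
    ; +-hom = λ x y → A₃.≈ᴹ-trans (ψ.cong (φ.+-hom x y)) (ψ.+-hom _ _)
    ; *ₗ-hom = λ r x → A₃.≈ᴹ-trans (ψ.cong (φ.*ₗ-hom r x)) (ψ.*ₗ-hom _ _)
    }
    where
    module A₃ = Mod A₃ mA₃
    module ψ = IsLinear lψ
    module φ = IsLinear lφ

  module _ {m ℓm m′ ℓm′} {A : RawKBMod m ℓm} {A′ : RawKBMod m′ ℓm′} (mA′ : IsMod A′) where
    private
      module A = RawKBMod A
      module A′ = Mod A′ mA′

    zero-linear : IsLinear A A′ (λ _ → A′.0ᴹ)
    zero-linear = record
      { cong = λ _ → A′.≈ᴹ-refl
      ; +-hom = λ _ _ → A′.≈ᴹ-sym (A′.+ᴹ-identityˡ _)
      ; *ₗ-hom = λ r _ → A′.≈ᴹ-sym (A′.*ₗ-zeroʳ r)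
      }

    +-linear : ∀ {φ ψ} → IsLinear A A′ φ → IsLinear A A′ ψ → IsLinear A A′ (λ x → φ x A′.+ᴹ ψ x)
    +-linear lφ lψ = record
      { cong = λ p → A′.+ᴹ-cong (φ.cong p) (ψ.cong p)
      ; +-hom = λ x y → A′.≈ᴹ-trans (A′.+ᴹ-cong (φ.+-hom x y) (ψ.+-hom x y)) (A′.interchange _ _ _ _)
      ; *ₗ-hom = λ r x → A′.≈ᴹ-trans (A′.+ᴹ-cong (φ.*ₗ-hom r x) (ψ.*ₗ-hom r x)) (A′.≈ᴹ-sym (A′.*ₗ-distribˡ r _ _))
      }
      where
      module φ = IsLinear lφ
      module ψ = IsLinear lψ

    -‿linear : ∀ {φ} → IsLinear A A′ φ → IsLinear A A′ (λ x → A′.-ᴹ φ x)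
    -‿linear {φ} lφ = record
      { cong = λ p → A′.-ᴹ‿cong (φ.cong p)
      ; +-hom = λ x y → A′.≈ᴹ-trans (A′.-ᴹ‿cong (φ.+-hom x y)) (A′.≈ᴹ-sym (A′.⁻¹-∙-comm _ _))
      ; *ₗ-hom = λ r x → A′.≈ᴹ-trans (A′.-ᴹ‿cong (φ.*ₗ-hom r x)) (A′.≈ᴹ-sym (-‿*ₗ r (φ x)))
      }
      where
      module φ = IsLinear lφ
      -‿*ₗ : ∀ r y → r A′.*ₗ (A′.-ᴹ y) A′.≈ᴹ A′.-ᴹ (r A′.*ₗ y)
      -‿*ₗ r = Linear.-‿hom mA′ mA′ {φ = r A′.*ₗ_} record
        { cong = A′.*ₗ-cong 𝕂.refl
        ; +-hom = A′.*ₗ-distribˡ r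
        ; *ₗ-hom = λ s x → A′.≈ᴹ-trans (A′.≈ᴹ-sym (A′.*ₗ-assoc r s x))
            (A′.≈ᴹ-trans (A′.*ₗ-cong (𝕂.*-comm r s) A′.≈ᴹ-refl) (A′.*ₗ-assoc s r x))
        }

    when-linear : ∀ {φ p} {P : Set p} (d : Dec P) → IsLinear A A′ φ → IsLinear A A′ (λ x → A′.whenᴹ d (φ x))
    when-linear (yes _) lφ = lφ
    when-linear (no _) lφ = zero-linear

    ⅀-linear : ∀ {S : Set} {φ : S → A.M → A′.M} (Σˢ : Summation S) → (∀ s → IsLinear A A′ (φ s)) →
               IsLinear A A′ (λ x → A′.⅀ Σˢ (λ s → φ s x))
    ⅀-linear Σˢ lφ = record
      { cong = λ p → A′.⅀-cong Σˢ (λ s → IsLinear.cong (lφ s) p)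
      ; +-hom = λ x y → A′.≈ᴹ-trans (A′.⅀-cong Σˢ (λ s → IsLinear.+-hom (lφ s) x y)) (A′.⅀-+ Σˢ _ _)
      ; *ₗ-hom = λ r x → A′.≈ᴹ-trans (A′.⅀-cong Σˢ (λ s → IsLinear.*ₗ-hom (lφ s) r x)) (A′.⅀-*ₗ Σˢ r _)
      }

  triv-isMod : IsMod triv
  triv-isMod = mod (IsModuleFromLeft.isModule record { isLeftModule = record
    { isLeftSemimodule = record
      { +ᴹ-isCommutativeMonoid = 𝕂.+-isCommutativeMonoid
      ; isPreleftSemimodule = record
        { *ₗ-cong = 𝕂.*-cong ; *ₗ-zeroˡ = 𝕂.zeroˡ ; *ₗ-distribʳ = 𝕂.distribʳ
        ; *ₗ-identityˡ = 𝕂.*-identityˡ ; *ₗ-assoc = 𝕂.*-assoc ; *ₗ-zeroʳ = 𝕂.zeroʳ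
        ; *ₗ-distribˡ = 𝕂.distribˡ } }
    ; -ᴹ‿cong = 𝕂.-‿cong ; -ᴹ‿inverse = 𝕂.-‿inverse } })

  module 𝕋 = Mod triv triv-isMod

  when-yes : ∀ {p} {P : Set p} (d : Dec P) {x} → P → when d x ≈K x
  when-yes (yes _) p = 𝕂.refl
  when-yes (no ¬p) p = ⊥-elim (¬p p)

  when-no : ∀ {p} {P : Set p} (d : Dec P) {x} → ¬ P → when d x ≈K 0#
  when-no (yes p) ¬p = ⊥-elim (¬p p)
  when-no (no _) ¬p = 𝕂.refl

  scalars-when-linear : ∀ {m ℓm} {A : RawKBMod m ℓm} {φ : RawKBMod.M A → K} {p} {P : Set p} (d : Dec P) →
                IsLinear A triv φ → IsLinear A triv (λ x → when d (φ x))
  scalars-when-linear (yes _) lφ = lφ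
  scalars-when-linear (no _) lφ = zero-linear triv-isMod

  *-linear : ∀ r → IsLinear triv triv (r *K_)
  *-linear r = record
    { cong = 𝕂.*-congˡ
    ; +-hom = 𝕂.distribˡ r
    ; *ₗ-hom = λ s x → 𝕂.trans (𝕂.sym (𝕂.*-assoc r s x))
        (𝕂.trans (𝕂.*-congʳ (𝕂.*-comm r s)) (𝕂.*-assoc s r x))
    }

  -- The free module on the elements of S satisfying P: functions on S, compared on P only.
  module Free {S : Set} (Σˢ : Summation S) (_≟_ : DecidableEquality S)
              {P : S → Set} (P? : ∀ s → Dec (P s)) (act : Fin n → (S → K) → S → K) where

    free : RawKBMod c ℓ
    free = record
      { M    = S → K
      ; _≈ᴹ_ = λ f g → ∀ s → P s → f s ≈K g s
      ; _+ᴹ_ = λ f g s → f s +K g s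
      ; 0ᴹ   = λ _ → 0#
      ; -ᴹ_  = λ f s → -K f s
      ; _*ₗ_ = λ r f s → r *K f s
      ; _▷_  = act
      }

    isMod : IsMod free
    isMod = mod (IsModuleFromLeft.isModule record { isLeftModule = record
      { isLeftSemimodule = record
        { +ᴹ-isCommutativeMonoid = record
          { isMonoid = record
            { isSemigroup = record
              { isMagma = record
                { isEquivalence = record
                  { refl = λ _ _ → 𝕂.refl
                  ; sym = λ p s q → 𝕂.sym (p s q)
                  ; trans = λ p p′ s q → 𝕂.trans (p s q) (p′ s q)
                  }
                ; ∙-cong = λ p p′ s q → 𝕂.+-cong (p s q) (p′ s q)
                }
              ; assoc = λ f g h s _ → 𝕂.+-assoc (f s) (g s) (h s)
              }
            ; identity = (λ f s _ → 𝕂.+-identityˡ (f s)) , (λ f s _ → 𝕂.+-identityʳ (f s))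
            }
          ; comm = λ f g s _ → 𝕂.+-comm (f s) (g s)
          }
        ; isPreleftSemimodule = record
          { *ₗ-cong = λ p p′ s q → 𝕂.*-cong p (p′ s q)
          ; *ₗ-zeroˡ = λ f s _ → 𝕂.zeroˡ (f s)
          ; *ₗ-distribʳ = λ f x y s _ → 𝕂.distribʳ (f s) x y
          ; *ₗ-identityˡ = λ f s _ → 𝕂.*-identityˡ (f s)
          ; *ₗ-assoc = λ x y f s _ → 𝕂.*-assoc x y (f s)
          ; *ₗ-zeroʳ = λ x s _ → 𝕂.zeroʳ x
          ; *ₗ-distribˡ = λ x f g s _ → 𝕂.distribˡ x (f s) (g s)
          }
        }
      ; -ᴹ‿cong = λ p s q → 𝕂.-‿cong (p s q)
      ; -ᴹ‿inverse = (λ f s _ → 𝕂.-‿inverseˡ (f s)) , (λ f s _ → 𝕂.-‿inverseʳ (f s))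
      } })

    module 𝔽 = Mod free isMod

    δ : S → S → K
    δ s t = when (s ≟ t) 1#

    -- Elements of the free module are compared on `P` only. This is what makes the basis vector of
    -- a degenerate tuple equal to zero.
    δ-junk : ∀ {s} → ¬ P s → δ s 𝔽.≈ᴹ 𝔽.0ᴹ
    δ-junk {s} ¬p t p = when-no (s ≟ t) λ { refl → ¬p p }

    at-linear : ∀ {t} → P t → IsLinear free triv (λ f → f t)
    at-linear {t} p = record
      { cong = λ q → q t p ; +-hom = λ _ _ → 𝕂.refl ; *ₗ-hom = λ _ _ → 𝕂.refl }

    module _ {m ℓm} {A : RawKBMod m ℓm} (mA : IsMod A) where
      private module A = Mod A mA

      -- Linear extension of `g`. Values of `f` off `P` are invisible to the equality of the free
      -- module and have to be masked for the map to respect it.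
      lin : (S → A.M) → (S → K) → A.M
      lin g f = A.⅀ Σˢ (λ s → when (P? s) (f s) A.*ₗ g s)

      private
        coefficient-linear : ∀ s x → IsLinear free A (λ f → when (P? s) (f s) A.*ₗ x)
        coefficient-linear s x with P? s
        ... | no _ = record
          { cong = λ _ → A.≈ᴹ-refl
          ; +-hom = λ _ _ → A.≈ᴹ-trans (A.*ₗ-cong (𝕂.sym (𝕂.+-identityˡ 0#)) A.≈ᴹ-refl) (A.*ₗ-distribʳ x 0# 0#)
          ; *ₗ-hom = λ r _ → A.≈ᴹ-trans (A.*ₗ-cong (𝕂.sym (𝕂.zeroʳ r)) A.≈ᴹ-refl) (A.*ₗ-assoc r 0# x)
          }
        ... | yes p = record
          { cong = λ q → A.*ₗ-cong (q s p) A.≈ᴹ-refl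
          ; +-hom = λ f g → A.*ₗ-distribʳ x (f s) (g s)
          ; *ₗ-hom = λ r f → A.*ₗ-assoc r (f s) x
          }

      lin-linear : ∀ g → IsLinear free A (lin g)
      lin-linear g = ⅀-linear mA Σˢ (λ s → coefficient-linear s (g s))

      lin-δ : ∀ g {s} → P s → lin g (δ s) A.≈ᴹ g s
      lin-δ g {s} p = begin
        lin g (δ s)                               ≈⟨ A.⅀-single Σˢ s (λ t t≢s → zero-coefficient (P? t) (s ≟ t) t≢s) ⟩
        when (P? s) (when (s ≟ s) 1#) A.*ₗ g s    ≈⟨ A.*ₗ-cong (𝕂.trans (when-yes (P? s) p) (when-yes (s ≟ s) refl)) A.≈ᴹ-refl ⟩
        1# A.*ₗ g s                               ≈⟨ A.*ₗ-identityˡ _ ⟩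
        g s                                       ∎
        where
        open SetoidReasoning A.≈ᴹ-setoid
        zero-coefficient : ∀ {t} (d : Dec (P t)) (e : Dec (s ≡ t)) → t ≢ s → when d (when e 1#) A.*ₗ g t A.≈ᴹ A.0ᴹ
        zero-coefficient (no _) _ _ = A.*ₗ-zeroˡ _
        zero-coefficient (yes _) (no _) _ = A.*ₗ-zeroˡ _
        zero-coefficient (yes _) (yes eq) t≢s = ⊥-elim (t≢s (≡.sym eq))

    δ-expansion : ∀ f → f 𝔽.≈ᴹ lin isMod δ f
    δ-expansion f t p = 𝕂.sym (begin
      lin isMod δ f t                               ≈⟨ Linear.⅀-hom isMod triv-isMod (at-linear p) Σˢ _ ⟩
      𝕋.⅀ Σˢ (λ s → when (P? s) (f s) *K δ s t)    ≈⟨ 𝕋.⅀-single Σˢ t (λ s s≢t →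
                                                       𝕂.trans (𝕂.*-congˡ (when-no (s ≟ t) s≢t)) (𝕂.zeroʳ _)) ⟩
      when (P? t) (f t) *K δ t t                    ≈⟨ 𝕂.*-cong (when-yes (P? t) p) (when-yes (t ≟ t) refl) ⟩
      f t *K 1#                                     ≈⟨ 𝕂.*-identityʳ _ ⟩
      f t                                           ∎)
      where open SetoidReasoning 𝕋.≈ᴹ-setoid

    module _ {m ℓm} {A : RawKBMod m ℓm} (mA : IsMod A) where
      private module A = Mod A mA

      linear≈lin : ∀ {φ} → IsLinear free A φ → ∀ f → φ f A.≈ᴹ lin mA (φ ∘ δ) f
      linear≈lin {φ} lφ f = begin
        φ f                                                 ≈⟨ φ.cong (δ-expansion f) ⟩
        φ (lin isMod δ f)                                   ≈⟨ φ.⅀-hom Σˢ _ ⟩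
        A.⅀ Σˢ (λ s → φ (λ t → when (P? s) (f s) *K δ s t)) ≈⟨ A.⅀-cong Σˢ (λ s → φ.*ₗ-hom _ _) ⟩
        lin mA (φ ∘ δ) f                                    ∎
        where
        open SetoidReasoning A.≈ᴹ-setoid
        module φ = Linear isMod mA lφ

      ext : ∀ {φ ψ} → IsLinear free A φ → IsLinear free A ψ → (∀ s → P s → φ (δ s) A.≈ᴹ ψ (δ s)) →
            ∀ f → φ f A.≈ᴹ ψ f
      ext {φ} {ψ} lφ lψ h f = begin
        φ f               ≈⟨ linear≈lin lφ f ⟩
        lin mA (φ ∘ δ) f  ≈⟨ A.⅀-cong Σˢ (λ s → term s (P? s)) ⟩
        lin mA (ψ ∘ δ) f  ≈⟨ linear≈lin lψ f ⟨
        ψ f               ∎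
        where
        open SetoidReasoning A.≈ᴹ-setoid
        term : ∀ s (d : Dec (P s)) → when d (f s) A.*ₗ φ (δ s) A.≈ᴹ when d (f s) A.*ₗ ψ (δ s)
        term s (yes p) = A.*ₗ-cong 𝕂.refl (h s p)
        term s (no _) = A.≈ᴹ-trans (A.*ₗ-zeroˡ _) (A.≈ᴹ-sym (A.*ₗ-zeroˡ _))

    -- The actions and boundary maps are all given by a matrix with entries `κ s t`. An entry is a
    -- linear map of scalars, not a scalar, so that `kernel` unfolds to the formulas in their
    -- definitions.
    module Kernel {T : Set} (κ : S → T → K → K) (κ-linear : ∀ s t → IsLinear triv triv (κ s t)) where

      kernel : (S → K) → T → K
      kernel f t = 𝕋.⅀ Σˢ (λ s → when (P? s) (κ s t (f s)))

      kernel-at-linear : ∀ t → IsLinear free triv (λ f → kernel f t)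
      kernel-at-linear t = ⅀-linear triv-isMod Σˢ term
        where
        term : ∀ s → IsLinear free triv (λ f → when (P? s) (κ s t (f s)))
        term s with P? s
        ... | no _ = zero-linear triv-isMod
        ... | yes p = ∘-linear triv-isMod (κ-linear s t) (at-linear p)

      kernel-δ : ∀ {s} → P s → ∀ t → kernel (δ s) t ≈K κ s t 1#
      kernel-δ {s} p t = begin
        kernel (δ s) t                ≈⟨ 𝕋.⅀-single Σˢ s off-diagonal ⟩
        when (P? s) (κ s t (δ s s))   ≈⟨ when-yes (P? s) p ⟩
        κ s t (δ s s)                 ≈⟨ IsLinear.cong (κ-linear s t) (when-yes (s ≟ s) refl) ⟩
        κ s t 1#                      ∎
        where
        open SetoidReasoning 𝕋.≈ᴹ-setoid
        off-diagonal : ∀ r → r ≢ s → when (P? r) (κ r t (δ s r)) ≈K 0#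
        off-diagonal r r≢s with P? r
        ... | no _ = 𝕂.refl
        ... | yes _ = 𝕂.trans (IsLinear.cong (κ-linear r t) (when-no (s ≟ r) (r≢s ∘ ≡.sym)))
          (Linear.0-hom triv-isMod triv-isMod (κ-linear r t))

  pointwise-linear : ∀ {m ℓm} {A : RawKBMod m ℓm} {T : Set} {Q : T → Set} {φ : RawKBMod.M A → T → K} act →
    (∀ t → IsLinear A triv (λ x → φ x t)) →
    {Σᵗ : Summation T} {_≟_ : DecidableEquality T} {Q? : ∀ t → Dec (Q t)} →
    IsLinear A (Free.free Σᵗ _≟_ Q? act) φ
  pointwise-linear act h = record
    { cong = λ p t _ → IsLinear.cong (h t) p
    ; +-hom = λ x y t _ → IsLinear.+-hom (h t) x y
    ; *ₗ-hom = λ r x t _ → IsLinear.*ₗ-hom (h t) r x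
    }

  -- The simplicial boundary

  weak-removeAt : ∀ {m} {w : Vec (Fin n) (suc m)} → Weak w → ∀ i → Weak (removeAt w i)
  weak-removeAt (p ∷ ps) zero = ps
  weak-removeAt (p ∷ ps@(_ ∷ _)) (suc i) = All-removeAt p i ∷ weak-removeAt ps i
    where
    All-removeAt : ∀ {P : Fin n → Set} {m} {w : Vec (Fin n) (suc m)} → All P w → ∀ i → All P (removeAt w i)
    All-removeAt (p ∷ ps) zero = ps
    All-removeAt (p ∷ ps@(_ ∷ _)) (suc i) = p ∷ All-removeAt ps i

  chain-tail : ∀ {x m} {w : Vec (Fin n) m} → IsChain (x ∷ w) → IsChain w
  chain-tail {w = []} _ = _
  chain-tail {w = y ∷ w} = proj₂

  module Boundary {m ℓm} {A : RawKBMod m ℓm} (mA : IsMod A) where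
    open Mod A mA

    -- The simplicial boundary Σᵢ (-1)ⁱ G (removeAt w i), by recursion on w.
    d : ∀ {m} → (Vec (Fin n) m → M) → Vec (Fin n) (suc m) → M
    d G (x ∷ []) = G []
    d G (x ∷ y ∷ w) = G (y ∷ w) +ᴹ -ᴹ d (G ∘ (x ∷_)) (y ∷ w)

    d-∷ : ∀ {m} (G : Vec (Fin n) (suc m) → M) x w → d G (x ∷ w) ≈ᴹ G w +ᴹ -ᴹ d (G ∘ (x ∷_)) w
    d-∷ G x (y ∷ w) = ≈ᴹ-refl

    d-cong : ∀ {m} {G H : Vec (Fin n) m → M} w → (∀ i → G (removeAt w i) ≈ᴹ H (removeAt w i)) → d G w ≈ᴹ d H w
    d-cong (x ∷ []) p = p zero
    d-cong (x ∷ y ∷ w) p = +ᴹ-cong (p zero) (-ᴹ‿cong (d-cong (y ∷ w) (p ∘ suc)))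

    d-zero : ∀ {m} (w : Vec (Fin n) (suc m)) → d (λ _ → 0ᴹ) w ≈ᴹ 0ᴹ
    d-zero (x ∷ []) = ≈ᴹ-refl
    d-zero (x ∷ y ∷ w) = ≈ᴹ-trans (+ᴹ-identityˡ _) (≈ᴹ-trans (-ᴹ‿cong (d-zero (y ∷ w))) ε⁻¹≈ε)

    d-+- : ∀ {m} (G H : Vec (Fin n) m → M) w → d (λ u → G u +ᴹ -ᴹ H u) w ≈ᴹ d G w +ᴹ -ᴹ d H w
    d-+- G H (x ∷ []) = ≈ᴹ-refl
    d-+- G H (x ∷ y ∷ w) = begin
      (G u +ᴹ -ᴹ H u) +ᴹ -ᴹ d (λ v → G (x ∷ v) +ᴹ -ᴹ H (x ∷ v)) u  ≈⟨ +ᴹ-congˡ (-ᴹ‿cong (d-+- (G ∘ (x ∷_)) (H ∘ (x ∷_)) u)) ⟩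
      (G u +ᴹ -ᴹ H u) +ᴹ -ᴹ (dG +ᴹ -ᴹ dH)                          ≈⟨ +ᴹ-congˡ (⁻¹-∙-comm dG (-ᴹ dH)) ⟨
      (G u +ᴹ -ᴹ H u) +ᴹ (-ᴹ dG +ᴹ -ᴹ (-ᴹ dH))                     ≈⟨ interchange _ _ _ _ ⟩
      (G u +ᴹ -ᴹ dG) +ᴹ (-ᴹ H u +ᴹ -ᴹ (-ᴹ dH))                     ≈⟨ +ᴹ-congˡ (⁻¹-∙-comm (H u) (-ᴹ dH)) ⟩
      (G u +ᴹ -ᴹ dG) +ᴹ -ᴹ (H u +ᴹ -ᴹ dH)                          ∎
      where
      open SetoidReasoning ≈ᴹ-setoid
      u = y ∷ w
      dG = d (G ∘ (x ∷_)) u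
      dH = d (H ∘ (x ∷_)) u

    d-map : ∀ {m} (G : Vec (Fin n) m → M) h w → d G (map h w) ≡ d (G ∘ map h) w
    d-map G h (x ∷ []) = refl
    d-map G h (x ∷ y ∷ w) = ≡.cong (λ z → G (map h (y ∷ w)) +ᴹ -ᴹ z) (d-map (G ∘ (h x ∷_)) h (y ∷ w))

    -- After splitting off the first entry x, the terms that remove x in the outer and in the inner
    -- boundary cancel. What is left is the double boundary for tuples with x put in front, which
    -- vanishes by induction.
    d-d : ∀ {m} (G : Vec (Fin n) m → M) w → d (d G) w ≈ᴹ 0ᴹ
    d-d G (x ∷ y ∷ []) = -ᴹ‿inverseʳ _
    d-d G (x ∷ w@(_ ∷ _ ∷ _)) = begin
      d G w +ᴹ -ᴹ d (d G ∘ (x ∷_)) w                          ≈⟨ +ᴹ-congˡ (-ᴹ‿cong (d-cong {G = d G ∘ (x ∷_)} {H = λ u → G u +ᴹ -ᴹ d (G ∘ (x ∷_)) u} w (λ i → d-∷ G x (removeAt w i)))) ⟩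
      d G w +ᴹ -ᴹ d (λ u → G u +ᴹ -ᴹ d (G ∘ (x ∷_)) u) w      ≈⟨ +ᴹ-congˡ (-ᴹ‿cong (d-+- G (d (G ∘ (x ∷_))) w)) ⟩
      d G w +ᴹ -ᴹ (d G w +ᴹ -ᴹ d (d (G ∘ (x ∷_))) w)          ≈⟨ +ᴹ-congˡ (-ᴹ‿cong (+ᴹ-congˡ (-ᴹ‿cong (d-d (G ∘ (x ∷_)) w)))) ⟩
      d G w +ᴹ -ᴹ (d G w +ᴹ -ᴹ 0ᴹ)                            ≈⟨ +ᴹ-congˡ (-ᴹ‿cong (+ᴹ-congˡ ε⁻¹≈ε)) ⟩
      d G w +ᴹ -ᴹ (d G w +ᴹ 0ᴹ)                               ≈⟨ +ᴹ-congˡ (-ᴹ‿cong (+ᴹ-identityʳ _)) ⟩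
      d G w +ᴹ -ᴹ d G w                                       ≈⟨ -ᴹ‿inverseʳ _ ⟩
      0ᴹ                                                      ∎
      where open SetoidReasoning ≈ᴹ-setoid

    -- If w has a repeated entry then its two equal faces cancel and all the others are degenerate.
    d-degenerate : ∀ {m} (G : Vec (Fin n) m → M) → (∀ u → ¬ IsChain u → G u ≈ᴹ 0ᴹ) →
                   ∀ {w} → Weak w → ¬ IsChain w → d G w ≈ᴹ 0ᴹ
    d-degenerate G h {x ∷ []} _ ¬c = ⊥-elim (¬c _)
    d-degenerate G h {x ∷ y ∷ w} ((p ∷ _) ∷ ps) ¬c with x ≟F y
    ... | no x≢y = begin
      G (y ∷ w) +ᴹ -ᴹ d (G ∘ (x ∷_)) (y ∷ w)  ≈⟨ +ᴹ-cong (h _ ¬c′) (-ᴹ‿cong (d-degenerate (G ∘ (x ∷_)) (λ u ¬u → h _ (¬u ∘ chain-tail)) ps ¬c′)) ⟩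
      0ᴹ +ᴹ -ᴹ 0ᴹ                             ≈⟨ -ᴹ‿inverseʳ 0ᴹ ⟩
      0ᴹ                                      ∎
      where
      open SetoidReasoning ≈ᴹ-setoid
      ¬c′ : ¬ IsChain (y ∷ w)
      ¬c′ c = ¬c ((p , x≢y) , c)
    d-degenerate G h {x ∷ .x ∷ []} _ _ | yes refl = -ᴹ‿inverseʳ _
    d-degenerate G h {x ∷ .x ∷ z ∷ w} _ _ | yes refl = begin
      G u +ᴹ -ᴹ (G u +ᴹ -ᴹ d (G ∘ (x ∷_) ∘ (x ∷_)) (z ∷ w))   ≈⟨ +ᴹ-congˡ (-ᴹ‿cong (+ᴹ-congˡ (-ᴹ‿cong rest))) ⟩
      G u +ᴹ -ᴹ (G u +ᴹ -ᴹ 0ᴹ)                                ≈⟨ +ᴹ-congˡ (-ᴹ‿cong (≈ᴹ-trans (+ᴹ-congˡ ε⁻¹≈ε) (+ᴹ-identityʳ _))) ⟩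
      G u +ᴹ -ᴹ G u                                           ≈⟨ -ᴹ‿inverseʳ _ ⟩
      0ᴹ                                                      ∎
      where
      open SetoidReasoning ≈ᴹ-setoid
      u = x ∷ z ∷ w
      rest : d (G ∘ (x ∷_) ∘ (x ∷_)) (z ∷ w) ≈ᴹ 0ᴹ
      rest = ≈ᴹ-trans (d-cong (z ∷ w) (λ i → h _ (λ c → proj₂ (proj₁ c) refl))) (d-zero (z ∷ w))

  d-natural : ∀ {m ℓm m′ ℓm′} {A : RawKBMod m ℓm} {A′ : RawKBMod m′ ℓm′} (mA : IsMod A) (mA′ : IsMod A′)
              {φ : RawKBMod.M A → RawKBMod.M A′} → IsLinear A A′ φ → ∀ {m} (G : Vec (Fin n) m → RawKBMod.M A) w →
              RawKBMod._≈ᴹ_ A′ (φ (Boundary.d mA G w)) (Boundary.d mA′ (φ ∘ G) w)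
  d-natural {A′ = A′} mA mA′ lφ G (x ∷ []) = Mod.≈ᴹ-refl A′ mA′
  d-natural {A′ = A′} mA mA′ lφ G (x ∷ y ∷ w) = A′.≈ᴹ-trans (φ.+-hom _ _)
    (A′.+ᴹ-congˡ (A′.≈ᴹ-trans (φ.-‿hom _) (A′.-ᴹ‿cong (d-natural mA mA′ lφ (G ∘ (x ∷_)) (y ∷ w)))))
    where
    module A′ = Mod A′ mA′
    module φ = Linear mA mA′ lφ

  -- The chain complex of Δ(B) over kB

  module ℂ (q : ℕ) = Free (vecSummation (suc q)) _≟V_ isChain? (RawKBMod._▷_ (C q))

  [_] : ∀ {q} → Vec (Fin n) (suc q) → RawKBMod.M (C q)
  [_] {q} = ℂ.δ q

  C-isMod : ∀ q → IsMod (C q)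
  C-isMod q = ℂ.isMod q

  module _ {q : ℕ} where
    open Mod (C q) (C-isMod q)

    module C-Kernel b = ℂ.Kernel q {T = Vec (Fin n) (suc q)} (λ σ τ → when (map (b ·_) σ ≟V τ))
      (λ σ τ → scalars-when-linear (map (b ·_) σ ≟V τ) (id-linear triv-isMod))

    C-▷-linear : ∀ b → IsLinear (C q) (C q) (b ▷_)
    C-▷-linear b = pointwise-linear (RawKBMod._▷_ (C q)) (C-Kernel.kernel-at-linear b)
      {vecSummation (suc q)} {_≟V_} {isChain?}

    -- A degenerate weak chain is 0 and remains degenerate after multiplication by `b`. Covering
    -- this case lets the formula be iterated, as one multiplication already leaves only a weak
    -- chain.
    ▷-[] : ∀ b {w : Vec (Fin n) (suc q)} → Weak w → b ▷ [ w ] ≈ᴹ [ map (b ·_) w ]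
    ▷-[] b {w} p with isChain? w
    ... | yes chain = λ τ _ → C-Kernel.kernel-δ b chain τ
    ... | no ¬chain = begin
      b ▷ [ w ]             ≈⟨ b▷.cong (ℂ.δ-junk q ¬chain) ⟩
      b ▷ 0ᴹ                ≈⟨ b▷.0-hom ⟩
      0ᴹ                    ≈⟨ ℂ.δ-junk q (¬chain ∘ chain-map⁻ b p) ⟨
      [ map (b ·_) w ]      ∎
      where
      open SetoidReasoning ≈ᴹ-setoid
      module b▷ = Linear (C-isMod q) (C-isMod q) (C-▷-linear b)

    C-▷-assoc : ∀ a b x → (a · b) ▷ x ≈ᴹ a ▷ (b ▷ x)
    C-▷-assoc a b = ℂ.ext q (C-isMod q) (C-▷-linear (a · b))
      (∘-linear (C-isMod q) (C-▷-linear a) (C-▷-linear b)) λ w chain →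
      let p = chain⇒weak w chain in begin
      (a · b) ▷ [ w ]                    ≈⟨ ▷-[] (a · b) p ⟩
      [ map (a · b ·_) w ]               ≡⟨ ≡.cong [_] (map-· a b w) ⟨
      [ map (a ·_) (map (b ·_) w) ]      ≈⟨ ▷-[] a (weak-map b p) ⟨
      a ▷ [ map (b ·_) w ]               ≈⟨ IsLinear.cong (C-▷-linear a) (▷-[] b p) ⟨
      a ▷ (b ▷ [ w ])                    ∎
      where open SetoidReasoning ≈ᴹ-setoid

  C-isKB : ∀ q → IsKBModule (C q)
  C-isKB q = record
    { isModule = IsMod.isModule (C-isMod q)
    ; ▷-cong = λ b → IsLinear.cong (C-▷-linear b)
    ; ▷-+ = λ b → IsLinear.+-hom (C-▷-linear b)
    ; ▷-*ₗ = λ b → IsLinear.*ₗ-hom (C-▷-linear b)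
    ; ▷-assoc = C-▷-assoc
    }

  triv-isKB : IsKBModule triv
  triv-isKB = record
    { isModule = IsMod.isModule triv-isMod
    ; ▷-cong = λ _ p → p
    ; ▷-+ = λ _ _ _ → 𝕂.refl
    ; ▷-*ₗ = λ _ _ _ → 𝕂.refl
    ; ▷-assoc = λ _ _ _ → 𝕂.refl
    }

  module _ (q : ℕ) where
    private module 𝔹 = Boundary (C-isMod q)
    private module 𝕋ᵈ = Boundary triv-isMod
    open Mod (C q) (C-isMod q)

    module ∂-Kernel = ℂ.Kernel (suc q) {T = Vec (Fin n) (suc q)}
      (λ σ τ x → Σf (suc (suc q)) (λ i → when (removeAt σ i ≟V τ) (sign i *K x)))
      (λ σ τ → ⅀-linear triv-isMod (finSummation (suc (suc q))) λ i →
        scalars-when-linear (removeAt σ i ≟V τ) (*-linear (sign i)))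

    ∂-linear : IsLinear (C (suc q)) (C q) (∂ q)
    ∂-linear = pointwise-linear (RawKBMod._▷_ (C q)) ∂-Kernel.kernel-at-linear
      {vecSummation (suc q)} {_≟V_} {isChain?}

    private
      -1*sign : ∀ {k} (i : Fin k) g → (-K sign i) *K g ≈K -K (sign i *K g)
      -1*sign i g = 𝕂.sym (𝕂ₚ.-‿distribˡ-* (sign i) g)

      -- Each sign is the negative of its predecessor, which is the recursion that `d` follows.
      alternating-sum : ∀ {m} (G : Vec (Fin n) m → K) w →
                        Σf (suc m) (λ i → sign i *K G (removeAt w i)) ≈K 𝕋ᵈ.d G w
      alternating-sum G (x ∷ []) = 𝕂.trans (𝕂.+-identityʳ _) (𝕂.*-identityˡ _)
      alternating-sum {suc m} G (x ∷ y ∷ w) = 𝕂.+-cong (𝕂.*-identityˡ _) (begin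
        Σf (suc m) (λ i → (-K sign i) *K G (x ∷ removeAt (y ∷ w) i))  ≈⟨ 𝕋.⅀-cong (finSummation (suc m)) (λ i → -1*sign i (G (x ∷ removeAt (y ∷ w) i))) ⟩
        Σf (suc m) (λ i → -K (sign i *K G (x ∷ removeAt (y ∷ w) i)))  ≈⟨ Linear.⅀-hom triv-isMod triv-isMod neg (finSummation (suc m)) (λ i → sign i *K G (x ∷ removeAt (y ∷ w) i)) ⟨
        -K Σf (suc m) (λ i → sign i *K G (x ∷ removeAt (y ∷ w) i))    ≈⟨ 𝕂.-‿cong (alternating-sum (G ∘ (x ∷_)) (y ∷ w)) ⟩
        -K 𝕋ᵈ.d (G ∘ (x ∷_)) (y ∷ w)                                  ∎)
        where
        open SetoidReasoning 𝕋.≈ᴹ-setoid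
        neg : IsLinear triv triv (-K_)
        neg = -‿linear triv-isMod (id-linear triv-isMod)

      ∂-chain : ∀ w → IsChain w → ∂ q [ w ] ≈ᴹ 𝔹.d [_] w
      ∂-chain w chain τ τ-chain = begin
        ∂ q [ w ] τ                                                              ≈⟨ ∂-Kernel.kernel-δ chain τ ⟩
        Σf (suc (suc q)) (λ i → when (removeAt w i ≟V τ) (sign i *K 1#))         ≈⟨ 𝕋.⅀-cong (finSummation _) (λ i → pull i (removeAt w i ≟V τ)) ⟩
        Σf (suc (suc q)) (λ i → sign i *K [ removeAt w i ] τ)                    ≈⟨ alternating-sum (λ u → [ u ] τ) w ⟩
        𝕋ᵈ.d (λ u → [ u ] τ) w                                                   ≈⟨ d-natural (C-isMod q) triv-isMod (ℂ.at-linear q τ-chain) [_] w ⟨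
        𝔹.d [_] w τ                                                              ∎
        where
        open SetoidReasoning 𝕋.≈ᴹ-setoid
        pull : ∀ {p} {P : Set p} (i : Fin (suc (suc q))) (D : Dec P) → when D (sign i *K 1#) ≈K sign i *K when D 1#
        pull i (yes _) = 𝕂.refl
        pull i (no _) = 𝕂.sym (𝕂.zeroʳ _)

    -- On a degenerate weak chain both sides are 0, the right one because equal faces cancel.
    -- Equivariance of the boundary needs this case, as `b` may merge vertices of a chain.
    ∂-[] : ∀ {w} → Weak w → ∂ q [ w ] ≈ᴹ 𝔹.d [_] w
    ∂-[] {w} p with isChain? w
    ... | yes chain = ∂-chain w chain
    ... | no ¬chain = begin
      ∂ q [ w ]                      ≈⟨ ∂ᴸ.cong (ℂ.δ-junk (suc q) ¬chain) ⟩
      ∂ q (RawKBMod.0ᴹ (C (suc q)))  ≈⟨ ∂ᴸ.0-hom ⟩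
      0ᴹ                             ≈⟨ 𝔹.d-degenerate [_] (λ _ → ℂ.δ-junk q) p ¬chain ⟨
      𝔹.d [_] w                      ∎
      where
      open SetoidReasoning ≈ᴹ-setoid
      module ∂ᴸ = Linear (C-isMod (suc q)) (C-isMod q) ∂-linear

    ∂-isHom : IsHom (C (suc q)) (C q) (∂ q)
    ∂-isHom = record
      { IsLinear ∂-linear
      ; ▷-hom = λ b → ℂ.ext (suc q) (C-isMod q) (∘-linear (C-isMod q) ∂-linear (C-▷-linear b))
          (∘-linear (C-isMod q) (C-▷-linear b) ∂-linear) λ w chain → basis b (chain⇒weak w chain)
      }
      where
      open SetoidReasoning ≈ᴹ-setoid
      basis : ∀ b {w : Vec (Fin n) (suc (suc q))} → Weak w →
              ∂ q (RawKBMod._▷_ (C (suc q)) b [ w ]) ≈ᴹ b ▷ ∂ q [ w ]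
      basis b {w} p = begin
        ∂ q (RawKBMod._▷_ (C (suc q)) b [ w ])   ≈⟨ IsLinear.cong ∂-linear (▷-[] b p) ⟩
        ∂ q [ map (b ·_) w ]                     ≈⟨ ∂-[] (weak-map b p) ⟩
        𝔹.d [_] (map (b ·_) w)                   ≡⟨ 𝔹.d-map [_] (b ·_) w ⟩
        𝔹.d ([_] ∘ map (b ·_)) w                 ≈⟨ 𝔹.d-cong w (λ i → ▷-[] b (weak-removeAt p i)) ⟨
        𝔹.d ((b ▷_) ∘ [_]) w                     ≈⟨ d-natural (C-isMod q) (C-isMod q) (C-▷-linear b) [_] w ⟨
        b ▷ 𝔹.d [_] w                            ≈⟨ IsLinear.cong (C-▷-linear b) (∂-[] p) ⟨
        b ▷ ∂ q [ w ]                            ∎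

  ∂-d : ∀ q {w : Vec (Fin n) (suc (suc (suc q)))} → Weak w →
        RawKBMod._≈ᴹ_ (C q) (∂ q (Boundary.d (C-isMod (suc q)) [_] w)) (RawKBMod.0ᴹ (C q))
  ∂-d q {w} p = begin
    ∂ q (Boundary.d (C-isMod (suc q)) [_] w)   ≈⟨ d-natural (C-isMod (suc q)) (C-isMod q) (∂-linear q) [_] w ⟩
    𝔹.d (∂ q ∘ [_]) w                          ≈⟨ 𝔹.d-cong w (λ i → ∂-[] q (weak-removeAt p i)) ⟩
    𝔹.d (𝔹.d [_]) w                            ≈⟨ 𝔹.d-d [_] w ⟩
    0ᴹ                                         ∎
    where
    module 𝔹 = Boundary (C-isMod q)
    open Mod (C q) (C-isMod q)
    open SetoidReasoning ≈ᴹ-setoid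

  ∂-∂ : ∀ q f → RawKBMod._≈ᴹ_ (C q) (∂ q (∂ (suc q) f)) (RawKBMod.0ᴹ (C q))
  ∂-∂ q = ℂ.ext (suc (suc q)) (C-isMod q) (∘-linear (C-isMod q) (∂-linear q) (∂-linear (suc q)))
    (zero-linear (C-isMod q)) λ w chain →
      let p = chain⇒weak w chain in
      ≈ᴹ-trans (IsLinear.cong (∂-linear q) (∂-[] (suc q) p)) (∂-d q p)
    where open Mod (C q) (C-isMod q)

  ε-linear : IsLinear (C 0) triv ε
  ε-linear = ⅀-linear triv-isMod (finSummation n) (λ v → ℂ.at-linear 0 _)

  ε-[] : ∀ w → ε [ w ] ≈K 1#
  ε-[] (v ∷ []) = 𝕂.trans
    (𝕋.⅀-single (finSummation n) v (λ u u≢v → when-no ((v ∷ []) ≟V (u ∷ [])) (λ { refl → u≢v refl })))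
    (when-yes ((v ∷ []) ≟V (v ∷ [])) refl)

  ε-isHom : IsHom (C 0) triv ε
  ε-isHom = record
    { IsLinear ε-linear
    ; ▷-hom = λ b → ℂ.ext 0 triv-isMod (∘-linear triv-isMod ε-linear (C-▷-linear b)) ε-linear λ w chain →
        𝕂.trans (IsLinear.cong ε-linear (▷-[] b (chain⇒weak w chain)))
          (𝕂.trans (ε-[] (map (b ·_) w)) (𝕂.sym (ε-[] w)))
    }

  ε-∂ : ∀ f → ε (∂ 0 f) ≈K 0#
  ε-∂ = ℂ.ext 1 triv-isMod (∘-linear triv-isMod ε-linear (∂-linear 0)) (zero-linear triv-isMod)
    λ { w@(x ∷ y ∷ []) chain → begin
      ε (∂ 0 [ w ])                                     ≈⟨ IsLinear.cong ε-linear (∂-[] 0 (chain⇒weak w chain)) ⟩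
      ε (Boundary.d (C-isMod 0) [_] w)                  ≈⟨ d-natural (C-isMod 0) triv-isMod ε-linear [_] w ⟩
      ε [ y ∷ [] ] +K -K ε [ x ∷ [] ]                   ≈⟨ 𝕂.+-cong (ε-[] (y ∷ [])) (𝕂.-‿cong (ε-[] (x ∷ []))) ⟩
      1# +K -K 1#                                       ≈⟨ 𝕂.-‿inverseʳ 1# ⟩
      0#                                                ∎ }
    where open SetoidReasoning 𝕋.≈ᴹ-setoid

  -- The modules kL_X and the homomorphisms from C_q to them

  -- kL_X with X = B x.
  KL : Fin n → RawKBMod c ℓ
  KL x = record
    { M    = Fin n → K
    ; _≈ᴹ_ = λ f g → ∀ a → a ≡Λ x → f a ≈K g a
    ; _+ᴹ_ = λ f g a → f a +K g a
    ; 0ᴹ   = λ _ → 0#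
    ; -ᴹ_  = λ f a → -K f a
    ; _*ₗ_ = λ r f a → r *K f a
    ; _▷_  = λ b f a′ → Σf n (λ a → when (a ≡Λ? x) (when (x ⊆Λ? b) (when ((b · a) ≟F a′) (f a))))
    }

  module 𝕃 (x : Fin n) = Free (finSummation n) _≟F_ (_≡Λ? x) (RawKBMod._▷_ (KL x))

  KL-isMod : ∀ x → IsMod (KL x)
  KL-isMod x = 𝕃.isMod x

  δ : Fin n → Fin n → K
  δ a a′ = when (a ≟F a′) 1#

  module _ {x : Fin n} where
    open Mod (KL x) (KL-isMod x)

    private
      module KL-Kernel b = 𝕃.Kernel x {T = Fin n} (λ a a′ y → when (x ⊆Λ? b) (when ((b · a) ≟F a′) y))
        (λ a a′ → scalars-when-linear (x ⊆Λ? b) (scalars-when-linear ((b · a) ≟F a′) (id-linear triv-isMod)))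

    KL-▷-linear : ∀ b → IsLinear (KL x) (KL x) (b ▷_)
    KL-▷-linear b = pointwise-linear (RawKBMod._▷_ (KL x)) (KL-Kernel.kernel-at-linear b)
      {finSummation n} {_≟F_} {_≡Λ? x}

    ▷-δ : ∀ {b a} → x ⊑ b → a ≡Λ x → b ▷ δ a ≈ᴹ δ (b · a)
    ▷-δ {b} p q t _ = 𝕂.trans (KL-Kernel.kernel-δ b q t) (when-yes (x ⊆Λ? b) (⊑⇒⊆Λ p))

    ▷-kills : ∀ {b} → ¬ (x ⊑ b) → ∀ f → b ▷ f ≈ᴹ 0ᴹ
    ▷-kills {b} ¬p = 𝕃.ext x (KL-isMod x) (KL-▷-linear b) (zero-linear (KL-isMod x))
      λ a q t _ → 𝕂.trans (KL-Kernel.kernel-δ b q t) (when-no (x ⊆Λ? b) (¬p ∘ ⊆Λ⇒⊑))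

    ·-≡Λ : ∀ {b a} → x ⊑ b → a ≡Λ x → (b · a) ≡Λ x
    ·-≡Λ {b} {a} p q = ⊑-antisym (⊑-trans (·-⊑ʳ b a) (≡Λ⇒⊑ q)) (⊑-· p (≡Λ⇒⊒ q))

    KL-isKB : IsKBModule (KL x)
    KL-isKB = record
      { isModule = IsMod.isModule (KL-isMod x)
      ; ▷-cong = λ b → IsLinear.cong (KL-▷-linear b)
      ; ▷-+ = λ b → IsLinear.+-hom (KL-▷-linear b)
      ; ▷-*ₗ = λ b → IsLinear.*ₗ-hom (KL-▷-linear b)
      ; ▷-assoc = λ a b → 𝕃.ext x (KL-isMod x) (KL-▷-linear (a · b))
          (∘-linear (KL-isMod x) (KL-▷-linear a) (KL-▷-linear b))
          λ s q → cases a b s q (x ⊆Λ? b) (x ⊆Λ? a)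
      }
      where
      open SetoidReasoning ≈ᴹ-setoid
      -- B (a b) is the intersection of B a and B b, so it contains X exactly when both of them do;
      -- otherwise both sides are 0.
      cases : ∀ a b s → s ≡Λ x → Dec (x ⊆Λ b) → Dec (x ⊆Λ a) → (a · b) ▷ δ s ≈ᴹ a ▷ (b ▷ δ s)
      cases a b s q (no ¬p) _ = begin
        (a · b) ▷ δ s     ≈⟨ ▷-kills (λ p → ¬p (⊑⇒⊆Λ (⊑-trans p (·-⊑ʳ a b)))) (δ s) ⟩
        0ᴹ                ≈⟨ Linear.0-hom (KL-isMod x) (KL-isMod x) (KL-▷-linear a) ⟨
        a ▷ 0ᴹ            ≈⟨ IsLinear.cong (KL-▷-linear a) (▷-kills (¬p ∘ ⊑⇒⊆Λ) (δ s)) ⟨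
        a ▷ (b ▷ δ s)     ∎
      cases a b s q (yes _) (no ¬p) = begin
        (a · b) ▷ δ s     ≈⟨ ▷-kills (λ p → ¬p (⊑⇒⊆Λ (⊑-trans p (·-⊑ˡ a b)))) (δ s) ⟩
        0ᴹ                ≈⟨ ▷-kills (¬p ∘ ⊑⇒⊆Λ) (b ▷ δ s) ⟨
        a ▷ (b ▷ δ s)     ∎
      cases a b s q (yes p′) (yes p″) = begin
        (a · b) ▷ δ s     ≈⟨ ▷-δ (⊑-· p p₁) q ⟩
        δ (a · b · s)     ≡⟨ ≡.cong δ (assoc a b s) ⟩
        δ (a · (b · s))   ≈⟨ ▷-δ p (·-≡Λ p₁ q) ⟨
        a ▷ δ (b · s)     ≈⟨ IsLinear.cong (KL-▷-linear a) (▷-δ p₁ q) ⟨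
        a ▷ (b ▷ δ s)     ∎
        where
        p = ⊆Λ⇒⊑ p″
        p₁ = ⊆Λ⇒⊑ p′

  -- The homomorphism C_q → kL_X sending σ to x_q z if B x_q ⊇ B z = X and z σ = τ, and to 0 otherwise.
  module Coordinate {q : ℕ} (x z : Fin n) (z≡x : z ≡Λ x) (τ : Vec (Fin n) (suc q)) (τ-chain : IsChain τ) where
    open Mod (KL x) (KL-isMod x)

    private
      Hit : Vec (Fin n) (suc q) → Set
      Hit σ = z ⊆Λ top σ × map (z ·_) σ ≡ τ

      hit? : ∀ σ → Dec (Hit σ)
      hit? σ = (z ⊆Λ? top σ) ×-dec (map (z ·_) σ ≟V τ)

      module φ-Kernel = ℂ.Kernel q {T = Fin n} (λ σ a y → when (hit? σ) (when ((top σ · z) ≟F a) y))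
        (λ σ a → scalars-when-linear (hit? σ) (scalars-when-linear ((top σ · z) ≟F a) (id-linear triv-isMod)))

    φ : RawKBMod.M (C q) → M
    φ = φ-Kernel.kernel

    φ-linear : IsLinear (C q) (KL x) φ
    φ-linear = pointwise-linear (RawKBMod._▷_ (KL x)) φ-Kernel.kernel-at-linear
      {finSummation n} {_≟F_} {_≡Λ? x}

    private module φᴸ = Linear (C-isMod q) (KL-isMod x) φ-linear

    φ-hit : ∀ σ → Weak σ → z ⊑ top σ → map (z ·_) σ ≡ τ → φ [ σ ] ≈ᴹ δ (top σ · z)
    φ-hit σ p h₁ h₂ a _ = 𝕂.trans
      -- If `z` maps `σ` onto a chain, `σ` itself has no repetition.
      (φ-Kernel.kernel-δ (chain-map⁻ z p (≡.subst IsChain (≡.sym h₂) τ-chain)) a)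
      (when-yes (hit? σ) (⊑⇒⊆Λ h₁ , h₂))

    φ-miss : ∀ σ → ¬ (z ⊑ top σ × map (z ·_) σ ≡ τ) → φ [ σ ] ≈ᴹ 0ᴹ
    φ-miss σ ¬h with isChain? σ
    ... | yes chain = λ a _ → 𝕂.trans (φ-Kernel.kernel-δ chain a)
      (when-no (hit? σ) (λ (h₁ , h₂) → ¬h (⊆Λ⇒⊑ h₁ , h₂)))
    ... | no ¬chain = ≈ᴹ-trans (φᴸ.cong (ℂ.δ-junk q ¬chain)) φᴸ.0-hom

    -- The value at `a` sums `f ρ` over the simplices ρ that `z` maps to `τ` and whose top entry
    -- goes to `a`. Once all but one of them vanish, a coefficient of `f` can be read off in kL_X.
    φ-single : ∀ {a} σ → IsChain σ → z ⊑ top σ → map (z ·_) σ ≡ τ → top σ · z ≡ a → ∀ f →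
               (∀ ρ → ρ ≢ σ → z ⊑ top ρ → top ρ · z ≡ a → f ρ ≈K 0#) → φ f a ≈K f σ
    φ-single {a} σ chain h₁ h₂ h₃ f others = 𝕂.trans
      (𝕋.⅀-single (vecSummation (suc q)) σ λ ρ ρ≢σ → other ρ ρ≢σ (isChain? ρ) (hit? ρ) ((top ρ · z) ≟F a))
      (𝕂.trans (when-yes (isChain? σ) chain)
        (𝕂.trans (when-yes (hit? σ) (⊑⇒⊆Λ h₁ , h₂)) (when-yes ((top σ · z) ≟F a) h₃)))
      where
      other : ∀ ρ → ρ ≢ σ → (d₁ : Dec (IsChain ρ)) (d₂ : Dec (Hit ρ)) (d₃ : Dec (top ρ · z ≡ a)) →
              when d₁ (when d₂ (when d₃ (f ρ))) ≈K 0#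
      other ρ ρ≢σ (no _) _ _ = 𝕂.refl
      other ρ ρ≢σ (yes _) (no _) _ = 𝕂.refl
      other ρ ρ≢σ (yes _) (yes _) (no _) = 𝕂.refl
      other ρ ρ≢σ (yes _) (yes (h , _)) (yes h′) = others ρ ρ≢σ (⊆Λ⇒⊑ h) h′

    -- If `z ⊑ b` then z b = z, so `z` maps b σ and σ to the same simplex, and the top entry picks
    -- up the factor `b`. If not, b σ is missed because its top has support inside B b, and `b` acts
    -- on kL_X by 0.
    φ-isHom : IsHom (C q) (KL x) φ
    φ-isHom = record
      { IsLinear φ-linear
      ; ▷-hom = λ b → ℂ.ext q (KL-isMod x) (∘-linear (KL-isMod x) φ-linear (C-▷-linear b))
          (∘-linear (KL-isMod x) (KL-▷-linear b) φ-linear)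
          λ σ chain → ≈ᴹ-trans (φᴸ.cong (▷-[] b (chain⇒weak σ chain))) (cases b (chain⇒weak σ chain) (hit? σ) (z ⊆Λ? b))
      }
      where
      open SetoidReasoning ≈ᴹ-setoid
      cases : ∀ b {σ : Vec (Fin n) (suc q)} → Weak σ → Dec (Hit σ) → Dec (z ⊆Λ b) →
              φ [ map (b ·_) σ ] ≈ᴹ b ▷ φ [ σ ]
      cases b {σ} p _ (no ¬q) = begin
        φ [ map (b ·_) σ ]   ≈⟨ φ-miss (map (b ·_) σ) (λ (h , _) → ¬q (⊑⇒⊆Λ (⊑-trans (≡.subst (z ⊑_) (top-map b σ) h) (·-⊑ˡ b (top σ))))) ⟩
        0ᴹ                   ≈⟨ ▷-kills (λ h → ¬q (⊑⇒⊆Λ (⊑-trans (≡Λ⇒⊑ z≡x) h))) (φ [ σ ]) ⟨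
        b ▷ φ [ σ ]          ∎
      cases b {σ} p (yes (h₁ , h₂)) (yes q′) = begin
        φ [ map (b ·_) σ ]         ≈⟨ φ-hit (map (b ·_) σ) (weak-map b p) (≡.subst (z ⊑_) (≡.sym (top-map b σ)) (⊑-· z⊑b z⊑top))
                                       (≡.trans (map-· z b σ) (≡.trans (≡.cong (λ y → map (y ·_) σ) z⊑b) h₂)) ⟩
        δ (top (map (b ·_) σ) · z) ≡⟨ ≡.cong δ (≡.trans (≡.cong (_· z) (top-map b σ)) (assoc b (top σ) z)) ⟩
        δ (b · (top σ · z))        ≈⟨ ▷-δ (⊑-trans (≡Λ⇒⊒ z≡x) z⊑b) (·-≡Λ (⊑-trans (≡Λ⇒⊒ z≡x) z⊑top) z≡x) ⟨
        b ▷ δ (top σ · z)          ≈⟨ IsLinear.cong (KL-▷-linear b) (φ-hit σ p z⊑top h₂) ⟨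
        b ▷ φ [ σ ]                ∎
        where
        z⊑b = ⊆Λ⇒⊑ q′
        z⊑top = ⊆Λ⇒⊑ h₁
      cases b {σ} p (no ¬h) (yes q′) = begin
        φ [ map (b ·_) σ ]   ≈⟨ φ-miss (map (b ·_) σ) (λ (h₁ , h₂) → ¬h (⊑⇒⊆Λ (⊑-trans (≡.subst (z ⊑_) (top-map b σ) h₁) (·-⊑ʳ b (top σ))) ,
                                  ≡.trans (≡.sym (≡.trans (map-· z b σ) (≡.cong (λ y → map (y ·_) σ) (⊆Λ⇒⊑ q′)))) h₂)) ⟩
        0ᴹ                   ≈⟨ Linear.0-hom (KL-isMod x) (KL-isMod x) (KL-▷-linear b) ⟨
        b ▷ 0ᴹ               ≈⟨ IsLinear.cong (KL-▷-linear b) (φ-miss σ (λ (h₁ , h₂) → ¬h (⊑⇒⊆Λ h₁ , h₂))) ⟨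
        b ▷ φ [ σ ]          ∎

  -- The operators `T k` and `f b`

  module Choice (e : Fin n → Fin n) (choice : IsRepChoice e) where

    Fn : Summation (Fin n)
    Fn = finSummation n

    IsRep : Fin n → Set
    IsRep b = e b ≡ b

    e-isRep : ∀ b → IsRep (e b)
    e-isRep b = proj₂ choice (e b) b (proj₁ choice b)

    ⊑-e : ∀ b → b ⊑ e b
    ⊑-e b = ≡Λ⇒⊒ (proj₁ choice b)

    e-⊑ : ∀ b → e b ⊑ b
    e-⊑ b = ≡Λ⇒⊑ (proj₁ choice b)

    rep-unique : ∀ {a b} → IsRep a → IsRep b → a ≡Λ b → a ≡ b
    rep-unique p q r = ≡.trans (≡.sym p) (≡.trans (proj₂ choice _ _ r) q)

    atLevel? : ∀ b k → Dec (IsRep b × key b ≡ k)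
    atLevel? b k = (e b ≟F b) ×-dec (key b ℕ.≟ k)

    module KBMod {m ℓm} {A : RawKBMod m ℓm} (isKB : IsKBModule A) where
      open IsKBModule isKB public using (▷-cong; ▷-assoc)

      isMod : IsMod A
      isMod = mod (IsKBModule.isModule isKB)

      open Mod A isMod public

      ▷-linear : ∀ b → IsLinear A A (b ▷_)
      ▷-linear b = record { cong = ▷-cong b ; +-hom = IsKBModule.▷-+ isKB b ; *ₗ-hom = IsKBModule.▷-*ₗ isKB b }

      module ▷-Lin b = Linear isMod isMod (▷-linear b)

      ▷-≡ : ∀ {a b} m → a ≡ b → a ▷ m ≈ᴹ b ▷ m
      ▷-≡ m refl = ≈ᴹ-refl

      -- Multiplication by the representative with key `k`, or 0 if there is none: keys being
      -- injective, at most one term survives.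
      level : ℕ → M → M
      level k m = ⅀ Fn (λ b → whenᴹ (atLevel? b k) (b ▷ m))

      -- T k = (1 - b_{k-1}) ⋯ (1 - b_0), where b_i is the representative with key i, if there is one.
      T : ℕ → M → M
      T zero m = m
      T (suc k) m = T k m +ᴹ -ᴹ level k (T k m)

      -- For representatives b these are the primitive idempotents: c f_b = 0 when B c ⊊ B b,
      -- and x Σ_b f_b = x for all x.
      f : Fin n → M → M
      f b m = b ▷ T (key b) m

      level-linear : ∀ k → IsLinear A A (level k)
      level-linear k = ⅀-linear isMod Fn
        (λ b → when-linear isMod (atLevel? b k) (▷-linear b))

      T-linear : ∀ k → IsLinear A A (T k)
      T-linear zero = id-linear isMod
      T-linear (suc k) = +-linear isMod (T-linear k)
        (-‿linear isMod (∘-linear isMod (level-linear k) (T-linear k)))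

      f-linear : ∀ b → IsLinear A A (f b)
      f-linear b = ∘-linear isMod (▷-linear b) (T-linear (key b))

      ▷-level : ∀ c k m → c ▷ level k m ≈ᴹ ⅀ Fn (λ b → whenᴹ (atLevel? b k) ((c · b) ▷ m))
      ▷-level c k m = begin
        c ▷ level k m                                                    ≈⟨ ▷-Lin.⅀-hom c Fn _ ⟩
        ⅀ Fn (λ b → c ▷ whenᴹ (atLevel? b k) (b ▷ m))      ≈⟨ ⅀-cong Fn (λ b → ▷-Lin.when-hom c (atLevel? b k) _) ⟩
        ⅀ Fn (λ b → whenᴹ (atLevel? b k) (c ▷ (b ▷ m)))    ≈⟨ ⅀-cong Fn (λ b → whenᴹ-cong (atLevel? b k) (λ _ → ≈ᴹ-sym (▷-assoc c b m))) ⟩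
        ⅀ Fn (λ b → whenᴹ (atLevel? b k) ((c · b) ▷ m))    ∎
        where open SetoidReasoning ≈ᴹ-setoid

      ▷-T-suc : ∀ c k m → c ▷ T (suc k) m ≈ᴹ c ▷ T k m +ᴹ -ᴹ (c ▷ level k (T k m))
      ▷-T-suc c k m = ≈ᴹ-trans (▷-Lin.+-hom c _ _) (+ᴹ-congˡ (▷-Lin.-‿hom c _))

      level-single : ∀ {k y} → IsRep y → key y ≡ k → ∀ (g : Fin n → M) → ⅀ Fn (λ b → whenᴹ (atLevel? b k) (g b)) ≈ᴹ g y
      level-single {k} {y} p q g = ≈ᴹ-trans
        (⅀-single Fn y (λ b b≢y → whenᴹ-no (atLevel? b k) (λ (_ , r) → b≢y (key-injective (≡.trans r (≡.sym q))))))
        (whenᴹ-yes (atLevel? y k) (p , q))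

      x-0≈x : ∀ {x y} → y ≈ᴹ 0ᴹ → x +ᴹ -ᴹ y ≈ᴹ x
      x-0≈x p = ≈ᴹ-trans (+ᴹ-congˡ (≈ᴹ-trans (-ᴹ‿cong p) ε⁻¹≈ε)) (+ᴹ-identityʳ _)

      -- c w (1 - y) = 0 for all w, as c w y = c w c y = c w c = c w.
      ▷-T-zero : ∀ {y} → IsRep y → ∀ k → key y ℕ.< k → ∀ {c} → c ⊑ y → ∀ m → c ▷ T k m ≈ᴹ 0ᴹ
      ▷-T-zero {y} p (suc k) (ℕ.s≤s q) {c} c⊑y m with ℕₚ.m≤n⇒m<n∨m≡n q
      -- The factor of `y` lies further to the right. The new factor replaces `c` by `c` and
      -- `c · b`, both with support inside B y, and the induction hypothesis kills either term.
      ... | inj₁ q′ = begin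
        c ▷ T (suc k) m                           ≈⟨ ▷-T-suc c k m ⟩
        c ▷ T k m +ᴹ -ᴹ (c ▷ level k (T k m))     ≈⟨ x-0≈x (≈ᴹ-trans (▷-level c k _) (⅀-zero Fn λ b →
                                                       ≈ᴹ-trans (whenᴹ-cong (atLevel? b k) {y = 0ᴹ} (λ _ →
                                                         ▷-T-zero p k q′ (⊑-trans (·-⊑ˡ c b) c⊑y) m))
                                                       (Linear.0-hom isMod isMod (when-linear isMod (atLevel? b k) (id-linear isMod))))) ⟩
        c ▷ T k m                                 ≈⟨ ▷-T-zero p k q′ c⊑y m ⟩
        0ᴹ                                        ∎
        where open SetoidReasoning ≈ᴹ-setoid
      ... | inj₂ q′ = begin
        c ▷ T (suc k) m                           ≈⟨ ▷-T-suc c k m ⟩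
        c ▷ T k m +ᴹ -ᴹ (c ▷ level k (T k m))     ≈⟨ +ᴹ-congˡ (-ᴹ‿cong (≈ᴹ-trans (▷-level c k _) (level-single p q′ (λ b → (c · b) ▷ T k m)))) ⟩
        c ▷ T k m +ᴹ -ᴹ ((c · y) ▷ T k m)         ≈⟨ +ᴹ-congˡ (-ᴹ‿cong (▷-≡ _ c⊑y)) ⟩
        c ▷ T k m +ᴹ -ᴹ (c ▷ T k m)               ≈⟨ -ᴹ‿inverseʳ _ ⟩
        0ᴹ                                        ∎
        where open SetoidReasoning ≈ᴹ-setoid

      -- Expanding the product, only words starting with `c` occur. Each has support inside B c,
      -- hence inside B x, and absorbs a final factor `x`.
      ▷-T-absorb : ∀ k {c x} → c ⊑ x → ∀ m → c ▷ T k (x ▷ m) ≈ᴹ c ▷ T k m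
      ▷-T-absorb zero {c} {x} p m = ≈ᴹ-trans (≈ᴹ-sym (▷-assoc c x m)) (▷-≡ m p)
      ▷-T-absorb (suc k) {c} {x} p m = begin
        c ▷ T (suc k) (x ▷ m)                                    ≈⟨ ▷-T-suc c k _ ⟩
        c ▷ T k (x ▷ m) +ᴹ -ᴹ (c ▷ level k (T k (x ▷ m)))        ≈⟨ +ᴹ-cong (▷-T-absorb k p m) (-ᴹ‿cong levels) ⟩
        c ▷ T k m +ᴹ -ᴹ (c ▷ level k (T k m))                    ≈⟨ ▷-T-suc c k m ⟨
        c ▷ T (suc k) m                                          ∎
        where
        open SetoidReasoning ≈ᴹ-setoid
        levels : c ▷ level k (T k (x ▷ m)) ≈ᴹ c ▷ level k (T k m)
        levels = begin
          c ▷ level k (T k (x ▷ m))                                                     ≈⟨ ▷-level c k _ ⟩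
          ⅀ Fn (λ b → whenᴹ (atLevel? b k) ((c · b) ▷ T k (x ▷ m)))       ≈⟨ ⅀-cong Fn (λ b → whenᴹ-cong (atLevel? b k)
                                                                                            (λ _ → ▷-T-absorb k (⊑-trans (·-⊑ˡ c b) p) m)) ⟩
          ⅀ Fn (λ b → whenᴹ (atLevel? b k) ((c · b) ▷ T k m))             ≈⟨ ▷-level c k _ ⟨
          c ▷ level k (T k m)                                                           ∎

      ▷-T-keyBound : ∀ c m → c ▷ T keyBound m ≈ᴹ 0ᴹ
      ▷-T-keyBound c m = ▷-T-zero (e-isRep c) keyBound (key<keyBound _) (⊑-e c) m

      -- The representative of B a is strictly below `b`, so it comes earlier in the linear order
      -- and contributes to `T (key b)` a factor that every word starting with `a` kills.
      ▷-f-zero : ∀ {a b} → a ⊏ b → ∀ m → a ▷ T (key b) m ≈ᴹ 0ᴹ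
      ▷-f-zero {a} {b} (p , ¬q) m = ▷-T-zero (e-isRep a) (key b)
        (key-mono-< (⊑-trans (e-⊑ a) p , λ q → ¬q (⊑-trans q (e-⊑ a)))) (⊑-e a) m

      f-absorb : ∀ b m → f b (b ▷ m) ≈ᴹ f b m
      f-absorb b m = ▷-T-absorb (key b) (⊑-refl b) m

      below? : ∀ b k → Dec (IsRep b × key b ℕ.< k)
      below? b k = (e b ≟F b) ×-dec (key b ℕ.<? k)

      -- `T k` and `T (suc k)` differ by `level k` applied to `T k`, which is the `f b` of the
      -- representative `b` with key `k`.
      telescope : ∀ k m → ⅀ Fn (λ b → whenᴹ (below? b k) (f b m)) +ᴹ T k m ≈ᴹ m
      telescope zero m = ≈ᴹ-trans (+ᴹ-congʳ (⅀-zero Fn (λ b → whenᴹ-no (below? b 0) λ ()))) (+ᴹ-identityˡ m)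
      telescope (suc k) m = begin
        ⅀ Fn (λ b → whenᴹ (below? b (suc k)) (f b m)) +ᴹ T (suc k) m                        ≈⟨ +ᴹ-congʳ (⅀-cong Fn split) ⟩
        ⅀ Fn (λ b → whenᴹ (below? b k) (f b m) +ᴹ whenᴹ (atLevel? b k) (b ▷ T k m)) +ᴹ T (suc k) m
                                                                                            ≈⟨ +ᴹ-congʳ (⅀-+ Fn _ _) ⟩
        ⅀ Fn (λ b → whenᴹ (below? b k) (f b m)) +ᴹ level k (T k m) +ᴹ T (suc k) m           ≈⟨ +ᴹ-assoc _ _ _ ⟩
        ⅀ Fn (λ b → whenᴹ (below? b k) (f b m)) +ᴹ (level k (T k m) +ᴹ T (suc k) m)         ≈⟨ +ᴹ-congˡ (x+[y-x] _ _) ⟩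
        ⅀ Fn (λ b → whenᴹ (below? b k) (f b m)) +ᴹ T k m                                    ≈⟨ telescope k m ⟩
        m                                                                                   ∎
        where
        open SetoidReasoning ≈ᴹ-setoid
        split : ∀ b → whenᴹ (below? b (suc k)) (f b m) ≈ᴹ whenᴹ (below? b k) (f b m) +ᴹ whenᴹ (atLevel? b k) (b ▷ T k m)
        split b with e b ≟F b | ℕₚ.<-cmp (key b) k
        ... | no ¬p | _ = begin
          whenᴹ (no ¬p ×-dec (key b ℕ.<? suc k)) (f b m)   ≈⟨ whenᴹ-no (no ¬p ×-dec (key b ℕ.<? suc k)) {f b m} (¬p ∘ proj₁) ⟩
          0ᴹ                                               ≈⟨ +ᴹ-identityˡ 0ᴹ ⟨
          0ᴹ +ᴹ 0ᴹ                                         ≈⟨ +ᴹ-cong (whenᴹ-no (no ¬p ×-dec (key b ℕ.<? k)) {f b m} (¬p ∘ proj₁))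
                                                                (whenᴹ-no (no ¬p ×-dec (key b ℕ.≟ k)) {b ▷ T k m} (¬p ∘ proj₁)) ⟨
          _                                                ∎
        ... | yes p | tri< q q′ _ = begin
          _                                                ≈⟨ whenᴹ-yes (yes p ×-dec (key b ℕ.<? suc k)) (p , ℕₚ.m<n⇒m<1+n q) ⟩
          f b m                                            ≈⟨ +ᴹ-identityʳ _ ⟨
          f b m +ᴹ 0ᴹ                                      ≈⟨ +ᴹ-cong (whenᴹ-yes (yes p ×-dec (key b ℕ.<? k)) (p , q))
                                                                (whenᴹ-no (yes p ×-dec (key b ℕ.≟ k)) {b ▷ T k m} (q′ ∘ proj₂)) ⟨
          _                                                ∎
        ... | yes p | tri> q q′ r = begin
          _                                                ≈⟨ whenᴹ-no (yes p ×-dec (key b ℕ.<? suc k)) (λ (_ , s) → ℕₚ.<⇒≱ r (ℕₚ.≤-pred s)) ⟩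
          0ᴹ                                               ≈⟨ +ᴹ-identityʳ _ ⟨
          0ᴹ +ᴹ 0ᴹ                                         ≈⟨ +ᴹ-cong (whenᴹ-no (yes p ×-dec (key b ℕ.<? k)) {f b m} (q ∘ proj₂))
                                                                (whenᴹ-no (yes p ×-dec (key b ℕ.≟ k)) {b ▷ T k m} (q′ ∘ proj₂)) ⟨
          _                                                ∎
        ... | yes p | tri≈ q refl _ = begin
          _                                                ≈⟨ whenᴹ-yes (yes p ×-dec (key b ℕ.<? suc k)) (p , ℕₚ.≤-refl) ⟩
          f b m                                            ≈⟨ +ᴹ-identityˡ _ ⟨
          0ᴹ +ᴹ f b m                                      ≈⟨ +ᴹ-cong (whenᴹ-no (yes p ×-dec (key b ℕ.<? k)) {f b m} (q ∘ proj₂))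
                                                                (whenᴹ-yes (yes p ×-dec (key b ℕ.≟ k)) (p , refl)) ⟨
          _                                                ∎

      Σf-identity : ∀ m → ⅀ Fn (λ b → whenᴹ (e b ≟F b) (f b m)) +ᴹ T keyBound m ≈ᴹ m
      Σf-identity m = ≈ᴹ-trans (+ᴹ-congʳ (⅀-cong Fn λ b → bounded b)) (telescope keyBound m)
        where
        bounded : ∀ b → whenᴹ (e b ≟F b) (f b m) ≈ᴹ whenᴹ (below? b keyBound) (f b m)
        bounded b with e b ≟F b
        ... | yes p = ≈ᴹ-sym (whenᴹ-yes (yes p ×-dec (key b ℕ.<? keyBound)) (p , key<keyBound b))
        ... | no ¬p = ≈ᴹ-sym (whenᴹ-no (no ¬p ×-dec (key b ℕ.<? keyBound)) {f b m} (¬p ∘ proj₁))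

      ▷-Σf : ∀ x m → x ▷ ⅀ Fn (λ b → whenᴹ (e b ≟F b) (f b m)) ≈ᴹ x ▷ m
      ▷-Σf x m = begin
        x ▷ u                          ≈⟨ +ᴹ-identityʳ _ ⟨
        x ▷ u +ᴹ 0ᴹ                    ≈⟨ +ᴹ-congˡ (▷-T-keyBound x m) ⟨
        x ▷ u +ᴹ x ▷ T keyBound m      ≈⟨ ▷-Lin.+-hom x u _ ⟨
        x ▷ (u +ᴹ T keyBound m)        ≈⟨ ▷-cong x (Σf-identity m) ⟩
        x ▷ m                          ∎
        where
        open SetoidReasoning ≈ᴹ-setoid
        u = ⅀ Fn (λ b → whenᴹ (e b ≟F b) (f b m))

    T-natural : ∀ {m ℓm m′ ℓm′} {A : RawKBMod m ℓm} {A′ : RawKBMod m′ ℓm′} (kA : IsKBModule A) (kA′ : IsKBModule A′)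
                {φ : RawKBMod.M A → RawKBMod.M A′} → IsHom A A′ φ →
                ∀ k x → RawKBMod._≈ᴹ_ A′ (φ (KBMod.T kA k x)) (KBMod.T kA′ k (φ x))
    T-natural {A = A} {A′} kA kA′ {φ} φ-hom = go
      where
      module A = KBMod kA
      module A′ = KBMod kA′
      module φ = Linear A.isMod A′.isMod (hom⇒linear φ-hom)
      open SetoidReasoning A′.≈ᴹ-setoid
      go : ∀ k x → φ (A.T k x) A′.≈ᴹ A′.T k (φ x)
      go zero x = A′.≈ᴹ-refl
      go (suc k) x = begin
        φ (A.T k x A.+ᴹ A.-ᴹ A.level k (A.T k x))                ≈⟨ φ.+-hom _ _ ⟩
        φ (A.T k x) A′.+ᴹ φ (A.-ᴹ A.level k (A.T k x))           ≈⟨ A′.+ᴹ-congˡ (φ.-‿hom _) ⟩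
        φ (A.T k x) A′.+ᴹ A′.-ᴹ φ (A.level k (A.T k x))          ≈⟨ A′.+ᴹ-cong (go k x) (A′.-ᴹ‿cong levels) ⟩
        A′.T k (φ x) A′.+ᴹ A′.-ᴹ A′.level k (A′.T k (φ x))       ∎
        where
        levels : φ (A.level k (A.T k x)) A′.≈ᴹ A′.level k (A′.T k (φ x))
        levels = A′.≈ᴹ-trans (φ.⅀-hom Fn _) (A′.⅀-cong Fn λ b → A′.≈ᴹ-trans (φ.when-hom (atLevel? b k) _)
          (A′.whenᴹ-cong (atLevel? b k) λ _ → A′.≈ᴹ-trans (IsHom.▷-hom φ-hom b _) (A′.▷-cong b (go k x))))

    module KLᵏ {x : Fin n} = KBMod (KL-isKB {x})

    module _ {x : Fin n} (x-rep : IsRep x) where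
      open KLᵏ {x}

      private
        -- A representative that acts nontrivially on kL_X generates a left ideal containing X, and
        -- such representatives come no earlier than `x` in the linear extension.
        level-zero : ∀ k → k ℕ.< key x → ∀ m → level k m ≈ᴹ 0ᴹ
        level-zero k k<key m = ⅀-zero Fn λ b → term b (atLevel? b k)
          where
          term : ∀ b (d : Dec (IsRep b × key b ≡ k)) → whenᴹ d (b ▷ m) ≈ᴹ 0ᴹ
          term b (no _) = ≈ᴹ-refl
          term b (yes (b-rep , refl)) = ▷-kills (λ x⊑b → ℕₚ.<-asym k<key (key-mono-< (x⊑b , λ b⊑x →
            ℕₚ.<⇒≢ k<key (≡.cong key (rep-unique b-rep x-rep (⊑-antisym b⊑x x⊑b)))))) m

      T-identity-below : ∀ k → k ℕ.≤ key x → ∀ m → T k m ≈ᴹ m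
      T-identity-below zero _ m = ≈ᴹ-refl
      T-identity-below (suc k) p m = ≈ᴹ-trans (x-0≈x (level-zero k p _)) (T-identity-below k (ℕₚ.<⇒≤ p) m)

      -- The factors of smaller key act as the identity on kL_X, the factor 1 - x kills `δ x`
      -- because `x` is idempotent, and the later ones preserve 0.
      T-δ-rep : ∀ k → key x ℕ.< k → T k (δ x) ≈ᴹ 0ᴹ
      T-δ-rep (suc k) (ℕ.s≤s p) with ℕₚ.m≤n⇒m<n∨m≡n p
      ... | inj₁ p′ = begin
        T k (δ x) +ᴹ -ᴹ level k (T k (δ x))   ≈⟨ IsLinear.cong step (T-δ-rep k p′) ⟩
        0ᴹ +ᴹ -ᴹ level k 0ᴹ                   ≈⟨ Linear.0-hom isMod isMod step ⟩
        0ᴹ                                    ∎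
        where
        open SetoidReasoning ≈ᴹ-setoid
        step : IsLinear (KL x) (KL x) (λ m → m +ᴹ -ᴹ level k m)
        step = +-linear isMod (id-linear isMod) (-‿linear isMod (level-linear k))
      ... | inj₂ refl = begin
        T k (δ x) +ᴹ -ᴹ level k (T k (δ x))   ≈⟨ +ᴹ-cong T-δ (-ᴹ‿cong (level-single x-rep refl (_▷ T k (δ x)))) ⟩
        δ x +ᴹ -ᴹ (x ▷ T k (δ x))             ≈⟨ +ᴹ-congˡ (-ᴹ‿cong (▷-cong x T-δ)) ⟩
        δ x +ᴹ -ᴹ (x ▷ δ x)                   ≈⟨ +ᴹ-congˡ (-ᴹ‿cong (▷-δ (⊑-refl x) (≡Λ-refl x))) ⟩
        δ x +ᴹ -ᴹ δ (x · x)                   ≡⟨ ≡.cong (λ y → δ x +ᴹ -ᴹ δ y) (idem x) ⟩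
        δ x +ᴹ -ᴹ δ x                         ≈⟨ -ᴹ‿inverseʳ _ ⟩
        0ᴹ                                    ∎
        where
        open SetoidReasoning ≈ᴹ-setoid
        T-δ = T-identity-below k ℕₚ.≤-refl (δ x)

    module _ {m ℓm} {A : RawKBMod m ℓm} (kA : IsKBModule A) where
      private module A = KBMod kA

      -- The homomorphism kL_X → A sending a to a f_X m; it is equivariant because c f_X = 0 when B c ⊊ X.
      ψ : ∀ x → A.M → (Fin n → K) → A.M
      ψ x m = 𝕃.lin x A.isMod (λ a → a A.▷ A.T (key x) m)

      ψ-δ : ∀ {x a} m → a ≡Λ x → ψ x m (δ a) A.≈ᴹ a A.▷ A.T (key x) m
      ψ-δ {x} m = 𝕃.lin-δ x A.isMod (λ a → a A.▷ A.T (key x) m)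

      ψ-linear : ∀ x m → IsLinear (KL x) A (ψ x m)
      ψ-linear x m = 𝕃.lin-linear x A.isMod (λ a → a A.▷ A.T (key x) m)

      ψ-isHom : ∀ x m → IsHom (KL x) A (ψ x m)
      ψ-isHom x m = record
        { IsLinear (ψ-linear x m)
        ; ▷-hom = λ b → 𝕃.ext x A.isMod (∘-linear A.isMod (ψ-linear x m) (KL-▷-linear b))
            (∘-linear A.isMod (A.▷-linear b) (ψ-linear x m)) λ a p → cases b a p (x ⊆Λ? b)
        }
        where
        open SetoidReasoning A.≈ᴹ-setoid
        module ψᴸ = Linear (KL-isMod x) A.isMod (ψ-linear x m)
        cases : ∀ b a → a ≡Λ x → Dec (x ⊆Λ b) → ψ x m (RawKBMod._▷_ (KL x) b (δ a)) A.≈ᴹ b A.▷ ψ x m (δ a)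
        cases b a p (yes q) = begin
          ψ x m (RawKBMod._▷_ (KL x) b (δ a))   ≈⟨ ψᴸ.cong (▷-δ (⊆Λ⇒⊑ q) p) ⟩
          ψ x m (δ (b · a))                     ≈⟨ ψ-δ m (·-≡Λ (⊆Λ⇒⊑ q) p) ⟩
          (b · a) A.▷ A.T (key x) m                 ≈⟨ A.▷-assoc b a _ ⟩
          b A.▷ (a A.▷ A.T (key x) m)               ≈⟨ A.▷-cong b (ψ-δ m p) ⟨
          b A.▷ ψ x m (δ a)                     ∎
        cases b a p (no ¬q) = begin
          ψ x m (RawKBMod._▷_ (KL x) b (δ a))   ≈⟨ ψᴸ.cong (▷-kills (¬q ∘ ⊑⇒⊆Λ) (δ a)) ⟩
          ψ x m (λ _ → 0#)                          ≈⟨ ψᴸ.0-hom ⟩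
          A.0ᴹ                                      ≈⟨ A.▷-f-zero (⊑-trans (·-⊑ʳ b a) (≡Λ⇒⊑ p) ,
                                                         λ h → ¬q (⊑⇒⊆Λ (⊑-trans h (·-⊑ˡ b a)))) m ⟨
          (b · a) A.▷ A.T (key x) m                 ≈⟨ A.▷-assoc b a _ ⟩
          b A.▷ (a A.▷ A.T (key x) m)               ≈⟨ A.▷-cong b (ψ-δ m p) ⟨
          b A.▷ ψ x m (δ a)                     ∎

    ψ-natural : ∀ {m ℓm m′ ℓm′} {A : RawKBMod m ℓm} {A′ : RawKBMod m′ ℓm′} (kA : IsKBModule A) (kA′ : IsKBModule A′)
                {θ : RawKBMod.M A → RawKBMod.M A′} → IsHom A A′ θ →
                ∀ x {m m′} → RawKBMod._≈ᴹ_ A′ (θ m) m′ → ∀ g → RawKBMod._≈ᴹ_ A′ (θ (ψ kA x m g)) (ψ kA′ x m′ g)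
    ψ-natural {A = A} {A′} kA kA′ {θ} θ-hom x {m} {m′} p =
      𝕃.ext x A′.isMod (∘-linear A′.isMod (hom⇒linear θ-hom) (ψ-linear kA x m)) (ψ-linear kA′ x m′) λ a q → begin
        θ (ψ kA x m (δ a))            ≈⟨ IsHom.cong θ-hom (ψ-δ kA m q) ⟩
        θ (a A.▷ A.T (key x) m)           ≈⟨ IsHom.▷-hom θ-hom a _ ⟩
        a A′.▷ θ (A.T (key x) m)          ≈⟨ A′.▷-cong a (T-natural kA kA′ θ-hom (key x) m) ⟩
        a A′.▷ A′.T (key x) (θ m)         ≈⟨ A′.▷-cong a (IsLinear.cong (A′.T-linear (key x)) p) ⟩
        a A′.▷ A′.T (key x) m′            ≈⟨ ψ-δ kA′ m′ q ⟨
        ψ kA′ x m′ (δ a)              ∎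
      where
      module A = KBMod kA
      module A′ = KBMod kA′
      open SetoidReasoning A′.≈ᴹ-setoid

    -- The isomorphism of C_q with a sum of copies of kL_X, and projectivity

    module _ (q : ℕ) where

      faces : ∀ b → Listing (IsFace b) (nSimp q b)
      faces b = countListing (suc q) (IsFace b)
        (λ σ → isChain? σ ×-dec allV? (_∈·B? b) σ ×-dec anyV? (b ≟F_) σ)

      private
        module D = RawKBMod (D e q)
        module Faces b = Listing (faces b)

      face : ∀ b → Fin (nSimp q b) → Vec (Fin n) (suc q)
      face = Faces.elem

      face-isFace : ∀ b j → IsFace b (face b j)
      face-isFace = Faces.elem-sound

      module φ b j = Coordinate b b (≡Λ-refl b) (face b j) (proj₁ (face-isFace b j))

      Φ : RawKBMod.M (C q) → D.M
      Φ f b j = φ.φ b j f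

      Φ-isHom : IsHom (C q) (D e q) Φ
      Φ-isHom = record
        { cong = λ p b _ j → IsHom.cong (φ.φ-isHom b j) p
        ; +-hom = λ f g b _ j → IsHom.+-hom (φ.φ-isHom b j) f g
        ; *ₗ-hom = λ r f b _ j → IsHom.*ₗ-hom (φ.φ-isHom b j) r f
        ; ▷-hom = λ c f b _ j → IsHom.▷-hom (φ.φ-isHom b j) c f
        }

      -- One element m per summand. It enters `ψ` only through f_X m, so any family, without
      -- conditions, defines a homomorphism on `D`.
      Generators : ∀ {m} → Set m → Set m
      Generators M = ∀ b → Fin (nSimp q b) → M

      module _ {m ℓm} {A : RawKBMod m ℓm} (kA : IsKBModule A) where
        private module A = KBMod kA

        Ψ : Generators A.M → D.M → A.M
        Ψ m g = A.⅀ Fn (λ b → A.whenᴹ (e b ≟F b) (A.⅀ (finSummation (nSimp q b)) (λ j → ψ kA b (m b j) (g b j))))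

        Ψ-linear : ∀ m → IsLinear (D e q) A (Ψ m)
        Ψ-linear m = ⅀-linear A.isMod Fn λ b → term b (e b ≟F b)
          where
          component-linear : ∀ {b} → IsRep b → ∀ j → IsLinear (D e q) (KL b) (λ g → g b j)
          component-linear {b} p j = record
            { cong = λ h → h b p j ; +-hom = λ _ _ _ _ → 𝕂.refl ; *ₗ-hom = λ _ _ _ _ → 𝕂.refl }
          term : ∀ b (d : Dec (IsRep b)) → IsLinear (D e q) A
                 (λ g → A.whenᴹ d (A.⅀ (finSummation (nSimp q b)) (λ j → ψ kA b (m b j) (g b j))))
          term b (no _) = zero-linear A.isMod
          term b (yes p) = ⅀-linear A.isMod (finSummation (nSimp q b)) λ j →
            ∘-linear A.isMod (ψ-linear kA b (m b j)) (component-linear p j)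

        Ψ-isHom : ∀ m → IsHom (D e q) A (Ψ m)
        Ψ-isHom m = record
          { IsLinear (Ψ-linear m)
          ; ▷-hom = λ c g → begin
              Ψ m (c D.▷ g)
                ≈⟨ A.⅀-cong Fn (λ b → A.whenᴹ-cong (e b ≟F b) λ _ → A.⅀-cong (finSummation (nSimp q b)) λ j →
                     IsHom.▷-hom (ψ-isHom kA b (m b j)) c (g b j)) ⟩
              A.⅀ Fn (λ b → A.whenᴹ (e b ≟F b) (A.⅀ (finSummation (nSimp q b)) (λ j → c A.▷ ψ kA b (m b j) (g b j))))
                ≈⟨ A.⅀-cong Fn (λ b → A.whenᴹ-cong (e b ≟F b) λ _ → A.▷-Lin.⅀-hom c (finSummation (nSimp q b)) _) ⟨
              A.⅀ Fn (λ b → A.whenᴹ (e b ≟F b) (c A.▷ A.⅀ (finSummation (nSimp q b)) (λ j → ψ kA b (m b j) (g b j))))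
                ≈⟨ A.⅀-cong Fn (λ b → A.▷-Lin.when-hom c (e b ≟F b) _) ⟨
              A.⅀ Fn (λ b → c A.▷ A.whenᴹ (e b ≟F b) (A.⅀ (finSummation (nSimp q b)) (λ j → ψ kA b (m b j) (g b j))))
                ≈⟨ A.▷-Lin.⅀-hom c Fn _ ⟨
              c A.▷ Ψ m g ∎
          }
          where open SetoidReasoning A.≈ᴹ-setoid

      Ψ-natural : ∀ {m ℓm m′ ℓm′} {A : RawKBMod m ℓm} {A′ : RawKBMod m′ ℓm′} (kA : IsKBModule A) (kA′ : IsKBModule A′)
                  {θ : RawKBMod.M A → RawKBMod.M A′} → IsHom A A′ θ →
                  ∀ {m m′} → (∀ b j → RawKBMod._≈ᴹ_ A′ (θ (m b j)) (m′ b j)) →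
                  ∀ g → RawKBMod._≈ᴹ_ A′ (θ (Ψ kA m g)) (Ψ kA′ m′ g)
      Ψ-natural kA kA′ {θ} θ-hom {m} {m′} p g =
        A′.≈ᴹ-trans (θᴸ.⅀-hom Fn _) (A′.⅀-cong Fn λ b →
        A′.≈ᴹ-trans (θᴸ.when-hom (e b ≟F b) _) (A′.whenᴹ-cong (e b ≟F b) λ _ →
        A′.≈ᴹ-trans (θᴸ.⅀-hom (finSummation (nSimp q b)) _) (A′.⅀-cong (finSummation (nSimp q b)) λ j →
        ψ-natural kA kA′ θ-hom b (p b j) (g b j))))
        where
        module A′ = KBMod kA′
        module θᴸ = Linear (KBMod.isMod kA) A′.isMod (hom⇒linear θ-hom)

      basisFaces : Generators (RawKBMod.M (C q))
      basisFaces b j = [ face b j ]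

      ΨC : D.M → RawKBMod.M (C q)
      ΨC = Ψ (C-isKB q) basisFaces

    module _ (q : ℕ) where
      private
        module D = RawKBMod (D e q)
        module Faces b = Listing (faces q b)

      -- On a simplex σ with top x_q each representative `b` contributes x_q f_b σ. These add up to
      -- x_q σ because x_q Σ f_b = x_q, and x_q σ = σ because x_q is the largest vertex.
      ΨΦ≈id : ∀ f → RawKBMod._≈ᴹ_ (C q) (ΨC q (Φ q f)) f
      ΨΦ≈id = ℂ.ext q (C-isMod q) (linear-ΨΦ) (id-linear (C-isMod q)) λ σ chain → on-basis σ chain
        where
        open KBMod (C-isKB q)
        open SetoidReasoning ≈ᴹ-setoid

        linear-ΨΦ : IsLinear (C q) (C q) (ΨC q ∘ Φ q)
        linear-ΨΦ = ∘-linear (C-isMod q) (Ψ-linear q (C-isKB q) (basisFaces q)) (hom⇒linear (Φ-isHom q))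

        summand : ∀ b (σ : Vec (Fin n) (suc q)) → Fin (nSimp q b) → M
        summand b σ j = ψ (C-isKB q) b [ face q b j ] (φ.φ q b j [ σ ])

        summand-miss : ∀ b σ j → ¬ (b ⊑ top σ × map (b ·_) σ ≡ face q b j) → summand b σ j ≈ᴹ 0ᴹ
        summand-miss b σ j h = ≈ᴹ-trans (ψᴸ.cong (φ.φ-miss q b j σ h)) ψᴸ.0-hom
          where module ψᴸ = Linear (KL-isMod b) (C-isMod q) (ψ-linear (C-isKB q) b [ face q b j ])

        -- If B b is not contained in B x_q, no copy is hit, and x_q f_b = 0 since x_q b has
        -- strictly smaller support than `b`. Otherwise f_b σ = f_b (b σ), which is 0 if b σ is
        -- degenerate; if not, b σ is listed exactly once.
        coordinate : ∀ b σ → IsChain σ → Dec (b ⊑ top σ) → Dec (IsChain (map (b ·_) σ)) →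
                     ⅀ (finSummation (nSimp q b)) (summand b σ) ≈ᴹ top σ ▷ f b [ σ ]
        coordinate b σ chain (no ¬p) _ = begin
          ⅀ (finSummation (nSimp q b)) (summand b σ)    ≈⟨ ⅀-zero (finSummation (nSimp q b)) (λ j → summand-miss b σ j (¬p ∘ proj₁)) ⟩
          0ᴹ                                            ≈⟨ ▷-f-zero (·-⊑ʳ (top σ) b , λ h → ¬p (⊑-trans h (·-⊑ˡ (top σ) b))) [ σ ] ⟨
          (top σ · b) ▷ T (key b) [ σ ]                 ≈⟨ ▷-assoc (top σ) b (T (key b) [ σ ]) ⟩
          top σ ▷ f b [ σ ]                             ∎
        coordinate b σ chain (yes p) (no ¬c) = begin
          ⅀ (finSummation (nSimp q b)) (summand b σ)    ≈⟨ ⅀-zero (finSummation (nSimp q b)) (λ j → summand-miss b σ j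
                                                             (λ (_ , h) → ¬c (≡.subst IsChain (≡.sym h) (proj₁ (face-isFace q b j))))) ⟩
          0ᴹ                                            ≈⟨ ▷-Lin.0-hom (top σ) ⟨
          top σ ▷ 0ᴹ                                    ≈⟨ ▷-cong (top σ) (Linear.0-hom (C-isMod q) (C-isMod q) (f-linear b)) ⟨
          top σ ▷ f b 0ᴹ                                ≈⟨ ▷-cong (top σ) (IsLinear.cong (f-linear b)
                                                             (≈ᴹ-trans (▷-[] b (chain⇒weak σ chain)) (ℂ.δ-junk q ¬c))) ⟨
          top σ ▷ f b (b ▷ [ σ ])                       ≈⟨ ▷-cong (top σ) (f-absorb b [ σ ]) ⟩
          top σ ▷ f b [ σ ]                             ∎
        coordinate b σ chain (yes p) (yes c) = begin
          ⅀ (finSummation (nSimp q b)) (summand b σ)    ≈⟨ ⅀-single (finSummation (nSimp q b)) j₀ (λ j j≢j₀ → summand-miss b σ j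
                                                             (λ (_ , h) → j≢j₀ (Faces.elem-injective b (≡.trans (≡.sym h) (≡.sym face-j₀))))) ⟩
          summand b σ j₀                                ≈⟨ IsLinear.cong (ψ-linear (C-isKB q) b [ face q b j₀ ])
                                                             (φ.φ-hit q b j₀ σ weak p (≡.sym face-j₀)) ⟩
          ψ (C-isKB q) b [ face q b j₀ ] (δ (top σ · b)) ≈⟨ ψ-δ (C-isKB q) [ face q b j₀ ] (·-≡Λ p (≡Λ-refl b)) ⟩
          (top σ · b) ▷ T (key b) [ face q b j₀ ]       ≡⟨ ≡.cong (λ w → (top σ · b) ▷ T (key b) [ w ]) face-j₀ ⟩
          (top σ · b) ▷ T (key b) [ map (b ·_) σ ]      ≈⟨ ▷-cong (top σ · b) (IsLinear.cong (T-linear (key b)) (▷-[] b weak)) ⟨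
          (top σ · b) ▷ T (key b) (b ▷ [ σ ])           ≈⟨ ▷-assoc (top σ) b (T (key b) (b ▷ [ σ ])) ⟩
          top σ ▷ f b (b ▷ [ σ ])                       ≈⟨ ▷-cong (top σ) (f-absorb b [ σ ]) ⟩
          top σ ▷ f b [ σ ]                             ∎
          where
          weak = chain⇒weak σ chain
          isFace = map-face b σ c p
          j₀ = Faces.index b (map (b ·_) σ) isFace
          face-j₀ : face q b j₀ ≡ map (b ·_) σ
          face-j₀ = Faces.elem-index b (map (b ·_) σ) isFace

        on-basis : ∀ σ → IsChain σ → ΨC q (Φ q [ σ ]) ≈ᴹ [ σ ]
        on-basis σ chain = begin
          ΨC q (Φ q [ σ ])                                          ≈⟨ ⅀-cong Fn (λ b → whenᴹ-cong (e b ≟F b) λ _ →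
                                                                        coordinate b σ chain (b · top σ ≟F b) (isChain? _)) ⟩
          ⅀ Fn (λ b → whenᴹ (e b ≟F b) (top σ ▷ f b [ σ ]))         ≈⟨ ⅀-cong Fn (λ b → ▷-Lin.when-hom (top σ) (e b ≟F b) _) ⟨
          ⅀ Fn (λ b → top σ ▷ whenᴹ (e b ≟F b) (f b [ σ ]))         ≈⟨ ▷-Lin.⅀-hom (top σ) Fn _ ⟨
          top σ ▷ ⅀ Fn (λ b → whenᴹ (e b ≟F b) (f b [ σ ]))         ≈⟨ ▷-Σf (top σ) [ σ ] ⟩
          top σ ▷ [ σ ]                                             ≈⟨ ▷-[] (top σ) (chain⇒weak σ chain) ⟩
          [ map (top σ ·_) σ ]                                      ≡⟨ ≡.cong [_] (≤⇒map-fixed (weak⇒≤top (chain⇒weak σ chain))) ⟩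
          [ σ ]                                                     ∎

      -- An entry of the matrix of `Φ q ∘ ΨC q`: from the copy belonging to `b` and `j` to the copy
      -- belonging to `b′` and `j′`.
      module Component {b b′ : Fin n} (b-rep : IsRep b) (b′-rep : IsRep b′)
                       (j : Fin (nSimp q b)) (j′ : Fin (nSimp q b′)) where
        private
          open module KLₘ = KBMod (KL-isKB {b′})
          open SetoidReasoning ≈ᴹ-setoid
          τ = face q b j
          τ-isFace = face-isFace q b j
          τ-weak = chain⇒weak τ (proj₁ τ-isFace)
          top-τ : top τ ≡ b
          top-τ = face-top τ-isFace
          φ′ = φ.φ q b′ j′

        φψ : (Fin n → K) → Fin n → K
        φψ = φ′ ∘ ψ (C-isKB q) b [ τ ]

        φψ-linear : IsLinear (KL b) (KL b′) φψ
        φψ-linear = ∘-linear (KL-isMod b′) (φ.φ-linear q b′ j′) (ψ-linear (C-isKB q) b [ τ ])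

        φψ-δ : ∀ {a} → a ≡Λ b → φψ (δ a) ≈ᴹ a ▷ T (key b) (φ′ [ τ ])
        φψ-δ {a} p = begin
          φψ (δ a)                             ≈⟨ φ′-hom.cong (ψ-δ (C-isKB q) [ τ ] p) ⟩
          φ′ (a Cₘ.▷ Cₘ.T (key b) [ τ ])       ≈⟨ φ′-hom.▷-hom a (Cₘ.T (key b) [ τ ]) ⟩
          a ▷ φ′ (Cₘ.T (key b) [ τ ])          ≈⟨ ▷-cong a (T-natural (C-isKB q) KL-isKB (φ.φ-isHom q b′ j′) (key b) [ τ ]) ⟩
          a ▷ T (key b) (φ′ [ τ ])             ∎
          where
          module Cₘ = KBMod (C-isKB q)
          module φ′-hom = IsHom (φ.φ-isHom q b′ j′)

        ▷T-linear : ∀ a → IsLinear (KL b′) (KL b′) (λ m → a ▷ T (key b) m)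
        ▷T-linear a = ∘-linear isMod (▷-linear a) (T-linear (key b))

        φψ-miss : ¬ (b′ ⊑ b × map (b′ ·_) τ ≡ face q b′ j′) → ∀ {a} → a ≡Λ b → φψ (δ a) ≈ᴹ 0ᴹ
        φψ-miss h {a} p = begin
          φψ (δ a)                     ≈⟨ φψ-δ p ⟩
          a ▷ T (key b) (φ′ [ τ ])     ≈⟨ IsLinear.cong (▷T-linear a) (φ.φ-miss q b′ j′ τ
                                            (λ (h₁ , h₂) → h (≡.subst (b′ ⊑_) top-τ h₁ , h₂))) ⟩
          a ▷ T (key b) 0ᴹ             ≈⟨ Linear.0-hom isMod isMod (▷T-linear a) ⟩
          0ᴹ                           ∎

        -- The top of `τ` is `b`, so `φ′` sends `τ` to b b′, and the factor `b` is absorbed because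
        -- `a` generates the same left ideal as `b`.
        φψ-hit : b′ ⊑ b → map (b′ ·_) τ ≡ face q b′ j′ → ∀ {a} → a ≡Λ b → φψ (δ a) ≈ᴹ a ▷ T (key b) (δ b′)
        φψ-hit h₁ h₂ {a} p = begin
          φψ (δ a)                          ≈⟨ φψ-δ p ⟩
          a ▷ T (key b) (φ′ [ τ ])          ≈⟨ IsLinear.cong (▷T-linear a) (φ.φ-hit q b′ j′ τ τ-weak (≡.subst (b′ ⊑_) (≡.sym top-τ) h₁) h₂) ⟩
          a ▷ T (key b) (δ (top τ · b′))    ≡⟨ ≡.cong (λ x → a ▷ T (key b) (δ (x · b′))) top-τ ⟩
          a ▷ T (key b) (δ (b · b′))        ≈⟨ IsLinear.cong (▷T-linear a) (▷-δ h₁ (≡Λ-refl b′)) ⟨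
          a ▷ T (key b) (b ▷ δ b′)          ≈⟨ ▷-T-absorb (key b) (≡Λ⇒⊑ p) (δ b′) ⟩
          a ▷ T (key b) (δ b′)              ∎

        -- A hit requires B b′ to lie strictly inside B b. Then 1 - b′ is among the factors of
        -- `T (key b)` and kills `δ b′`.
        φψ-zero : b ≢ b′ → ∀ g → φψ g ≈ᴹ 0ᴹ
        φψ-zero b≢b′ = 𝕃.ext b (KL-isMod b′) φψ-linear (zero-linear isMod)
          λ a p → cases p (b′ · b ≟F b′) (map (b′ ·_) τ ≟V face q b′ j′)
          where
          cases : ∀ {a} → a ≡Λ b → Dec (b′ ⊑ b) → Dec (map (b′ ·_) τ ≡ face q b′ j′) → φψ (δ a) ≈ᴹ 0ᴹ
          cases p (no ¬h) _ = φψ-miss (¬h ∘ proj₁) p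
          cases p (yes _) (no ¬h) = φψ-miss (¬h ∘ proj₂) p
          cases {a} p (yes h₁) (yes h₂) = begin
            φψ (δ a)                 ≈⟨ φψ-hit h₁ h₂ p ⟩
            a ▷ T (key b) (δ b′)     ≈⟨ ▷-cong a (T-δ-rep b′-rep (key b) (key-mono-< (h₁ , λ h → b≢b′ (rep-unique b-rep b′-rep (⊑-antisym h h₁))))) ⟩
            a ▷ 0ᴹ                   ≈⟨ ▷-Lin.0-hom a ⟩
            0ᴹ                       ∎

      -- `b` fixes its faces, so the simplex is hit, and every factor of `T (key b)` acts as the
      -- identity on kL_X.
      φψ-diagonal : ∀ {b} (r : IsRep b) j j′ → j ≡ j′ →
                    ∀ g → RawKBMod._≈ᴹ_ (KL b) (Component.φψ r r j j′ g) g
      φψ-diagonal {b} r j .j refl = 𝕃.ext b isMod φψ-linear (id-linear isMod) λ a p → begin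
          φψ (δ a)                 ≈⟨ φψ-hit (⊑-refl b) (face-fixed (face-isFace q b j)) p ⟩
          a ▷ T (key b) (δ b)      ≈⟨ ▷-cong a (T-identity-below r (key b) ℕₚ.≤-refl (δ b)) ⟩
          a ▷ δ b                  ≈⟨ ▷-δ (≡Λ⇒⊒ p) (≡Λ-refl b) ⟩
          δ (a · b)                ≡⟨ ≡.cong δ (≡Λ⇒⊑ p) ⟩
          δ a                      ∎
        where
        open Component r r j j
        open KBMod (KL-isKB {b})
        open SetoidReasoning ≈ᴹ-setoid

      φψ-off-diagonal : ∀ {b} (r : IsRep b) j j′ → j ≢ j′ →
                        ∀ g → RawKBMod._≈ᴹ_ (KL b) (Component.φψ r r j j′ g) (RawKBMod.0ᴹ (KL b))
      φψ-off-diagonal {b} r j j′ j≢j′ = 𝕃.ext b (KL-isMod b) φψ-linear (zero-linear (KL-isMod b)) λ a p →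
        φψ-miss (λ (_ , h) → j≢j′ (Faces.elem-injective b
          (≡.trans (≡.sym (face-fixed (face-isFace q b j))) h))) p
        where open Component r r j j′

      ΦΨ≈id : ∀ g → Φ q (ΨC q g) D.≈ᴹ g
      ΦΨ≈id g b′ b′-rep j′ = begin
        φ′ (ΨC q g)                                                 ≈⟨ φᴸ.⅀-hom Fn _ ⟩
        ⅀ Fn (λ b → φ′ (Cₘ.whenᴹ (e b ≟F b) (Ψ-part b)))            ≈⟨ ⅀-cong Fn (λ b → φᴸ.when-hom (e b ≟F b) (Ψ-part b)) ⟩
        ⅀ Fn (λ b → whenᴹ (e b ≟F b) (φ′ (Ψ-part b)))               ≈⟨ ⅀-single Fn b′ (λ b b≢b′ → off b b≢b′ (e b ≟F b)) ⟩
        whenᴹ (e b′ ≟F b′) (φ′ (Ψ-part b′))                         ≈⟨ whenᴹ-yes (e b′ ≟F b′) b′-rep ⟩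
        φ′ (Ψ-part b′)                                              ≈⟨ φᴸ.⅀-hom (finSummation (nSimp q b′)) _ ⟩
        ⅀ (finSummation (nSimp q b′)) (λ j → Component.φψ b′-rep b′-rep j j′ (g b′ j))
                                                                    ≈⟨ ⅀-single (finSummation (nSimp q b′)) j′ (λ j j≢j′ → φψ-off-diagonal b′-rep j j′ j≢j′ (g b′ j)) ⟩
        Component.φψ b′-rep b′-rep j′ j′ (g b′ j′)                  ≈⟨ φψ-diagonal b′-rep j′ j′ refl (g b′ j′) ⟩
        g b′ j′                                                     ∎
        where
        open KBMod (KL-isKB {b′})
        open SetoidReasoning ≈ᴹ-setoid
        module Cₘ = KBMod (C-isKB q)
        φ′ = φ.φ q b′ j′
        module φᴸ = Linear (C-isMod q) (KL-isMod b′) (φ.φ-linear q b′ j′)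
        Ψ-part : ∀ b → Cₘ.M
        Ψ-part b = Cₘ.⅀ (finSummation (nSimp q b)) (λ j → ψ (C-isKB q) b [ face q b j ] (g b j))
        off : ∀ b → b ≢ b′ → (r : Dec (IsRep b)) → whenᴹ r (φ′ (Ψ-part b)) ≈ᴹ 0ᴹ
        off b b≢b′ (no _) = ≈ᴹ-refl
        off b b≢b′ (yes r) = ≈ᴹ-trans (φᴸ.⅀-hom (finSummation (nSimp q b)) _)
          (⅀-zero (finSummation (nSimp q b)) (λ j → Component.φψ-zero r b′-rep j j′ b≢b′ (g b j)))

      ΨC-isHom : IsHom (D e q) (C q) (ΨC q)
      ΨC-isHom = Ψ-isHom q (C-isKB q) (basisFaces q)

      C≅D : Iso (C q) (D e q)
      C≅D = record { isHom = Φ-isHom q } , record { isHom = ΨC-isHom } , ΨΦ≈id , ΦΨ≈id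

      -- Preimages under `g` are chosen for the images of the listed faces only. As `Ψ` is natural
      -- in the target, g after the lift and h after `ΨC q ∘ Φ q` are both built from the same
      -- elements of the codomain, and the latter map is h.
      C-projective : ∀ m ℓm m′ ℓm′ → Projective m ℓm m′ ℓm′ (C q)
      C-projective m ℓm m′ ℓm′ Mo No g surj h =
        record { fun = Ψ q Mᵏ.isKBModule generators ∘ Φ q ; isHom = l-isHom } , λ x → begin
          g.fun (Ψ q Mᵏ.isKBModule generators (Φ q x))  ≈⟨ Ψ-natural q Mᵏ.isKBModule Nᵏ.isKBModule g.isHom (λ b j → proj₂ (surj _)) (Φ q x) ⟩
          Ψ q Nᵏ.isKBModule images (Φ q x)              ≈⟨ Ψ-natural q (C-isKB q) Nᵏ.isKBModule h.isHom (λ b j → ≈ᴹ-refl) (Φ q x) ⟨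
          h.fun (ΨC q (Φ q x))                          ≈⟨ IsHom.cong h.isHom (ΨΦ≈id x) ⟩
          h.fun x                                       ∎
        where
        module Mᵏ = KBModule Mo
        module Nᵏ = KBModule No
        module g = Hom g
        module h = Hom h
        open KBMod Nᵏ.isKBModule
        open SetoidReasoning ≈ᴹ-setoid
        images : Generators q Nᵏ.M
        images b j = h.fun [ face q b j ]
        generators : Generators q Mᵏ.M
        generators b j = proj₁ (surj (images b j))
        Ψ-hom = Ψ-isHom q Mᵏ.isKBModule generators
        Mᵏ-isMod = KBMod.isMod Mᵏ.isKBModule
        l-isHom : IsHom (C q) Mᵏ.raw (Ψ q Mᵏ.isKBModule generators ∘ Φ q)
        l-isHom = record
          { IsLinear (∘-linear Mᵏ-isMod (hom⇒linear Ψ-hom) (hom⇒linear (Φ-isHom q)))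
          ; ▷-hom = λ b x → Mod.≈ᴹ-trans Mᵏ.raw Mᵏ-isMod (IsHom.cong Ψ-hom (IsHom.▷-hom (Φ-isHom q) b x))
              (IsHom.▷-hom Ψ-hom b (Φ q x))
          }

    -- Connectedness and the vanishing of 1 - Σ f_X

    module _ (connected : Connected) where

      private
        module C₀ = KBMod (C-isKB 0)
        module L {x} = KBMod (KL-isKB {x})

        ⊏-noetherian : ∀ x → Acc (flip _⊏_) x
        ⊏-noetherian = spo-noetherian {_≈_ = _≡_} record
          { isEquivalence = ≡.isEquivalence
          ; irrefl = λ { refl (p , ¬p) → ¬p p }
          ; trans = λ (p , ¬p) (q , ¬q) → ⊑-trans p q , λ r → ¬q (⊑-trans r p)
          ; <-resp-≈ = (λ { refl p → p }) , (λ { refl p → p })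
          }

      -- 1 - Σ f_X maps kB to elements with no coefficients on L_X, where X = B x.
      Vanishes : Fin n → Set ℓ
      Vanishes x = ∀ b {a} → a ≡Λ x → C₀.T keyBound [ b ∷ [] ] (a ∷ []) ≈K 0#

      module _ {x : Fin n} (x-rep : IsRep x) (above : ∀ {y} → x ⊏ y → Vanishes y) {a} (a≡x : a ≡Λ x) where

        private
          value : Fin n → K
          value b = C₀.T keyBound [ b ∷ [] ] (a ∷ [])

          -- For a vertex c both conditions of a hit amount to `z ⊑ c`, so this is the homomorphism
          -- from kB to kL_X given by right multiplication by `z`.
          module φ₀ {z} (z≡x : z ≡Λ x) = Coordinate {q = 0} x z z≡x (z ∷ []) _

          -- Right multiplication by `z` moves onto `a` the coefficients of all c with c z = a. Any
          -- such c other than `a` has support strictly above X, where the coefficients vanish by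
          -- hypothesis.
          value-φ : ∀ {z} (z≡x : z ≡Λ x) b → value b ≈K L.T {x} keyBound (φ₀.φ z≡x [ b ∷ [] ]) a
          value-φ {z} z≡x b = begin
            value b                                              ≈⟨ φ₀.φ-single z≡x (a ∷ []) _ z⊑a (≡.cong (_∷ []) z⊑a)
                                                                     (⊑-trans (≡Λ⇒⊑ a≡x) (≡Λ⇒⊒ z≡x)) (C₀.T keyBound [ b ∷ [] ]) others ⟨
            φ₀.φ z≡x (C₀.T keyBound [ b ∷ [] ]) a                ≈⟨ T-natural (C-isKB 0) KL-isKB (φ₀.φ-isHom z≡x) keyBound [ b ∷ [] ] a a≡x ⟩
            L.T {x} keyBound (φ₀.φ z≡x [ b ∷ [] ]) a             ∎
            where
            open SetoidReasoning 𝕋.≈ᴹ-setoid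
            z⊑a = ⊑-trans (≡Λ⇒⊑ z≡x) (≡Λ⇒⊒ a≡x)
            others : ∀ ρ → ρ ≢ a ∷ [] → z ⊑ top ρ → top ρ · z ≡ a → C₀.T keyBound [ b ∷ [] ] ρ ≈K 0#
            others (c ∷ []) c≢a z⊑c cz≡a = above
              (⊑-trans (≡Λ⇒⊒ z≡x) z⊑c , λ c⊑x → c≢a (≡.cong (_∷ []) (≡.trans (≡.sym (⊑-trans c⊑x (≡Λ⇒⊒ z≡x))) cz≡a)))
              b (≡Λ-refl c)

          value-δ : ∀ {z} → z ≡Λ x → ∀ b → z ⊑ b → value b ≈K L.T {x} keyBound (δ (b · z)) a
          value-δ {z} z≡x b z⊑b = 𝕂.trans (value-φ z≡x b)
            (IsLinear.cong (L.T-linear {x} keyBound) (φ₀.φ-hit z≡x (b ∷ []) ([] ∷ []) z⊑b (≡.cong (_∷ []) z⊑b)) a a≡x)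

          value-outside : ∀ b → ¬ (x ⊑ b) → value b ≈K 0#
          value-outside b ¬p = 𝕂.trans (value-φ (≡Λ-refl x) b)
            (𝕂.trans (T.cong (φ₀.φ-miss (≡Λ-refl x) (b ∷ []) (¬p ∘ proj₁)) a a≡x) (T.0-hom a a≡x))
            where module T = Linear (KL-isMod x) (KL-isMod x) (L.T-linear {x} keyBound)

          -- Multiply `b` by `b′ · x` and `b′` by `x`, both elements of L_X: the products agree
          -- since `b · b′ ≡ b′`.
          value-≤ : ∀ {b b′} → x ⊑ b′ → b′ ≤ b → value b ≈K value b′
          value-≤ {b} {b′} x⊑b′ b′≤b = begin
            value b                                      ≈⟨ value-δ (·-≡Λ x⊑b′ (≡Λ-refl x)) b
                                                              (⊑-trans (·-⊑ˡ b′ x) (≤⇒⊑ b′≤b)) ⟩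
            L.T {x} keyBound (δ (b · (b′ · x))) a        ≡⟨ ≡.cong (λ y → L.T {x} keyBound (δ y) a)
                                                              (≡.trans (≡.sym (assoc b b′ x)) (≡.cong (_· x) b′≤b)) ⟩
            L.T {x} keyBound (δ (b′ · x)) a              ≈⟨ value-δ (≡Λ-refl x) b′ x⊑b′ ⟨
            value b′                                     ∎
            where open SetoidReasoning 𝕋.≈ᴹ-setoid

          value-connected : ∀ {b b′} → Star (Adj≥ x) b b′ → value b ≈K value b′
          value-connected ⟨⟩ = 𝕂.refl
          value-connected ((_ , q , inj₂ r) ◅ path) = 𝕂.trans (value-≤ (⊆Λ⇒⊑ q) r) (value-connected path)
          value-connected ((p , _ , inj₁ r) ◅ path) = 𝕂.trans (𝕂.sym (value-≤ (⊆Λ⇒⊑ p) r)) (value-connected path)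

          value-rep : value x ≈K 0#
          value-rep = begin
            value x                             ≈⟨ value-δ (≡Λ-refl x) x (⊑-refl x) ⟩
            L.T {x} keyBound (δ (x · x)) a      ≡⟨ ≡.cong (λ y → L.T {x} keyBound (δ y) a) (idem x) ⟩
            L.T {x} keyBound (δ x) a            ≈⟨ T-δ-rep x-rep keyBound (key<keyBound x) a a≡x ⟩
            0#                                  ∎
            where open SetoidReasoning 𝕋.≈ᴹ-setoid

        vanishes-step : ∀ b → value b ≈K 0#
        vanishes-step b = cases (x ⊆Λ? b)
          where
          cases : Dec (x ⊆Λ b) → value b ≈K 0#
          cases (no ¬p) = value-outside b (¬p ∘ ⊑⇒⊆Λ)
          cases (yes p) = 𝕂.trans
            (value-connected (connected x b x p (proj₁ (≡Λ-refl x)))) value-rep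

        -- Right multiplication by `x` fixes `b`, so these coefficients can be computed in kL_X as
        -- well as in kB.
        T-δ≈value : ∀ {b} → b ≡Λ x → L.T {x} keyBound (δ b) a ≈K C₀.T keyBound [ b ∷ [] ] (a ∷ [])
        T-δ≈value {b} p = 𝕂.sym (𝕂.trans (value-δ (≡Λ-refl x) b (≡Λ⇒⊒ p))
          (𝕂.reflexive (≡.cong (λ y → L.T {x} keyBound (δ y) a) (≡Λ⇒⊑ p))))

      vanishes : ∀ x → Vanishes x
      vanishes x b {a} a≡x = go (e x) (⊏-noetherian (e x)) (e-isRep x) b
        (≡Λ-trans a≡x (≡Λ-sym (proj₁ choice x)))
        where
        go : ∀ x → Acc (flip _⊏_) x → IsRep x → Vanishes x
        go x (acc rs) x-rep b a≡x = vanishes-step x-rep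
          -- The recursion visits representatives only: `e y` generates the same left ideal as `y`
          -- and is thus strictly above `x` too.
          (λ {y} (x⊑y , ¬y⊑x) b a≡y → go (e y) (rs (⊑-trans x⊑y (⊑-e y) , λ h → ¬y⊑x (⊑-trans (⊑-e y) h))) (e-isRep y) b
            (≡Λ-trans a≡y (≡Λ-sym (proj₁ choice y)))) a≡x b

      KL-T-zero : ∀ {x} → IsRep x → ∀ g → RawKBMod._≈ᴹ_ (KL x) (L.T keyBound g) (RawKBMod.0ᴹ (KL x))
      KL-T-zero {x} x-rep = 𝕃.ext x (KL-isMod x) (L.T-linear keyBound) (zero-linear (KL-isMod x)) λ b p a a≡x →
        𝕂.trans (T-δ≈value x-rep (λ {y} _ → vanishes y) a≡x p) (vanishes x b a≡x)

      -- `Φ` embeds C_q into a sum of copies of kL_X, and `T keyBound` commutes with each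
      -- coordinate.
      C-T-zero : ∀ q x → RawKBMod._≈ᴹ_ (C q) (KBMod.T (C-isKB q) keyBound x) (RawKBMod.0ᴹ (C q))
      C-T-zero q x = begin
        T keyBound x                    ≈⟨ ΨΦ≈id q (T keyBound x) ⟨
        ΨC q (Φ q (T keyBound x))       ≈⟨ IsLinear.cong Ψ-lin (λ b b-rep j → Mod.≈ᴹ-trans (KL b) (KL-isMod b)
                                             (T-natural (C-isKB q) KL-isKB (φ.φ-isHom q b j) keyBound x)
                                             (KL-T-zero b-rep (φ.φ q b j x))) ⟩
        ΨC q (λ _ _ _ → 0#)             ≈⟨ IsLinear.cong Ψ-lin (λ b b-rep j → Mod.≈ᴹ-sym (KL b) (KL-isMod b) (φᴸ.0-hom b j)) ⟩
        ΨC q (Φ q 0ᴹ)                   ≈⟨ ΨΦ≈id q 0ᴹ ⟩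
        0ᴹ                              ∎
        where
        open KBMod (C-isKB q)
        open SetoidReasoning ≈ᴹ-setoid
        Ψ-lin = Ψ-linear q (C-isKB q) (basisFaces q)
        module φᴸ b j = Linear (C-isMod q) (KL-isMod b) (φ.φ-linear q b j)

      -- If Σ f_X = 1 on A then a cycle is Σ b ▷ (cycle), so it suffices that B maps cycles to boundaries.
      cycle⇒boundary : ∀ {m₁ ℓ₁ m₂ ℓ₂ m₃ ℓ₃} {E : RawKBMod m₁ ℓ₁} {A : RawKBMod m₂ ℓ₂} {A′ : RawKBMod m₃ ℓ₃}
        (mE : IsMod E) (kA : IsKBModule A) (kA′ : IsKBModule A′) {∂₁ : RawKBMod.M E → RawKBMod.M A}
        {∂₀ : RawKBMod.M A → RawKBMod.M A′} → IsLinear E A ∂₁ → IsHom A A′ ∂₀ →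
        (∀ x → RawKBMod._≈ᴹ_ A (KBMod.T kA keyBound x) (RawKBMod.0ᴹ A)) →
        (∀ b x → RawKBMod._≈ᴹ_ A′ (∂₀ x) (RawKBMod.0ᴹ A′) → ∃[ g ] (RawKBMod._≈ᴹ_ A (∂₁ g) (RawKBMod._▷_ A b x))) →
        ∀ x → RawKBMod._≈ᴹ_ A′ (∂₀ x) (RawKBMod.0ᴹ A′) → ∃[ g ] (RawKBMod._≈ᴹ_ A (∂₁ g) x)
      cycle⇒boundary {E = E} mE kA kA′ {∂₁} {∂₀} ∂₁-linear ∂₀-hom T-zero contract x x-cycle =
        E.⅀ Fn (λ b → proj₁ (term b (e b ≟F b))) , (begin
          ∂₁ (E.⅀ Fn (λ b → proj₁ (term b (e b ≟F b))))              ≈⟨ ∂₁ᴸ.⅀-hom Fn _ ⟩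
          ⅀ Fn (λ b → ∂₁ (proj₁ (term b (e b ≟F b))))                ≈⟨ ⅀-cong Fn (λ b → proj₂ (term b (e b ≟F b))) ⟩
          ⅀ Fn (λ b → whenᴹ (e b ≟F b) (f b x))                      ≈⟨ +ᴹ-identityʳ _ ⟨
          ⅀ Fn (λ b → whenᴹ (e b ≟F b) (f b x)) +ᴹ 0ᴹ                ≈⟨ +ᴹ-congˡ (T-zero x) ⟨
          ⅀ Fn (λ b → whenᴹ (e b ≟F b) (f b x)) +ᴹ T keyBound x      ≈⟨ Σf-identity x ⟩
          x                                                            ∎)
        where
        module E = Mod E mE
        module A′ = KBMod kA′
        open KBMod kA
        open SetoidReasoning ≈ᴹ-setoid
        module ∂₁ᴸ = Linear mE isMod ∂₁-linear
        T-cycle : ∀ k → ∂₀ (T k x) A′.≈ᴹ A′.0ᴹ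
        T-cycle k = A′.≈ᴹ-trans (T-natural kA kA′ ∂₀-hom k x)
          (A′.≈ᴹ-trans (T′.cong x-cycle) T′.0-hom)
          where module T′ = Linear A′.isMod A′.isMod (A′.T-linear k)
        term : ∀ b (d : Dec (IsRep b)) → ∃[ g ] (∂₁ g ≈ᴹ whenᴹ d (f b x))
        term b (no _) = E.0ᴹ , ∂₁ᴸ.0-hom
        -- f_b x is `b` applied to `T (key b) x`, which is again a cycle because `T` commutes with
        -- `∂₀`.
        term b (yes _) = contract b (T (key b) x) (T-cycle (key b))

      -- Cones and exactness

      signℕ : ℕ → K
      signℕ zero = 1#
      signℕ (suc k) = -K signℕ k

      signℕ² : ∀ k → signℕ k *K signℕ k ≈K 1#
      signℕ² zero = 𝕂.*-identityˡ 1#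
      signℕ² (suc k) = begin
        -K s *K -K s        ≈⟨ 𝕂ₚ.-‿distribˡ-* s (-K s) ⟨
        -K (s *K -K s)      ≈⟨ 𝕂.-‿cong (𝕂ₚ.-‿distribʳ-* s s) ⟨
        -K (-K (s *K s))    ≈⟨ 𝕂ₚ.-‿involutive (s *K s) ⟩
        s *K s              ≈⟨ signℕ² k ⟩
        1#                  ∎
        where
        open SetoidReasoning 𝕋.≈ᴹ-setoid
        s = signℕ k

      module _ {m ℓm} {A : RawKBMod m ℓm} (mA : IsMod A) where
        open Mod A mA
        open Boundary mA

        -- Chains increase, so the apex of a cone stands last; removing it gives the face of index m
        -- + 1, whence the sign.
        d-∷ʳ : ∀ {m} (G : Vec (Fin n) (suc m) → M) x (w : Vec (Fin n) (suc m)) →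
               d G (w ∷ʳ x) ≈ᴹ d (λ u → G (u ∷ʳ x)) w +ᴹ signℕ (suc m) *ₗ G w
        d-∷ʳ G x (y ∷ []) = +ᴹ-congˡ (≈ᴹ-trans (-ᴹ‿cong (≈ᴹ-sym (*ₗ-identityˡ _))) (≈ᴹ-sym (-ᴹ-*ₗ 1# _)))
        d-∷ʳ {suc m} G x (y ∷ w@(_ ∷ _)) = begin
          G (w ∷ʳ x) +ᴹ -ᴹ d (G ∘ (y ∷_)) (w ∷ʳ x)                      ≈⟨ +ᴹ-congˡ (-ᴹ‿cong (d-∷ʳ (G ∘ (y ∷_)) x w)) ⟩
          G (w ∷ʳ x) +ᴹ -ᴹ (dG +ᴹ signℕ (suc m) *ₗ G (y ∷ w))           ≈⟨ +ᴹ-congˡ (⁻¹-∙-comm _ _) ⟨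
          G (w ∷ʳ x) +ᴹ (-ᴹ dG +ᴹ -ᴹ (signℕ (suc m) *ₗ G (y ∷ w)))      ≈⟨ +ᴹ-assoc _ _ _ ⟨
          (G (w ∷ʳ x) +ᴹ -ᴹ dG) +ᴹ -ᴹ (signℕ (suc m) *ₗ G (y ∷ w))      ≈⟨ +ᴹ-congˡ (-ᴹ-*ₗ _ _) ⟨
          (G (w ∷ʳ x) +ᴹ -ᴹ dG) +ᴹ signℕ (suc (suc m)) *ₗ G (y ∷ w)     ∎
          where
          open SetoidReasoning ≈ᴹ-setoid
          dG = d (λ u → G (y ∷ (u ∷ʳ x))) w

      -- The cone over b ▷ f with apex b.
      cone : ∀ q → Fin n → RawKBMod.M (C q) → RawKBMod.M (C (suc q))
      cone q b = ℂ.lin q (C-isMod (suc q)) (λ w → [ map (b ·_) w ∷ʳ b ])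

      module _ (q : ℕ) (b : Fin n) where
        open Mod (C (suc q)) (C-isMod (suc q))

        cone-linear : IsLinear (C q) (C (suc q)) (cone q b)
        cone-linear = ℂ.lin-linear q (C-isMod (suc q)) (λ w → [ map (b ·_) w ∷ʳ b ])

        cone-[] : ∀ {w} → Weak w → cone q b [ w ] ≈ᴹ [ map (b ·_) w ∷ʳ b ]
        cone-[] {w} p with isChain? w
        ... | yes chain = ℂ.lin-δ q (C-isMod (suc q)) (λ w → [ map (b ·_) w ∷ʳ b ]) chain
        ... | no ¬chain = begin
          cone q b [ w ]               ≈⟨ coneᴸ.cong (ℂ.δ-junk q ¬chain) ⟩
          cone q b (λ _ → 0#)          ≈⟨ coneᴸ.0-hom ⟩
          0ᴹ                           ≈⟨ ℂ.δ-junk (suc q) (¬chain ∘ chain-map⁻ b p ∘ chain-init (map (b ·_) w)) ⟨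
          [ map (b ·_) w ∷ʳ b ]        ∎
          where
          open SetoidReasoning ≈ᴹ-setoid
          module coneᴸ = Linear (C-isMod q) (C-isMod (suc q)) cone-linear

        weak-cone : ∀ {w : Vec (Fin n) (suc q)} → Weak w → Weak (map (b ·_) w ∷ʳ b)
        weak-cone {w} p = weak-snoc (weak-map b p) (All-map-≤ b w)

      ∂-cone : ∀ q b f → RawKBMod._≈ᴹ_ (C (suc q)) (∂ (suc q) (cone (suc q) b f))
                 (RawKBMod._+ᴹ_ (C (suc q)) (cone q b (∂ q f))
                   (RawKBMod._*ₗ_ (C (suc q)) (signℕ (suc (suc q))) (RawKBMod._▷_ (C (suc q)) b f)))
      ∂-cone q b = ℂ.ext (suc q) isMod
        (∘-linear isMod (∂-linear (suc q)) (cone-linear (suc q) b))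
        (+-linear isMod (∘-linear isMod (cone-linear q b) (∂-linear q))
          (∘-linear isMod scale-linear (C-▷-linear b)))
        λ w chain → basis (chain⇒weak w chain)
        where
        isMod = C-isMod (suc q)
        open Mod (C (suc q)) isMod
        open SetoidReasoning ≈ᴹ-setoid
        s = signℕ (suc (suc q))
        module 𝔹 = Boundary isMod

        scale-linear : IsLinear (C (suc q)) (C (suc q)) (s *ₗ_)
        scale-linear = record
          { cong = *ₗ-cong 𝕂.refl
          ; +-hom = *ₗ-distribˡ s
          ; *ₗ-hom = λ r x → ≈ᴹ-trans (≈ᴹ-sym (*ₗ-assoc s r x))
              (≈ᴹ-trans (*ₗ-cong (𝕂.*-comm s r) ≈ᴹ-refl) (*ₗ-assoc r s x))
          }

        basis : ∀ {w} → Weak w → ∂ (suc q) (cone (suc q) b [ w ]) ≈ᴹ cone q b (∂ q [ w ]) +ᴹ s *ₗ (b ▷ [ w ])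
        basis {w} p = begin
          ∂ (suc q) (cone (suc q) b [ w ])                              ≈⟨ IsLinear.cong (∂-linear (suc q)) (cone-[] (suc q) b p) ⟩
          ∂ (suc q) [ bw ∷ʳ b ]                                         ≈⟨ ∂-[] (suc q) (weak-cone (suc q) b p) ⟩
          𝔹.d [_] (bw ∷ʳ b)                                             ≈⟨ d-∷ʳ isMod [_] b bw ⟩
          𝔹.d (λ u → [ u ∷ʳ b ]) bw +ᴹ s *ₗ [ bw ]                      ≡⟨ ≡.cong (_+ᴹ s *ₗ [ bw ]) (𝔹.d-map (λ u → [ u ∷ʳ b ]) (b ·_) w) ⟩
          𝔹.d (λ u → [ map (b ·_) u ∷ʳ b ]) w +ᴹ s *ₗ [ bw ]            ≈⟨ +ᴹ-cong (𝔹.d-cong w (λ i → cone-[] q b (weak-removeAt p i)))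
                                                                            (*ₗ-cong 𝕂.refl (▷-[] b p)) ⟨
          𝔹.d (cone q b ∘ [_]) w +ᴹ s *ₗ (b ▷ [ w ])                    ≈⟨ +ᴹ-congʳ (d-natural (C-isMod q) isMod (cone-linear q b) [_] w) ⟨
          cone q b (Boundary.d (C-isMod q) [_] w) +ᴹ s *ₗ (b ▷ [ w ])   ≈⟨ +ᴹ-congʳ (IsLinear.cong (cone-linear q b) (∂-[] q p)) ⟨
          cone q b (∂ q [ w ]) +ᴹ s *ₗ (b ▷ [ w ])                      ∎
          where bw = map (b ·_) w

      -- Here the place of the cone over `∂ f` is taken by the apex itself: each edge from b x to b
      -- has the vertex b as a face, and these add up with total coefficient `ε f`.
      ∂-cone₀ : ∀ b f → RawKBMod._≈ᴹ_ (C 0) (∂ 0 (cone 0 b f))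
                  (RawKBMod._+ᴹ_ (C 0) (RawKBMod._*ₗ_ (C 0) (ε f) [ b ∷ [] ])
                    (RawKBMod.-ᴹ_ (C 0) (RawKBMod._▷_ (C 0) b f)))
      ∂-cone₀ b = ℂ.ext 0 isMod
        (∘-linear isMod (∂-linear 0) (cone-linear 0 b))
        (+-linear isMod (∘-linear isMod scaled-linear ε-linear) (-‿linear isMod (C-▷-linear b)))
        λ { w@(x ∷ []) _ → begin
          ∂ 0 (cone 0 b [ w ])                                  ≈⟨ IsLinear.cong (∂-linear 0) (cone-[] 0 b ([] ∷ [])) ⟩
          ∂ 0 [ b · x ∷ b ∷ [] ]                                ≈⟨ ∂-[] 0 (weak-cone 0 b {w} ([] ∷ [])) ⟩
          [ b ∷ [] ] +ᴹ -ᴹ [ b · x ∷ [] ]                       ≈⟨ +ᴹ-cong (≈ᴹ-trans (*ₗ-cong (ε-[] w) ≈ᴹ-refl) (*ₗ-identityˡ _))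
                                                                    (-ᴹ‿cong (▷-[] b {w} ([] ∷ []))) ⟨
          ε [ w ] *ₗ [ b ∷ [] ] +ᴹ -ᴹ (b ▷ [ w ])               ∎ }
        where
        isMod = C-isMod 0
        open Mod (C 0) isMod
        open SetoidReasoning ≈ᴹ-setoid
        scaled-linear : IsLinear triv (C 0) (_*ₗ [ b ∷ [] ])
        scaled-linear = record
          { cong = λ p → *ₗ-cong p ≈ᴹ-refl
          ; +-hom = λ r s → *ₗ-distribʳ _ r s
          ; *ₗ-hom = λ r s → *ₗ-assoc r s _
          }

      exact-C : ∀ q f → RawKBMod._≈ᴹ_ (C q) (∂ q f) (RawKBMod.0ᴹ (C q)) →
                ∃[ g ] (RawKBMod._≈ᴹ_ (C (suc q)) (∂ (suc q) g) f)
      exact-C q = cycle⇒boundary (C-isMod (suc (suc q))) (C-isKB (suc q)) (C-isKB q) (∂-linear (suc q)) (∂-isHom q)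
        -- The sign `s` with which `b ▷ f` enters the boundary of the cone is undone by multiplying
        -- by `s` again, as its square is 1.
        (C-T-zero (suc q)) λ b f f-cycle → s *ₗ′ cone (suc q) b f , (begin
          ∂ (suc q) (s *ₗ′ cone (suc q) b f)                ≈⟨ IsLinear.*ₗ-hom (∂-linear (suc q)) s (cone (suc q) b f) ⟩
          s *ₗ ∂ (suc q) (cone (suc q) b f)                 ≈⟨ *ₗ-cong 𝕂.refl (∂-cone q b f) ⟩
          s *ₗ (cone q b (∂ q f) +ᴹ s *ₗ (b ▷ f))           ≈⟨ *ₗ-cong 𝕂.refl (+ᴹ-congʳ (≈ᴹ-trans (coneᴸ.cong b f-cycle) (coneᴸ.0-hom b))) ⟩
          s *ₗ (0ᴹ +ᴹ s *ₗ (b ▷ f))                         ≈⟨ *ₗ-cong 𝕂.refl (+ᴹ-identityˡ _) ⟩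
          s *ₗ (s *ₗ (b ▷ f))                               ≈⟨ *ₗ-assoc s s _ ⟨
          (s *K s) *ₗ (b ▷ f)                               ≈⟨ *ₗ-cong (signℕ² (suc (suc q))) ≈ᴹ-refl ⟩
          1# *ₗ (b ▷ f)                                     ≈⟨ *ₗ-identityˡ _ ⟩
          b ▷ f                                             ∎)
        where
        open Mod (C (suc q)) (C-isMod (suc q))
        open SetoidReasoning ≈ᴹ-setoid
        open RawKBMod (C (suc (suc q))) using () renaming (_*ₗ_ to _*ₗ′_)
        module coneᴸ b = Linear (C-isMod q) (C-isMod (suc q)) (cone-linear q b)
        s = signℕ (suc (suc q))

      exact-C₀ : ∀ f → ε f ≈K 0# → ∃[ g ] (RawKBMod._≈ᴹ_ (C 0) (∂ 0 g) f)
      exact-C₀ = cycle⇒boundary (C-isMod 1) (C-isKB 0) triv-isKB (∂-linear 0) ε-isHom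
        -- In degree 0 the chain `b ▷ f` enters with sign -1, hence the minus.
        (C-T-zero 0) λ b f f-cycle → RawKBMod.-ᴹ_ (C 1) (cone 0 b f) , (begin
          ∂ 0 (RawKBMod.-ᴹ_ (C 1) (cone 0 b f))             ≈⟨ Linear.-‿hom (C-isMod 1) (C-isMod 0) (∂-linear 0) (cone 0 b f) ⟩
          -ᴹ ∂ 0 (cone 0 b f)                               ≈⟨ -ᴹ‿cong (∂-cone₀ b f) ⟩
          -ᴹ (ε f *ₗ [ b ∷ [] ] +ᴹ -ᴹ (b ▷ f))              ≈⟨ -ᴹ‿cong (+ᴹ-congʳ (≈ᴹ-trans (*ₗ-cong f-cycle ≈ᴹ-refl) (*ₗ-zeroˡ _))) ⟩
          -ᴹ (0ᴹ +ᴹ -ᴹ (b ▷ f))                             ≈⟨ -ᴹ‿cong (+ᴹ-identityˡ _) ⟩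
          -ᴹ (-ᴹ (b ▷ f))                                   ≈⟨ ⁻¹-involutive _ ⟩
          b ▷ f                                             ∎)
        where
        open Mod (C 0) (C-isMod 0)
        open SetoidReasoning ≈ᴹ-setoid

  -- Assembly of the resolution

  resolution : Fin n → Connected → IsProjectiveResolution
  resolution b₀ connected = record
    { C-isKBModule = C-isKB
    ; triv-isKBModule = triv-isKB
    ; ∂-hom = ∂-isHom
    ; ε-hom = ε-isHom
    ; ε∘∂≈0 = ε-∂
    ; ∂∘∂≈0 = ∂-∂
    ; ε-surjective = λ r → (λ σ → r *K [ b₀ ∷ [] ] σ) ,
        𝕂.trans (IsLinear.*ₗ-hom ε-linear r [ b₀ ∷ [] ]) (𝕂.trans (𝕂.*-congˡ (ε-[] (b₀ ∷ []))) (𝕂.*-identityʳ r))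
    ; exact-C₀ = Choice.exact-C₀ rep rep-isRepChoice connected
    ; exact-C = Choice.exact-C rep rep-isRepChoice connected
    ; C-projective = Choice.C-projective rep rep-isRepChoice
    }

theorem5p11 : ∀ {c ℓ} (R : CommutativeRing c ℓ) (n : ℕ) (B : LRB (suc n)) →
    LRBTheory.Connected B →
    KB.IsProjectiveResolution R B ×ω
    ((e : Fin (suc n) → Fin (suc n)) → LRBTheory.IsRepChoice B e →
    ∀ q → KB.Iso R B (KB.C R B q) (KB.D R B e q))
theorem5p11 R n B connected =
  Resolution.resolution R B zero connected ,ω Resolution.Choice.C≅D R B
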